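{- Let $\mathsf{M}$ be a connected paving matroid of rank $k$ and cardinality $n$. Then \[ g_{\mathsf{M}}(t) = g_{\mathsf{U}_{k,n}}(t) - \sum_{h=k}^{n-1}\lambda_h\left(g_{\mathsf{U}_{k,h+1}}(t)+t\cdot g_{\mathsf{U}_{k-1,h}}(t)\right),\] where $g$ denotes Speyer's $g$-polynomial and $\lambda_h$ denotes the number of (stressed) hyperplanes of $\mathsf{M}$ of cardinality $h$.
   Context: All matroids have finite ground sets contained in the positive integers. $\mathsf{U}_{k,n}$ is the uniform matroid of rank $k$ on $n$ elements. A matroid is paving if all its dependent sets have size at least its rank. A subset $A$ is stressed if $\mathsf{M}|_A$ and $\mathsf{M}/A$ are both uniform; in a paving matroid every hyperplane is stressed. Speyer's $g$-polynomial: the base polytope of a matroid $\mathsf{M}$ on $E$ with bases $\mathscr{B}$ is $\mathscr{P}(\mathsf{M})=\operatorname{conv}\{\sum_{i\in B}e_i : B\in\mathscr{B}\}\subseteq\mathbb{R}^E$, with indicator function $\mathbf{1}_{\mathscr{P}(\mathsf{M})}$. A map $f$ from matroids to an abelian group is a valuation if $\sum_i a_if(\mathsf{M}_i)=0$ whenever $\mathsf{M}_1,\dots,\mathsf{M}_s$ are matroids on a common ground set and $a_i\in\mathbb{Z}$ satisfy $\sum_i a_i\mathbf{1}_{\mathscr{P}(\mathsf{M}_i)}=0$. A map $f$ is a covaluation if $\mathsf{M}\mapsto(-1)^{c(\mathsf{M})}f(\mathsf{M})$ is a valuation, where $c(\mathsf{M})$ is the number of connected components of $\mathsf{M}$. Series-parallel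 matroids are the matroids obtained from $\mathsf{U}_{1,2}$ by a sequence of series and parallel extensions, together with $\mathsf{U}_{0,1}$ and $\mathsf{U}_{1,1}$ (in particular they are connected). The map $\mathsf{M}\mapsto g_{\mathsf{M}}(t)\in\mathbb{Z}[t]$ is the unique isomorphism invariant of matroids such that (a) $g$ is covaluative; (b) $g_{\mathsf{M}}(t)=0$ if $\mathsf{M}$ has loops or coloops; (c) $g_{\mathsf{M}}(t)=t^m$ if $\mathsf{M}$ is loopless and coloopless and is isomorphic to a direct sum of $m$ series-parallel matroids.
   Formalization: In the definition of a (co)valuation, base polytopes and their indicator functions are taken in Q^E (rational points, rational convex weights) rather than R^E; integer relations between such indicators hold on R^E exactly when they hold at rational points. -}

module Defs where

open import Level using (Level; 0ℓ)
open import Algebra.Bundles using (AbelianGroup)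
import Algebra.Definitions.RawMonoid as RawMonoidDefs
import Algebra.Properties.CommutativeMonoid.Sum as Sum
open import Data.Bool.Base using (true; false; if_then_else_)
open import Data.Empty using (⊥-elim)
open import Data.Fin.Base using (Fin; zero; suc; _↑ˡ_; _↑ʳ_; splitAt; punchIn)
open import Data.Fin.Permutation using (Permutation; _⟨$⟩ˡ_)
open import Data.Fin.Properties using (all?; any?; splitAt⁻¹-↑ˡ; splitAt⁻¹-↑ʳ)
  renaming (_≟_ to _≟ᶠ_)
open import Data.Fin.Subset
open import Data.Fin.Subset.Properties
open import Data.Integer.Base as ℤ using (ℤ; +_; -[1+_]; 0ℤ; 1ℤ; -1ℤ)
import Data.Integer.Properties as ℤ
open import Data.List.Base as List using (List; []; _∷_)
open import Data.List.Relation.Unary.All using (All)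
open import Data.Nat.Base as ℕ using (ℕ; zero; suc; _⊔_; _⊓_; _≤_; _<_; z≤n; s≤s)
import Data.Nat.Properties as ℕ
open import Data.Product.Base using (∃; _×_; _,_; proj₁; proj₂)
open import Data.Rational.Base as ℚ using (ℚ; 0ℚ; 1ℚ)
import Data.Rational.Properties as ℚ
open import Data.Sum.Base using (_⊎_; inj₁; inj₂)
open import Data.Vec.Base as Vec using ([]; _∷_; lookup; tabulate; take; drop; insertAt; here; there)
open import Data.Vec.Properties using (take-zipWith; drop-zipWith)
open import Function.Bundles using (_⇔_; mk⇔)
open import Relation.Binary.PropositionalEquality
  using (_≡_; refl; sym; trans; cong; cong₂; subst)
open import Relation.Nullary using (¬_; Dec; yes; no; does)
open import Relation.Nullary.Decidable using (_×-dec_; _→-dec_; _⊎-dec_; ¬?; map′; decidable-stable)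
open import Relation.Unary using (Pred; Decidable)

private
  variable
    a ℓ : Level
    m n k : ℕ

------------------------------------------------------------------------
-- Subsets of a finite set

allSubset? : {P : Pred (Subset n) 0ℓ} → Decidable P → Dec (∀ S → P S)
allSubset? P? = map′ (λ ¬∃ S → decidable-stable (P? S) (λ ¬p → ¬∃ (S , ¬p)))
                     (λ all (S , ¬p) → ¬p (all S))
                     (¬? (anySubset? (λ S → ¬? (P? S))))

allSubsets : ∀ n → List (Subset n)
allSubsets zero    = [] ∷ []
allSubsets (suc n) = List.map (outside ∷_) (allSubsets n)
               List.++ List.map (inside ∷_) (allSubsets n)

#subsets : {P : Pred (Subset n) 0ℓ} → Decidable P → ℕ
#subsets {n} P? = List.length (List.filter P? (allSubsets n))

∣p-x∣ : ∀ {p : Subset n} {x} → x ∈ p → suc ∣ p - x ∣ ≡ ∣ p ∣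
∣p-x∣ {p = inside ∷ p} here = cong (λ q → suc ∣ q ∣) (p─⊥≡p p)
∣p-x∣ {p = outside ∷ p} (there x∈p) = ∣p-x∣ x∈p
∣p-x∣ {p = inside ∷ p} (there x∈p) = cong suc (∣p-x∣ x∈p)

p∪⊥≡p : (p : Subset n) → p ∪ ⊥ ≡ p
p∪⊥≡p = ∪-identityʳ

∣p∪y∣ : ∀ {p : Subset n} {y} → y ∉ p → ∣ p ∪ ⁅ y ⁆ ∣ ≡ suc ∣ p ∣
∣p∪y∣ {p = inside ∷ p} {zero} y∉p = ⊥-elim (y∉p here)
∣p∪y∣ {p = outside ∷ p} {zero} y∉p = cong (λ q → suc ∣ q ∣) (p∪⊥≡p p)
∣p∪y∣ {p = inside ∷ p} {suc y} y∉p = cong suc (∣p∪y∣ (λ y∈p → y∉p (there y∈p)))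
∣p∪y∣ {p = outside ∷ p} {suc y} y∉p = ∣p∪y∣ (λ y∈p → y∉p (there y∈p))

------------------------------------------------------------------------
-- Matroids

-- The ground set of a matroid on n elements is Fin n; matroids "on a
-- common ground set" are matroids with the same index n.

record Matroid (n : ℕ) : Set₁ where
  field
    Basis    : Pred (Subset n) 0ℓ
    basis?   : Decidable Basis
    nonempty : ∃ Basis
    exchange : ∀ {A B x} → Basis A → Basis B → x ∈ A → x ∉ B →
               ∃ λ y → y ∈ B × y ∉ A × Basis ((A - x) ∪ ⁅ y ⁆)

open Matroid public

image : Permutation m n → Subset m → Subset n
image π S = tabulate (λ j → lookup S (π ⟨$⟩ˡ j))

infix 4 _≅_
_≅_ : Matroid m → Matroid n → Set
_≅_ {m} {n} M N =
  ∃ λ (π : Permutation m n) → ∀ B → Basis M B ⇔ Basis N (image π B)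

module _ (M : Matroid n) where

  Independent : Pred (Subset n) 0ℓ
  Independent I = ∃ λ B → Basis M B × I ⊆ B

  Dependent : Pred (Subset n) 0ℓ
  Dependent D = ¬ Independent D

  Circuit : Pred (Subset n) 0ℓ
  Circuit C = Dependent C × (∀ D → D ⊂ C → Independent D)

  -- Independence and circuits of the dual matroid, whose bases are the
  -- complements of the bases of M.

  Coindependent : Pred (Subset n) 0ℓ
  Coindependent I = ∃ λ B → Basis M B × I ⊆ ∁ B

  Cocircuit : Pred (Subset n) 0ℓ
  Cocircuit C = ¬ Coindependent C × (∀ D → D ⊂ C → Coindependent D)

  Loop : Pred (Fin n) 0ℓ
  Loop i = ∀ B → Basis M B → i ∉ B

  Coloop : Pred (Fin n) 0ℓ
  Coloop i = ∀ B → Basis M B → i ∈ B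

  independent? : Decidable Independent
  independent? I = anySubset? (λ B → basis? M B ×-dec (I ⊆? B))

  circuit? : Decidable Circuit
  circuit? C = ¬? (independent? C) ×-dec
               allSubset? (λ D → (D ⊂? C) →-dec independent? D)

  rk : Subset n → ℕ
  rk S = List.foldr _⊔_ 0 (List.map ∣_∣
           (List.filter (λ I → independent? I ×-dec (I ⊆? S)) (allSubsets n)))

  rank : ℕ
  rank = rk ⊤

  private
    bounded : (Ss : List (Subset n)) → List.foldr _⊔_ 0 (List.map ∣_∣ Ss) ≤ n
    bounded []       = z≤n
    bounded (S ∷ Ss) = ℕ.⊔-lub (∣p∣≤n S) (bounded Ss)

  rank≤n : rank ≤ n
  rank≤n = bounded (List.filter (λ I → independent? I ×-dec (I ⊆? ⊤)) (allSubsets n))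

  Flat : Pred (Subset n) 0ℓ
  Flat F = ∀ x → x ∉ F → rk F < rk (F ∪ ⁅ x ⁆)

  Hyperplane : Pred (Subset n) 0ℓ
  Hyperplane H = Flat H × suc (rk H) ≡ rank

  hyperplane? : Decidable Hyperplane
  hyperplane? H = all? (λ x → ¬? (x ∈? H) →-dec (rk H ℕ.<? rk (H ∪ ⁅ x ⁆)))
                  ×-dec (suc (rk H) ℕ.≟ rank)

  -- In a paving matroid every hyperplane is stressed, so these are also
  -- the stressed hyperplanes of size h.

  #hyperplanes : ℕ → ℕ
  #hyperplanes h = #subsets (λ H → hyperplane? H ×-dec (∣ H ∣ ℕ.≟ h))

  Paving : Set
  Paving = ∀ D → Dependent D → rank ≤ ∣ D ∣

  infix 4 _∼_
  _∼_ : Fin n → Fin n → Set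
  i ∼ j = i ≡ j ⊎ ∃ λ C → Circuit C × i ∈ C × j ∈ C

  Connected : Set
  Connected = ∀ i j → i ∼ j

  -- Connected components are the equivalence classes of _∼_.

  Component : Pred (Subset n) 0ℓ
  Component S = ∃ λ i → ∀ j → (j ∈ S → i ∼ j) × (i ∼ j → j ∈ S)

  component? : Decidable Component
  component? S = any? (λ i → all? (λ j →
      ((j ∈? S) →-dec (i ∼? j)) ×-dec ((i ∼? j) →-dec (j ∈? S))))
    where
    _∼?_ : ∀ i j → Dec (i ∼ j)
    i ∼? j = (i ≟ᶠ j) ⊎-dec
             anySubset? (λ C → circuit? C ×-dec (i ∈? C) ×-dec (j ∈? C))

  #components : ℕ
  #components = #subsets component?

------------------------------------------------------------------------
-- Uniform matroids

U : ∀ k n → k ≤ n → Matroid n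
U k n k≤n = record
  { Basis    = λ B → ∣ B ∣ ≡ k
  ; basis?   = λ B → ∣ B ∣ ℕ.≟ k
  ; nonempty = first k≤n
  ; exchange = exch
  }
  where
  first : ∀ {k n} → k ≤ n → ∃ λ (B : Subset n) → ∣ B ∣ ≡ k
  first {n = n} z≤n = ⊥ , ∣⊥∣≡0 n
  first (s≤s k≤n) with first k≤n
  ... | B , eq = inside ∷ B , cong suc eq

  exch : ∀ {A B : Subset n} {x} → ∣ A ∣ ≡ k → ∣ B ∣ ≡ k → x ∈ A → x ∉ B →
         ∃ λ y → y ∈ B × y ∉ A × ∣ (A - x) ∪ ⁅ y ⁆ ∣ ≡ k
  exch {A} {B} {x} ∣A∣ ∣B∣ x∈A x∉B with any? (λ y → (y ∈? B) ×-dec ¬? (y ∈? A))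
  ... | yes (y , y∈B , y∉A) =
        y , y∈B , y∉A ,
        trans (∣p∪y∣ (λ y∈ → y∉A (p─q⊆p A ⁅ x ⁆ y∈))) (trans (∣p-x∣ x∈A) ∣A∣)
  ... | no none = ⊥-elim (ℕ.<-irrefl (trans ∣B∣ (sym ∣A∣)) (p⊂q⇒∣p∣<∣q∣ B⊂A))
    where
    B⊂A : B ⊂ A
    B⊂A = (λ {y} y∈B → decidable-stable (y ∈? A) (λ y∉A → none (y , y∈B , y∉A)))
        , x , x∈A , x∉B

------------------------------------------------------------------------
-- Direct sums

∈-take⁺ : ∀ m {p : Subset (m ℕ.+ n)} {i : Fin m} → i ↑ˡ n ∈ p → i ∈ take m p
∈-take⁺ (suc m) {_ ∷ p} {zero}  here       = here
∈-take⁺ (suc m) {_ ∷ p} {suc i} (there i∈) = there (∈-take⁺ m i∈)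

∈-take⁻ : ∀ m {p : Subset (m ℕ.+ n)} {i : Fin m} → i ∈ take m p → i ↑ˡ n ∈ p
∈-take⁻ (suc m) {_ ∷ p} {zero}  here       = here
∈-take⁻ (suc m) {_ ∷ p} {suc i} (there i∈) = there (∈-take⁻ m i∈)

∈-drop⁺ : ∀ m {p : Subset (m ℕ.+ n)} {i : Fin n} → m ↑ʳ i ∈ p → i ∈ drop m p
∈-drop⁺ zero            i∈         = i∈
∈-drop⁺ (suc m) {_ ∷ p} (there i∈) = ∈-drop⁺ m i∈

∈-drop⁻ : ∀ m {p : Subset (m ℕ.+ n)} {i : Fin n} → i ∈ drop m p → m ↑ʳ i ∈ p
∈-drop⁻ zero            i∈ = i∈
∈-drop⁻ (suc m) {_ ∷ p} i∈ = there (∈-drop⁻ m i∈)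

take-⊥ : ∀ m → take m (⊥ {m ℕ.+ n}) ≡ ⊥
take-⊥ zero    = refl
take-⊥ (suc m) = cong (outside ∷_) (take-⊥ m)

drop-⊥ : ∀ m → drop m (⊥ {m ℕ.+ n}) ≡ ⊥
drop-⊥ zero    = refl
drop-⊥ (suc m) = drop-⊥ m

take-⁅↑ˡ⁆ : ∀ m (i : Fin m) → take m ⁅ i ↑ˡ n ⁆ ≡ ⁅ i ⁆
take-⁅↑ˡ⁆ (suc m) zero    = cong (inside ∷_) (take-⊥ m)
take-⁅↑ˡ⁆ (suc m) (suc i) = cong (outside ∷_) (take-⁅↑ˡ⁆ m i)

drop-⁅↑ˡ⁆ : ∀ m (i : Fin m) → drop m ⁅ i ↑ˡ n ⁆ ≡ ⊥
drop-⁅↑ˡ⁆ (suc m) zero    = drop-⊥ m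
drop-⁅↑ˡ⁆ (suc m) (suc i) = drop-⁅↑ˡ⁆ m i

take-⁅↑ʳ⁆ : ∀ m (i : Fin n) → take m ⁅ m ↑ʳ i ⁆ ≡ ⊥
take-⁅↑ʳ⁆ zero    i = refl
take-⁅↑ʳ⁆ (suc m) i = cong (outside ∷_) (take-⁅↑ʳ⁆ m i)

drop-⁅↑ʳ⁆ : ∀ m (i : Fin n) → drop m ⁅ m ↑ʳ i ⁆ ≡ ⁅ i ⁆
drop-⁅↑ʳ⁆ zero    i = refl
drop-⁅↑ʳ⁆ (suc m) i = drop-⁅↑ʳ⁆ m i

take-swap : ∀ m (p q r : Subset (m ℕ.+ n)) →
            take m ((p ─ q) ∪ r) ≡ (take m p ─ take m q) ∪ take m r
take-swap m p q r = trans (take-zipWith _ (p ─ q) r)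
                          (cong (_∪ take m r) (take-zipWith _ p q))

drop-swap : ∀ m (p q r : Subset (m ℕ.+ n)) →
            drop m ((p ─ q) ∪ r) ≡ (drop m p ─ drop m q) ∪ drop m r
drop-swap m p q r = trans (drop-zipWith {m = m} _ (p ─ q) r)
                          (cong (_∪ drop m r) (drop-zipWith {m = m} _ p q))

swap-⊥ : (p : Subset n) {q r : Subset n} → q ≡ ⊥ → r ≡ ⊥ → (p ─ q) ∪ r ≡ p
swap-⊥ p refl refl = trans (p∪⊥≡p (p ─ ⊥)) (p─⊥≡p p)

infixr 6 _⊕_
_⊕_ : Matroid m → Matroid n → Matroid (m ℕ.+ n)
_⊕_ {m} {n} M N = record
  { Basis    = Bas
  ; basis?   = λ B → basis? M (take m B) ×-dec basis? N (drop m B)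
  ; nonempty = proj₁ (nonempty M) Vec.++ proj₁ (nonempty N)
             , subst (Basis M) (sym (take-++ (proj₁ (nonempty M)))) (proj₂ (nonempty M))
             , subst (Basis N) (sym (drop-++ (proj₁ (nonempty M)))) (proj₂ (nonempty N))
  ; exchange = exch
  }
  where
  Bas : Pred (Subset (m ℕ.+ n)) 0ℓ
  Bas B = Basis M (take m B) × Basis N (drop m B)

  take-++ : ∀ {m n} (p : Subset m) {q : Subset n} → take m (p Vec.++ q) ≡ p
  take-++ []      = refl
  take-++ (s ∷ p) = cong (s ∷_) (take-++ p)

  drop-++ : ∀ {m n} (p : Subset m) {q : Subset n} → drop m (p Vec.++ q) ≡ q
  drop-++ []      = refl
  drop-++ (s ∷ p) = drop-++ p

  exch : ∀ {A B x} → Bas A → Bas B → x ∈ A → x ∉ B →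
         ∃ λ y → y ∈ B × y ∉ A × Bas ((A - x) ∪ ⁅ y ⁆)
  exch {A} {B} {x} (A₁ , A₂) (B₁ , B₂) x∈A x∉B with splitAt m x in eq
  ... | inj₁ i with refl ← splitAt⁻¹-↑ˡ {m} eq
      with j , j∈B , j∉A , bas ←
           exchange M A₁ B₁ (∈-take⁺ m x∈A) (λ i∈ → x∉B (∈-take⁻ m i∈)) =
        j ↑ˡ n , ∈-take⁻ m j∈B , (λ j∈ → j∉A (∈-take⁺ m j∈))
      , subst (Basis M)
          (sym (trans (take-swap m A ⁅ i ↑ˡ n ⁆ ⁅ j ↑ˡ n ⁆)
                      (cong₂ (λ q r → (take m A ─ q) ∪ r) (take-⁅↑ˡ⁆ m i) (take-⁅↑ˡ⁆ m j))))
          bas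
      , subst (Basis N)
          (sym (trans (drop-swap m A ⁅ i ↑ˡ n ⁆ ⁅ j ↑ˡ n ⁆)
                      (swap-⊥ (drop m A) (drop-⁅↑ˡ⁆ m i) (drop-⁅↑ˡ⁆ m j))))
          A₂
  exch {A} {B} {x} (A₁ , A₂) (B₁ , B₂) x∈A x∉B
      | inj₂ i with refl ← splitAt⁻¹-↑ʳ {m} eq
      with j , j∈B , j∉A , bas ←
           exchange N A₂ B₂ (∈-drop⁺ m x∈A) (λ i∈ → x∉B (∈-drop⁻ m i∈)) =
        m ↑ʳ j , ∈-drop⁻ m j∈B , (λ j∈ → j∉A (∈-drop⁺ m j∈))
      , subst (Basis M)
          (sym (trans (take-swap m A ⁅ m ↑ʳ i ⁆ ⁅ m ↑ʳ j ⁆)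
                      (swap-⊥ (take m A) (take-⁅↑ʳ⁆ m i) (take-⁅↑ʳ⁆ m j))))
          A₁
      , subst (Basis N)
          (sym (trans (drop-swap m A ⁅ m ↑ʳ i ⁆ ⁅ m ↑ʳ j ⁆)
                      (cong₂ (λ q r → (drop m A ─ q) ∪ r) (drop-⁅↑ʳ⁆ m i) (drop-⁅↑ʳ⁆ m j))))
          bas

⨁ : List (∃ Matroid) → ∃ Matroid
⨁ []             = 0 , U 0 0 z≤n
⨁ ((m , M) ∷ Ms) = m ℕ.+ proj₁ (⨁ Ms) , M ⊕ proj₂ (⨁ Ms)

------------------------------------------------------------------------
-- Series-parallel matroids

-- N is obtained from M by adding a new element f in parallel with e:
-- {e , f} is a circuit of N and N \ f = M.  Since f is not a coloop of
-- N, the bases of N \ f are the bases of N avoiding f.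

ParallelExtension : Matroid n → Matroid (suc n) → Set
ParallelExtension {n} M N = ∃ λ (e : Fin n) → ∃ λ (f : Fin (suc n)) →
  Circuit N (⁅ punchIn f e ⁆ ∪ ⁅ f ⁆) ×
  (∀ B → Basis M B ⇔ Basis N (insertAt B f outside))

-- Dually, {e , f} is a cocircuit of N and N / f = M.  Since f is not a
-- loop of N, the bases of N / f are the B with B ∪ {f} a basis of N.

SeriesExtension : Matroid n → Matroid (suc n) → Set
SeriesExtension {n} M N = ∃ λ (e : Fin n) → ∃ λ (f : Fin (suc n)) →
  Cocircuit N (⁅ punchIn f e ⁆ ∪ ⁅ f ⁆) ×
  (∀ B → Basis M B ⇔ Basis N (insertAt B f inside))

data SeriesParallel : Matroid n → Set₁ where
  isU₀₁    : {M : Matroid n} → M ≅ U 0 1 z≤n → SeriesParallel M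
  isU₁₁    : {M : Matroid n} → M ≅ U 1 1 (s≤s z≤n) → SeriesParallel M
  isU₁₂    : {M : Matroid n} → M ≅ U 1 2 (s≤s z≤n) → SeriesParallel M
  parallel : {M : Matroid n} {N : Matroid (suc n)} →
             SeriesParallel M → ParallelExtension M N → SeriesParallel N
  series   : {M : Matroid n} {N : Matroid (suc n)} →
             SeriesParallel M → SeriesExtension M N → SeriesParallel N

------------------------------------------------------------------------
-- Base polytopes

-- The base polytope has integral vertices, and an integral linear
-- relation between indicator functions of rational polytopes holds on
-- ℝⁿ iff it holds at every rational point, so points are rational.

Point : ℕ → Set
Point n = Fin n → ℚ

open Sum ℚ.+-0-commutativeMonoid using () renaming (sum to sumℚ)
open Sum ℤ.+-0-commutativeMonoid using () renaming (sum to sumℤ)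

conv : Pred (Point n) 0ℓ → Pred (Point n) 0ℓ
conv {n} V x = ∃ λ s → ∃ λ (v : Fin s → Point n) → ∃ λ (w : Fin s → ℚ) →
  (∀ j → V (v j)) ×
  (∀ j → 0ℚ ℚ.≤ w j) ×
  sumℚ w ≡ 1ℚ ×
  (∀ i → x i ≡ sumℚ (λ j → w j ℚ.* v j i))

e[_] : Subset n → Point n
e[ B ] i = if lookup B i then 1ℚ else 0ℚ

Polytope : Matroid n → Pred (Point n) 0ℓ
Polytope M = conv (λ v → ∃ λ B → Basis M B × (∀ i → v i ≡ e[ B ] i))

𝟙 : {P : Set} → Dec P → ℤ
𝟙 P? = if does P? then 1ℤ else 0ℤ

-- The decisions d give the values at x of the indicator functions; they
-- exist and are unique up to their truth value, so quantifying over them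
-- only avoids fixing a decision procedure for Polytope.

IndicatorRelation : ∀ {s} → (Fin s → Matroid n) → (Fin s → ℤ) → Set
IndicatorRelation {n} M a =
  ∀ (x : Point n) (d : ∀ i → Dec (Polytope (M i) x)) →
  sumℤ (λ i → a i ℤ.* 𝟙 (d i)) ≡ 0ℤ

------------------------------------------------------------------------
-- Valuations

module _ (G : AbelianGroup a ℓ) where
  open AbelianGroup G
  open RawMonoidDefs rawMonoid using (sum) renaming (_×_ to _×ᴺ_)

  infixr 8 _×ᶻ_
  _×ᶻ_ : ℤ → Carrier → Carrier
  (+ n)    ×ᶻ x = n ×ᴺ x
  -[1+ n ] ×ᶻ x = (suc n ×ᴺ x) ⁻¹

  Valuation : (∀ {n} → Matroid n → Carrier) → Set _
  Valuation f = ∀ {n s} (M : Fin s → Matroid n) (a : Fin s → ℤ) →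
    IndicatorRelation M a → sum (λ i → a i ×ᶻ f (M i)) ≈ ε

  Covaluation : (∀ {n} → Matroid n → Carrier) → Set _
  Covaluation f = Valuation (λ M → (-1ℤ ℤ.^ #components M) ×ᶻ f M)

------------------------------------------------------------------------
-- Integer polynomials

-- Lists of coefficients, constant term first, up to trailing zeros.

ℤ[t] : Set
ℤ[t] = List ℤ

coeff : ℤ[t] → ℕ → ℤ
coeff []      i       = 0ℤ
coeff (c ∷ p) zero    = c
coeff (c ∷ p) (suc i) = coeff p i

infix 4 _≈_
record _≈_ (p q : ℤ[t]) : Set where
  constructor mk≈
  field coeff-≡ : ∀ i → coeff p i ≡ coeff q i

open _≈_ public

infixl 6 _+ᵖ_ _-ᵖ_
infix  8 -ᵖ_

_+ᵖ_ : ℤ[t] → ℤ[t] → ℤ[t]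
[]      +ᵖ q       = q
(c ∷ p) +ᵖ []      = c ∷ p
(c ∷ p) +ᵖ (d ∷ q) = (c ℤ.+ d) ∷ (p +ᵖ q)

-ᵖ_ : ℤ[t] → ℤ[t]
-ᵖ_ = List.map (ℤ.-_)

_-ᵖ_ : ℤ[t] → ℤ[t] → ℤ[t]
p -ᵖ q = p +ᵖ (-ᵖ q)

infixr 7 t·_
t·_ : ℤ[t] → ℤ[t]
t· p = 0ℤ ∷ p

t^_ : ℕ → ℤ[t]
t^ zero  = 1ℤ ∷ []
t^ suc m = t· (t^ m)

coeff-+ᵖ : ∀ p q i → coeff (p +ᵖ q) i ≡ coeff p i ℤ.+ coeff q i
coeff-+ᵖ []      q       i       = sym (ℤ.+-identityˡ _)
coeff-+ᵖ (c ∷ p) []      i       = sym (ℤ.+-identityʳ _)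
coeff-+ᵖ (c ∷ p) (d ∷ q) zero    = refl
coeff-+ᵖ (c ∷ p) (d ∷ q) (suc i) = coeff-+ᵖ p q i

coeff--ᵖ : ∀ p i → coeff (-ᵖ p) i ≡ ℤ.- coeff p i
coeff--ᵖ []      i       = refl
coeff--ᵖ (c ∷ p) zero    = refl
coeff--ᵖ (c ∷ p) (suc i) = coeff--ᵖ p i

ℤ[t]-+-abelianGroup : AbelianGroup 0ℓ 0ℓ
ℤ[t]-+-abelianGroup = record
  { Carrier = ℤ[t]
  ; _≈_     = _≈_
  ; _∙_     = _+ᵖ_
  ; ε       = []
  ; _⁻¹     = -ᵖ_
  ; isAbelianGroup = record
    { isGroup = record
      { isMonoid = record
        { isSemigroup = record
          { isMagma = record
            { isEquivalence = record
              { refl  = mk≈ λ i → refl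
              ; sym   = λ p≈q → mk≈ λ i → sym (coeff-≡ p≈q i)
              ; trans = λ p≈q q≈r → mk≈ λ i → trans (coeff-≡ p≈q i) (coeff-≡ q≈r i)
              }
            ; ∙-cong = λ {p} {q} {r} {s} p≈q r≈s → mk≈ λ i →
                trans (coeff-+ᵖ p r i)
                  (trans (cong₂ ℤ._+_ (coeff-≡ p≈q i) (coeff-≡ r≈s i)) (sym (coeff-+ᵖ q s i)))
            }
          ; assoc = λ p q r → mk≈ λ i →
              trans (trans (coeff-+ᵖ (p +ᵖ q) r i) (cong (ℤ._+ coeff r i) (coeff-+ᵖ p q i)))
                (trans (ℤ.+-assoc (coeff p i) (coeff q i) (coeff r i))
                  (sym (trans (coeff-+ᵖ p (q +ᵖ r) i) (cong (ℤ._+_ (coeff p i)) (coeff-+ᵖ q r i)))))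
          }
        ; identity = (λ p → mk≈ λ i → refl)
                   , (λ p → mk≈ λ i → trans (coeff-+ᵖ p [] i) (ℤ.+-identityʳ _))
        }
      ; inverse =
            (λ p → mk≈ λ i → trans (coeff-+ᵖ (-ᵖ p) p i)
               (trans (cong (ℤ._+ coeff p i) (coeff--ᵖ p i)) (ℤ.+-inverseˡ (coeff p i))))
          , (λ p → mk≈ λ i → trans (coeff-+ᵖ p (-ᵖ p) i)
               (trans (cong (ℤ._+_ (coeff p i)) (coeff--ᵖ p i)) (ℤ.+-inverseʳ (coeff p i))))
      ; ⁻¹-cong = λ {p} {q} p≈q → mk≈ λ i →
          trans (coeff--ᵖ p i) (trans (cong ℤ.-_ (coeff-≡ p≈q i)) (sym (coeff--ᵖ q i)))
      }
    ; comm = λ p q → mk≈ λ i →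
        trans (coeff-+ᵖ p q i)
          (trans (ℤ.+-comm (coeff p i) (coeff q i)) (sym (coeff-+ᵖ q p i)))
    }
  }

open Sum (AbelianGroup.commutativeMonoid ℤ[t]-+-abelianGroup) public using (sum; sum-syntax)
open RawMonoidDefs (AbelianGroup.rawMonoid ℤ[t]-+-abelianGroup) public
  using () renaming (_×_ to _·_)

------------------------------------------------------------------------
-- Speyer's g-polynomial

-- The properties that determine g uniquely.

record IsSpeyerG (g : ∀ {n} → Matroid n → ℤ[t]) : Set₁ where
  field
    invariant       : ∀ {m n} {M : Matroid m} {N : Matroid n} → M ≅ N → g M ≈ g N
    covaluative     : Covaluation ℤ[t]-+-abelianGroup g
    loop            : ∀ {n} (M : Matroid n) → ∃ (Loop M) → g M ≈ []
    coloop          : ∀ {n} (M : Matroid n) → ∃ (Coloop M) → g M ≈ []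
    series-parallel : ∀ {n} (M : Matroid n) → ¬ ∃ (Loop M) → ¬ ∃ (Coloop M) →
                      (Ms : List (∃ Matroid)) →
                      All (λ (_ , N) → SeriesParallel N) Ms →
                      M ≅ proj₂ (⨁ Ms) → g M ≈ t^ (List.length Ms)

-- For a hyperplane H of size h ≥ k cut the hypersimplex, the base polytope of
-- U k n, along x(H) = k - 1. The part x(H) ≥ k - 1 is the base polytope of a
-- matroid Λ (|B \ H| ≤ 1 for every basis B), the cut itself that of a matroid Δ
-- (|B \ H| = 1), and the base polytope of M is what remains below all the cuts.
-- Two hyperplanes share at most k - 2 elements, so a point lies above at most
-- one cut, and the indicator functions satisfy 1_U = 1_M + Σ_H (1_Λ - 1_Δ).
--
-- Λ is U k (h + 1) with one element replaced by n - h parallel ones, and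
-- Δ = U (k - 1) h ⊕ U 1 (n - h). That g does not see the parallel elements and
-- that the summand U 1 (n - h) contributes a factor t follows by cutting both
-- sides in the same way into direct sums of series-parallel matroids. All
-- matroids that arise are given by bounds on the prefix counts of a basis. If
-- the prefix counts have come down to {a , a + 1}, bounding the next one by
-- {a , a + 1} or {a + 1 , a + 2} is a parallel or series extension, while
-- {a + 1} closes a connected component; a free element is split into these
-- three cases by cutting at a + 1.
module Submission where

open import Defs
import Algebra.Properties.CommutativeMonoid.Sum as BigSum
open import Data.Empty using (⊥-elim)
open import Data.Fin.Base as Fin using (Fin; zero; suc; toℕ; fromℕ; punchIn)
import Data.Fin.Properties as Fin
open import Data.Fin.Permutation as Perm using (Permutation; _⟨$⟩ʳ_; _⟨$⟩ˡ_; lift₀; insert)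
open import Data.Fin.Subset
open import Data.Fin.Subset.Properties
open import Data.Integer.Base as ℤ using (ℤ; -[1+_]; 0ℤ; 1ℤ; -1ℤ)
import Data.Integer.Properties as ℤ
import Data.Integer.Tactic.RingSolver as ℤ
open import Data.List.Base as List using (List; []; _∷_)
open import Data.List.Membership.Propositional using (find) renaming (_∈_ to _∈ˡ_)
open import Data.List.Membership.Propositional.Properties
  using (∈-∃++; ∈-++⁻; ∈-++⁺ˡ; ∈-++⁺ʳ; ∈-map⁺; ∈-map⁻; ∈-filter⁺; ∈-filter⁻;
         ∈-tabulate⁺; ∈-tabulate⁻; ∈-lookup; ∈-downFrom⁻)
open import Data.List.Properties
  using (length-++; length-map; length-tabulate; length-downFrom; filter-accept; filter-reject)
open import Data.List.Relation.Unary.All as All using (All; []; _∷_)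
import Data.List.Relation.Unary.All.Properties as All
open import Data.List.Relation.Unary.AllPairs using ([]; _∷_)
open import Data.List.Relation.Unary.Any as Any using (here; there)
open import Data.List.Relation.Unary.Unique.Propositional using (Unique)
import Data.List.Relation.Unary.Unique.Propositional.Properties as Unique
open import Data.Nat.Base as ℕ
  using (ℕ; zero; suc; _+_; _*_; _∸_; _⊔_; _/_; _≤_; _<_; z≤n; s≤s; NonZero)
open import Data.Nat.Divisibility using (∣-refl)
open import Data.Nat.DivMod using (+-distrib-/-∣ʳ; n/n≡1; m<n⇒m/n≡0; m*n/n≡m; m<n*o⇒m/o<n; /-monoˡ-≤)
open import Data.Nat.Properties
open import Data.Nat.Tactic.RingSolver using (solve-∀)
open import Data.Product.Base using (∃; ∃₂; Σ; _×_; _,_; proj₁; proj₂)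
open import Data.Rational.Base as ℚ using (ℚ; mkℚ; 0ℚ; 1ℚ; toℚᵘ)
import Data.Rational.Properties as ℚ
open import Data.Rational.Unnormalised.Base as ℚᵘ using (mkℚᵘ; *≡*) renaming (_≃_ to _≃ᵘ_)
import Data.Rational.Unnormalised.Properties as ℚᵘ
open import Data.Sum.Base as Sum using (_⊎_; inj₁; inj₂; [_,_]′)
open import Data.Vec.Base as Vec using (Vec; []; _∷_; here; there; lookup; take; drop; tabulate; _[_]≔_)
open import Data.Vec.Properties
  using (tabulate∘lookup; lookup∘tabulate; tabulate-cong; ∷-injectiveʳ; []=⇒lookup; lookup⇒[]=;
         lookup∘update; lookup∘update′; lookup-replicate)
open import Function.Base using (_∘_; case_of_)
open import Function.Bundles using (_⇔_; mk⇔; Equivalence)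
open import Level using (0ℓ)
open import Relation.Binary.Definitions using (tri<; tri≈; tri>)
open import Relation.Binary.PropositionalEquality
open import Relation.Nullary
open import Relation.Nullary.Decidable using (¬?; _×-dec_; _⊎-dec_; decidable-stable; dec-yes)
open import Relation.Unary using (Pred; Decidable)
open import Algebra.Properties.Group ℚ.+-0-group using (∙-cancelˡ)
open BigSum +-0-commutativeMonoid using ()
  renaming (sum to sumℕ; sum-permute to sumℕ-permute; sum-cong-≗ to sumℕ-cong)
open BigSum ℚ.+-0-commutativeMonoid using () renaming (sum to sumℚ)
open BigSum ℤ.+-0-commutativeMonoid using () renaming (sum to sumℤ)
open Equivalence using () renaming (to to ⇒; from to ⇐)

-- Only the axioms of `g` are available, so every value has to come from an indicator relation that
-- ends in direct sums of series-parallel matroids. By covaluativity the additive quantity is the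
-- coefficient of `g` signed by the number of components; each closed block contributes `- t`, and
-- the components of these sums have to be determined as well. No formula for `g` of a uniform
-- matroid enters: both sides of a comparison reduce to the same contribution of a free part.
--
-- The obstacle is geometric. A point on one side of a cut may be presented as an average of bases
-- on both sides. Points are therefore written with natural numerators over a common `N` and
-- presented anew: for chains a rounding argument turns the prefix inequalities into an average of
-- bases, and for the paving matroid the nonbases in a list of subsets are exchanged away without
-- moving its average.
--
-- Connectedness of `M` ensures that a large hyperplane misses at least two elements and that the
-- rank is at least two; otherwise Δ would have a coloop or U (k - 1) h would have rank zero.

private variable
  m n j k h l r a b s K S : ℕ
  A : Set

-- Chains: matroids given by bounds on prefix counts

Interval : Set
Interval = ℕ × ℕ

private variable
  c c′ : Vec Interval n

step : Side → ℕ → ℕ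
step outside s = s
step inside  s = suc s

-- Path K s c B: the running count of B, started at s, visits the intervals c
-- in turn and ends at K.
Path : ℕ → ℕ → Vec Interval n → Subset n → Set
Path K s []            []      = s ≡ K
Path K s ((l , h) ∷ c) (β ∷ B) = l ≤ step β s × step β s ≤ h × Path K (step β s) c B

path? : ∀ K s (c : Vec Interval n) B → Dec (Path K s c B)
path? K s []            []      = s ≟ K
path? K s ((l , h) ∷ c) (β ∷ B) =
  (l ≤? step β s) ×-dec (step β s ≤? h) ×-dec path? K (step β s) c B

-- Both paths end at `K`, so that of `A`, which starts strictly higher, must lose its lead: `y` is
-- the first place where `B` steps up and `A` does not. Up to there the path of `A` lowered by one
-- still lies no lower than that of `B`, which supplies the lower bounds; the upper bounds are those
-- of `A`.
path-forward : ∀ {c : Vec Interval n} {A B} →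
               Path K (suc a) c A → Path K b c B → b ≤ a →
               ∃ λ y → y ∈ B × y ∉ A × Path K a c (A [ y ]≔ inside)
path-forward {c = []} {[]} {[]} refl refl b≤a = ⊥-elim (1+n≰n b≤a)
path-forward {c = _ ∷ c} {outside ∷ A} {inside ∷ B} (l≤a , a≤h , pA) (l≤b , b≤h , pB) b≤a =
  zero , here , (λ ()) , l≤a , a≤h , pA
path-forward {c = _ ∷ c} {outside ∷ A} {outside ∷ B} (l≤a , a≤h , pA) (l≤b , b≤h , pB) b≤a
  with y , y∈B , y∉A , p ← path-forward {c = c} pA pB b≤a =
  suc y , there y∈B , (λ { (there y∈A) → y∉A y∈A })
  , ≤-trans l≤b b≤a , ≤-trans (n≤1+n _) a≤h , p
path-forward {c = _ ∷ c} {inside ∷ A} {outside ∷ B} (l≤a , a≤h , pA) (l≤b , b≤h , pB) b≤a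
  with y , y∈B , y∉A , p ← path-forward {c = c} pA pB (m≤n⇒m≤1+n b≤a) =
  suc y , there y∈B , (λ { (there y∈A) → y∉A y∈A })
  , ≤-trans l≤b (m≤n⇒m≤1+n b≤a) , ≤-trans (n≤1+n _) a≤h , p
path-forward {c = _ ∷ c} {inside ∷ A} {inside ∷ B} (l≤a , a≤h , pA) (l≤b , b≤h , pB) b≤a
  with y , y∈B , y∉A , p ← path-forward {c = c} pA pB (s≤s b≤a) =
  suc y , there y∈B , (λ { (there y∈A) → y∉A y∈A })
  , ≤-trans l≤b (s≤s b≤a) , ≤-trans (n≤1+n _) a≤h , p

-- If the path of A is at x no lower than that of B, the element to insert
-- comes after x; otherwise it comes before x, and the second alternative
-- records that the path of A without x may be entered one step higher.
path-exchange : ∀ {c : Vec Interval n} {A B x} →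
                Path K a c A → Path K b c B → x ∈ A → x ∉ B →
                (∃ λ y → y ∈ B × y ∉ A × Path K a c ((A [ x ]≔ outside) [ y ]≔ inside))
                ⊎ (a < b × Path K (suc a) c (A [ x ]≔ outside))
path-exchange {B = inside ∷ B} pA pB here x∉B = ⊥-elim (x∉B here)
path-exchange {a = a} {b} {c = _ ∷ c} {inside ∷ A} {outside ∷ B}
  (l≤a , a≤h , pA) (l≤b , b≤h , pB) here x∉B with b ≤? a
... | no b≰a = inj₂ (≰⇒> b≰a , l≤a , a≤h , pA)
... | yes b≤a with y , y∈B , y∉A , p ← path-forward {c = c} pA pB b≤a =
  inj₁ (suc y , there y∈B , (λ { (there y∈A) → y∉A y∈A })
       , ≤-trans l≤b b≤a , ≤-trans (n≤1+n _) a≤h , p)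
path-exchange {c = _ ∷ c} {α ∷ A} {β ∷ B} (l≤a , a≤h , pA) (l≤b , b≤h , pB) (there x∈A) x∉B
  with path-exchange {c = c} pA pB x∈A (λ x∈B → x∉B (there x∈B))
... | inj₁ (y , y∈B , y∉A , p) =
  inj₁ (suc y , there y∈B , (λ { (there y∈A) → y∉A y∈A }) , l≤a , a≤h , p)
path-exchange {c = _ ∷ c} {outside ∷ A} {inside ∷ B} (l≤a , a≤h , pA) (l≤b , b≤h , pB) (there x∈A) x∉B
    | inj₂ (a<b , p) =
  inj₁ (zero , here , (λ ()) , ≤-trans l≤a (n≤1+n _) , ≤-trans a<b b≤h , p)
path-exchange {c = _ ∷ c} {outside ∷ A} {outside ∷ B} (l≤a , a≤h , pA) (l≤b , b≤h , pB) (there x∈A) x∉B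
    | inj₂ (a<b , p) = inj₂ (a<b , ≤-trans l≤a (n≤1+n _) , ≤-trans a<b b≤h , p)
path-exchange {c = _ ∷ c} {inside ∷ A} {outside ∷ B} (l≤a , a≤h , pA) (l≤b , b≤h , pB) (there x∈A) x∉B
    | inj₂ (a<b , p) = inj₂ (<-trans (n<1+n _) a<b , ≤-trans l≤a (n≤1+n _) , ≤-trans a<b b≤h , p)
path-exchange {c = _ ∷ c} {inside ∷ A} {inside ∷ B} (l≤a , a≤h , pA) (l≤b , b≤h , pB) (there x∈A) x∉B
    | inj₂ (a<b , p) = inj₂ (≤-pred a<b , ≤-trans l≤a (n≤1+n _) , ≤-trans a<b b≤h , p)

p-x≡p[x]≔outside : ∀ (p : Subset n) x → p - x ≡ p [ x ]≔ outside
p-x≡p[x]≔outside (inside  ∷ p) zero    = cong (outside ∷_) (p─⊥≡p p)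
p-x≡p[x]≔outside (outside ∷ p) zero    = cong (outside ∷_) (p─⊥≡p p)
p-x≡p[x]≔outside (inside  ∷ p) (suc x) = cong (inside ∷_) (p-x≡p[x]≔outside p x)
p-x≡p[x]≔outside (outside ∷ p) (suc x) = cong (outside ∷_) (p-x≡p[x]≔outside p x)

p∪⁅y⁆≡p[y]≔inside : ∀ (p : Subset n) y → p ∪ ⁅ y ⁆ ≡ p [ y ]≔ inside
p∪⁅y⁆≡p[y]≔inside (inside  ∷ p) zero    = cong (inside ∷_) (p∪⊥≡p p)
p∪⁅y⁆≡p[y]≔inside (outside ∷ p) zero    = cong (inside ∷_) (p∪⊥≡p p)
p∪⁅y⁆≡p[y]≔inside (inside  ∷ p) (suc y) = cong (inside ∷_) (p∪⁅y⁆≡p[y]≔inside p y)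
p∪⁅y⁆≡p[y]≔inside (outside ∷ p) (suc y) = cong (outside ∷_) (p∪⁅y⁆≡p[y]≔inside p y)

swap≡≔ : ∀ (p : Subset n) x y → (p - x) ∪ ⁅ y ⁆ ≡ (p [ x ]≔ outside) [ y ]≔ inside
swap≡≔ p x y = trans (p∪⁅y⁆≡p[y]≔inside (p - x) y)
                     (cong (_[ y ]≔ inside) (p-x≡p[x]≔outside p x))

-- These are lattice path matroids. The intervals need not be tight and may even contradict each
-- other, so a basis is part of the data.
chain : ∀ K s (c : Vec Interval n) → ∃ (Path K s c) → Matroid n
chain K s c ne = record
  { Basis    = Path K s c
  ; basis?   = path? K s c
  ; nonempty = ne
  ; exchange = exch
  }
  where
  exch : ∀ {A B x} → Path K s c A → Path K s c B → x ∈ A → x ∉ B →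
         ∃ λ y → y ∈ B × y ∉ A × Path K s c ((A - x) ∪ ⁅ y ⁆)
  exch {A} {B} {x} pA pB x∈A x∉B with path-exchange {c = c} pA pB x∈A x∉B
  ... | inj₁ (y , y∈B , y∉A , p) =
        y , y∈B , y∉A , subst (Path K s c) (sym (swap≡≔ A x y)) p
  ... | inj₂ (s<s , _) = ⊥-elim (n≮n _ s<s)

path-total : ∀ {K s} (c : Vec Interval n) B → Path K s c B → s + ∣ B ∣ ≡ K
path-total {s = s} [] [] p = trans (+-identityʳ s) p
path-total (_ ∷ c) (outside ∷ B) (_ , _ , p) = path-total c B p
path-total {s = s} (_ ∷ c) (inside ∷ B) (_ , _ , p) = trans (+-suc s ∣ B ∣) (path-total c B p)

-- Blocks are series-parallel, and closed chains are direct sums of blocks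

data Letter : Set where
  par ser : Letter

-- The running count of a block lives in a strip {a , a + 1}, which a series
-- letter raises by one, until the block is closed at the top of the strip.
end : ℕ → List Letter → ℕ
end a []        = suc a
end a (par ∷ w) = end a w
end a (ser ∷ w) = end (suc a) w

strip : ∀ a (w : List Letter) → Vec Interval (suc (List.length w))
strip a []        = (suc a , suc a) ∷ []
strip a (par ∷ w) = (a , suc a) ∷ strip a w
strip a (ser ∷ w) = (suc a , suc (suc a)) ∷ strip (suc a) w

strip-path-low  : ∀ a w → ∃ (Path (end a w) a (strip a w))
strip-path-high : ∀ a w → ∃ (Path (end a w) (suc a) (strip a w))
strip-path-low a [] = inside ∷ [] , ≤-refl , ≤-refl , refl
strip-path-low a (par ∷ w) with B , p ← strip-path-low a w =
  outside ∷ B , ≤-refl , n≤1+n a , p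
strip-path-low a (ser ∷ w) with B , p ← strip-path-low (suc a) w =
  inside ∷ B , ≤-refl , n≤1+n _ , p
strip-path-high a [] = outside ∷ [] , ≤-refl , ≤-refl , refl
strip-path-high a (par ∷ w) with B , p ← strip-path-high a w =
  outside ∷ B , n≤1+n a , ≤-refl , p
strip-path-high a (ser ∷ w) with B , p ← strip-path-high (suc a) w =
  inside ∷ B , n≤1+n _ , ≤-refl , p

block : ∀ a (w : List Letter) → Vec Interval (suc (suc (List.length w)))
block a w = (a , suc a) ∷ strip a w

block-path : ∀ a w → ∃ (Path (end a w) a (block a w))
block-path a w with B , p ← strip-path-low a w = outside ∷ B , ≤-refl , n≤1+n a , p

∉⊥∪⊥ : ∀ {x : Fin n} → x ∉ ⊥ ∪ ⊥
∉⊥∪⊥ x∈ = ∉⊥ (subst (_ ∈_) (p∪⊥≡p ⊥) x∈)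

proper-pair : ∀ {D : Subset (suc (suc n))} → D ⊂ ⁅ suc zero ⁆ ∪ ⁅ zero ⁆ →
              (∀ {x} → x ∈ D → x ≡ zero) ⊎ (∀ {x} → x ∈ D → x ≡ suc zero)
proper-pair {D = inside ∷ inside ∷ D} (D⊆ , zero , _ , x∉D) = ⊥-elim (x∉D here)
proper-pair {D = inside ∷ inside ∷ D} (D⊆ , suc zero , _ , x∉D) = ⊥-elim (x∉D (there here))
proper-pair {D = inside ∷ inside ∷ D} (D⊆ , suc (suc x) , there (there x∈) , x∉D)
  = ⊥-elim (∉⊥∪⊥ x∈)
proper-pair {D = β ∷ outside ∷ D} (D⊆ , _) = inj₁ λ
  { here → refl
  ; (there (there x∈)) → ⊥-elim (∉⊥∪⊥ (drop-there (drop-there (D⊆ (there (there x∈)))))) }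
proper-pair {D = outside ∷ inside ∷ D} (D⊆ , _) = inj₂ λ
  { (there here) → refl
  ; (there (there x∈)) → ⊥-elim (∉⊥∪⊥ (drop-there (drop-there (D⊆ (there (there x∈)))))) }

pair-⊆ : ∀ {B : Subset (suc (suc n))} → ⁅ suc zero ⁆ ∪ ⁅ zero ⁆ ⊆ B → zero ∈ B × suc zero ∈ B
pair-⊆ sub = sub here , sub (there here)

-- The first letter relates the first two elements: with `par` the count stays at most `suc a`, so
-- they are never both taken, and with `ser` it reaches at least `suc a`, so they are never both
-- left out. Deleting, respectively contracting, the first element leaves the block of the remaining
-- word. The empty word is `U 1 2`.
block-seriesParallel : ∀ a w ne → SeriesParallel (chain (end a w) a (block a w) ne)
block-seriesParallel a [] ne = isU₁₂ (Perm.id , λ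
  { (outside ∷ outside ∷ []) → mk⇔ (λ (_ , _ , l , _) → ⊥-elim (1+n≰n l)) (λ ())
  ; (outside ∷ inside  ∷ []) → mk⇔ (λ _ → refl) (λ _ → ≤-refl , n≤1+n a , ≤-refl , ≤-refl , refl)
  ; (inside  ∷ outside ∷ []) → mk⇔ (λ _ → refl) (λ _ → n≤1+n a , ≤-refl , ≤-refl , ≤-refl , refl)
  ; (inside  ∷ inside  ∷ []) → mk⇔ (λ (_ , _ , _ , h , _) → ⊥-elim (1+n≰n h)) (λ ()) })
block-seriesParallel a (par ∷ w) ne =
  parallel (block-seriesParallel a w (block-path a w))
    (zero , zero , (dependent , minimal) , λ
      { (β ∷ B) → mk⇔ (λ p → ≤-refl , n≤1+n a , p) (λ (_ , _ , p) → p) })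
  where
  N = chain (end a w) a (block a (par ∷ w)) ne

  dependent : ¬ Independent N (⁅ suc zero ⁆ ∪ ⁅ zero ⁆)
  dependent (inside ∷ inside ∷ B , (_ , _ , _ , h , _) , sub) = 1+n≰n h
  dependent (outside ∷ _ , _ , sub) with () ← proj₁ (pair-⊆ sub)
  dependent (inside ∷ outside ∷ _ , _ , sub) with there () ← proj₂ (pair-⊆ sub)

  minimal : ∀ D → D ⊂ ⁅ suc zero ⁆ ∪ ⁅ zero ⁆ → Independent N D
  minimal D D⊂ with proper-pair D⊂ | strip-path-high a w
  ... | inj₁ D₀ | B , p = inside ∷ outside ∷ B
                        , (n≤1+n a , ≤-refl , n≤1+n a , ≤-refl , p)
                        , λ x∈ → subst (_∈ _) (sym (D₀ x∈)) here
  ... | inj₂ D₁ | B , p = outside ∷ inside ∷ B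
                        , (≤-refl , n≤1+n a , n≤1+n a , ≤-refl , p)
                        , λ x∈ → subst (_∈ _) (sym (D₁ x∈)) (there here)
block-seriesParallel a (ser ∷ w) ne =
  series (block-seriesParallel (suc a) w (block-path (suc a) w))
    (zero , zero , (dependent , minimal) , λ
      { (β ∷ B) → mk⇔ (λ p → n≤1+n a , ≤-refl , p) (λ (_ , _ , p) → p) })
  where
  N = chain (end (suc a) w) a (block a (ser ∷ w)) ne

  dependent : ¬ Coindependent N (⁅ suc zero ⁆ ∪ ⁅ zero ⁆)
  dependent (outside ∷ outside ∷ B , (_ , _ , l , _) , sub) = 1+n≰n l
  dependent (inside ∷ _ , _ , sub) with () ← proj₁ (pair-⊆ sub)
  dependent (outside ∷ inside ∷ _ , _ , sub) with there () ← proj₂ (pair-⊆ sub)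

  minimal : ∀ D → D ⊂ ⁅ suc zero ⁆ ∪ ⁅ zero ⁆ → Coindependent N D
  minimal D D⊂ with proper-pair D⊂ | strip-path-low (suc a) w
  ... | inj₁ D₀ | B , p = outside ∷ inside ∷ B
                        , (≤-refl , n≤1+n a , ≤-refl , n≤1+n _ , p)
                        , λ x∈ → subst (_∈ _) (sym (D₀ x∈)) here
  ... | inj₂ D₁ | B , p = inside ∷ outside ∷ B
                        , (n≤1+n a , ≤-refl , ≤-refl , n≤1+n _ , p)
                        , λ x∈ → subst (_∈ _) (sym (D₁ x∈)) (there here)

-- The closing interval of a strip is a single number, so the count behind it is the same for all
-- paths and the conditions on the two sides are independent. This is the direct sum decomposition.
strip-++ : ∀ {K s a} w (c : Vec Interval n) B →
           Path K s (strip a w Vec.++ c) B ⇔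
           (Path (end a w) s (strip a w) (take (suc (List.length w)) B) ×
            Path K (end a w) c (drop (suc (List.length w)) B))
strip-++ {K = K} [] c (β ∷ B) = mk⇔
  (λ (l , h , p) → (l , h , ≤-antisym h l) , subst (λ s → Path K s c B) (≤-antisym h l) p)
  (λ ((l , h , e) , p) → l , h , subst (λ s → Path K s c B) (sym e) p)
strip-++ (par ∷ w) c (β ∷ B) = mk⇔
  (λ (l , h , p) → let q , q′ = ⇒ (strip-++ w c B) p in (l , h , q) , q′)
  (λ ((l , h , q) , q′) → l , h , ⇐ (strip-++ w c B) (q , q′))
strip-++ (ser ∷ w) c (β ∷ B) = mk⇔
  (λ (l , h , p) → let q , q′ = ⇒ (strip-++ w c B) p in (l , h , q) , q′)
  (λ ((l , h , q) , q′) → l , h , ⇐ (strip-++ w c B) (q , q′))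

block-++ : ∀ {K a} w (c : Vec Interval n) B →
           Path K a (block a w Vec.++ c) B ⇔
           (Path (end a w) a (block a w) (take (suc (suc (List.length w))) B) ×
            Path K (end a w) c (drop (suc (suc (List.length w))) B))
block-++ w c (β ∷ B) = mk⇔
  (λ (l , h , p) → let q , q′ = ⇒ (strip-++ w c B) p in (l , h , q) , q′)
  (λ ((l , h , q) , q′) → l , h , ⇐ (strip-++ w c B) (q , q′))

-- Closed K a r c: from a, the intervals c run through r blocks and end at K.
-- Open K a r c: the same from within a block whose current strip is {a , a + 1}.
mutual
  data Closed (K : ℕ) : ∀ {n} → ℕ → ℕ → Vec Interval n → Set where
    done  : Closed K K 0 []
    start : {c : Vec Interval n} → Open K a r c → Closed K a r ((a , suc a) ∷ c)

  data Open (K : ℕ) : ∀ {n} → ℕ → ℕ → Vec Interval n → Set where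
    par   : {c : Vec Interval n} → Open K a r c → Open K a r ((a , suc a) ∷ c)
    ser   : {c : Vec Interval n} → Open K (suc a) r c →
            Open K a r ((suc a , suc (suc a)) ∷ c)
    close : {c : Vec Interval n} → Closed K (suc a) r c →
            Open K a (suc r) ((suc a , suc a) ∷ c)

-- An equation of sizes takes the place of an isomorphism: `closed-sum` matches it with `refl` and
-- compares bases subset by subset.
IsSum : ∀ (r : ℕ) → (Subset n → Set) → Set₁
IsSum {n} r P =
  Σ (List (∃ Matroid)) λ Ms → All (λ (_ , N) → SeriesParallel N) Ms × List.length Ms ≡ r ×
  Σ (n ≡ proj₁ (⨁ Ms)) λ eq → ∀ B → P B ⇔ Basis (proj₂ (⨁ Ms)) (subst Subset eq B)

-- The word of the current block sits in the index, so that a match on the only constructor exposes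
-- it.
data Decomposition (K a : ℕ) : ∀ {n} → ℕ → Vec Interval n → Set₁ where
  strip-then : ∀ w {c : Vec Interval n} → IsSum r (Path K (end a w) c) →
               Decomposition K a (suc r) (strip a w Vec.++ c)

closed-sum : ∀ {c : Vec Interval n} → Closed K a r c → IsSum r (Path K a c)
open-sum   : ∀ {c : Vec Interval n} → Open K a r c → Decomposition K a r c
closed-sum done = [] , [] , refl , refl , λ { [] → mk⇔ (λ _ → refl) (λ _ → refl) }
closed-sum {a = a} (start o) with open-sum o
... | strip-then w {c} (Ms , sps , refl , refl , iff) =
  (_ , chain _ a (block a w) (block-path a w)) ∷ Ms
  , block-seriesParallel a w (block-path a w) ∷ sps , refl , refl
  , λ B → mk⇔
      (λ p → let q , q′ = ⇒ (block-++ w c B) p in q , ⇒ (iff _) q′)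
      (λ (q , q′) → ⇐ (block-++ w c B) (q , ⇐ (iff _) q′))
open-sum (par o) with open-sum o
... | strip-then w s = strip-then (par ∷ w) s
open-sum (ser o) with open-sum o
... | strip-then w s = strip-then (ser ∷ w) s
open-sum (close o) = strip-then [] (closed-sum o)

sum-≅ : ∀ {M : Matroid n} {m} {N : Matroid m} (eq : n ≡ m) →
        (∀ B → Basis M B ⇔ Basis N (subst Subset eq B)) → M ≅ N
sum-≅ {N = N} refl iff = Perm.id , λ B → mk⇔
  (λ p → subst (Basis N) (sym (tabulate∘lookup B)) (⇒ (iff B) p))
  (λ p → ⇐ (iff B) (subst (Basis N) (tabulate∘lookup B) p))

closed-path    : ∀ {c : Vec Interval n} → Closed K a r c → ∃ (Path K a c)
open-path-low  : ∀ {c : Vec Interval n} → Open K a r c → ∃ (Path K a c)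
open-path-high : ∀ {c : Vec Interval n} → Open K a r c → ∃ (Path K (suc a) c)
closed-path done = [] , refl
closed-path (start o) with B , p ← open-path-low o = outside ∷ B , ≤-refl , n≤1+n _ , p
open-path-low (par o) with B , p ← open-path-low o = outside ∷ B , ≤-refl , n≤1+n _ , p
open-path-low (ser o) with B , p ← open-path-low o = inside ∷ B , ≤-refl , n≤1+n _ , p
open-path-low (close o) with B , p ← closed-path o = inside ∷ B , ≤-refl , ≤-refl , p
open-path-high (par o) with B , p ← open-path-high o = outside ∷ B , n≤1+n _ , ≤-refl , p
open-path-high (ser o) with B , p ← open-path-high o = inside ∷ B , n≤1+n _ , ≤-refl , p
open-path-high (close o) with B , p ← closed-path o = outside ∷ B , ≤-refl , ≤-refl , p

-- This excludes loops and coloops. Within a block either entry level may be the one required, so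
-- `open-bit` leaves the choice to the beginning of the block, where both can be realised.
closed-bit : ∀ {c : Vec Interval n} → Closed K a r c → ∀ i β →
             ∃ λ B → Path K a c B × lookup B i ≡ β
open-bit   : ∀ {c : Vec Interval n} → Open K a r c → ∀ i β →
             ∃ λ B → (Path K a c B ⊎ Path K (suc a) c B) × lookup B i ≡ β
closed-bit (start o) zero outside with B , p ← open-path-low o =
  outside ∷ B , (≤-refl , n≤1+n _ , p) , refl
closed-bit (start o) zero inside with B , p ← open-path-high o =
  inside ∷ B , (n≤1+n _ , ≤-refl , p) , refl
closed-bit (start o) (suc i) β with open-bit o i β
... | B , inj₁ p , eq = outside ∷ B , (≤-refl , n≤1+n _ , p) , eq
... | B , inj₂ p , eq = inside ∷ B , (n≤1+n _ , ≤-refl , p) , eq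
open-bit (par o) zero outside with B , p ← open-path-low o =
  outside ∷ B , inj₁ (≤-refl , n≤1+n _ , p) , refl
open-bit (par o) zero inside with B , p ← open-path-high o =
  inside ∷ B , inj₁ (n≤1+n _ , ≤-refl , p) , refl
open-bit (par o) (suc i) β with open-bit o i β
... | B , inj₁ p , eq = outside ∷ B , inj₁ (≤-refl , n≤1+n _ , p) , eq
... | B , inj₂ p , eq = outside ∷ B , inj₂ (n≤1+n _ , ≤-refl , p) , eq
open-bit (ser o) zero outside with B , p ← open-path-low o =
  outside ∷ B , inj₂ (≤-refl , n≤1+n _ , p) , refl
open-bit (ser o) zero inside with B , p ← open-path-low o =
  inside ∷ B , inj₁ (≤-refl , n≤1+n _ , p) , refl
open-bit (ser o) (suc i) β with open-bit o i β
... | B , inj₁ p , eq = inside ∷ B , inj₁ (≤-refl , n≤1+n _ , p) , eq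
... | B , inj₂ p , eq = inside ∷ B , inj₂ (n≤1+n _ , ≤-refl , p) , eq
open-bit (close o) zero outside with B , p ← closed-path o =
  outside ∷ B , inj₂ (≤-refl , ≤-refl , p) , refl
open-bit (close o) zero inside with B , p ← closed-path o =
  inside ∷ B , inj₁ (≤-refl , ≤-refl , p) , refl
open-bit (close o) (suc i) β with B , p , eq ← closed-bit o i β =
  inside ∷ B , inj₁ (≤-refl , ≤-refl , p) , eq

-- Counting subsets

length-mono : ∀ {A : Set} {xs ys : List A} → Unique xs → (∀ {x} → x ∈ˡ xs → x ∈ˡ ys) →
              List.length xs ≤ List.length ys
length-mono [] sub = z≤n
length-mono {xs = x ∷ xs} (x∉xs ∷ uniq) sub with ys , zs , refl ← ∈-∃++ (sub (here refl)) =
  subst (suc (List.length xs) ≤_) (sym len)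
    (s≤s (length-mono uniq (λ {y} y∈ → drop-mid y∈ (∈-++⁻ ys (sub (there y∈))))))
  where
  len : List.length (ys List.++ x ∷ zs) ≡ suc (List.length (ys List.++ zs))
  len = trans (length-++ ys) (trans (+-suc _ _) (cong suc (sym (length-++ ys))))

  drop-mid : ∀ {y} → y ∈ˡ xs → y ∈ˡ ys ⊎ y ∈ˡ x ∷ zs → y ∈ˡ ys List.++ zs
  drop-mid y∈ (inj₁ y∈ys) = ∈-++⁺ˡ y∈ys
  drop-mid y∈ (inj₂ (here refl)) = ⊥-elim (All.lookup x∉xs y∈ refl)
  drop-mid y∈ (inj₂ (there y∈zs)) = ∈-++⁺ʳ ys y∈zs

∈-allSubsets : (S : Subset n) → S ∈ˡ allSubsets n
∈-allSubsets [] = here refl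
∈-allSubsets (outside ∷ S) = ∈-++⁺ˡ (∈-map⁺ (outside ∷_) (∈-allSubsets S))
∈-allSubsets {suc n} (inside ∷ S) = ∈-++⁺ʳ (List.map (outside ∷_) (allSubsets n)) (∈-map⁺ (inside ∷_) (∈-allSubsets S))

allSubsets-unique : ∀ n → Unique (allSubsets n)
allSubsets-unique zero = [] ∷ []
allSubsets-unique (suc n) = Unique.++⁺ (Unique.map⁺ ∷-injectiveʳ (allSubsets-unique n))
                                       (Unique.map⁺ ∷-injectiveʳ (allSubsets-unique n))
  λ (o , i) → case ∈-map⁻ (outside ∷_) o of λ where
    (_ , _ , refl) → case ∈-map⁻ (inside ∷_) i of λ ()

module _ {P : Pred (Subset n) 0ℓ} (P? : Decidable P) where

  #subsets-enumerated : (S : Fin r → Subset n) → (∀ {p q} → S p ≡ S q → p ≡ q) →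
                        (∀ q → P (S q)) → (∀ {T} → P T → ∃ λ q → T ≡ S q) →
                        #subsets P? ≡ r
  #subsets-enumerated {r} S inj PS only = trans (≤-antisym
      (length-mono (Unique.filter⁺ P? (allSubsets-unique n)) λ T∈ →
        let q , eq = only (proj₂ (∈-filter⁻ P? {xs = allSubsets n} T∈))
        in subst (_∈ˡ List.tabulate S) (sym eq) (∈-tabulate⁺ q))
      (length-mono (Unique.tabulate⁺ inj) λ T∈ →
        let q , eq = ∈-tabulate⁻ T∈
        in ∈-filter⁺ P? (∈-allSubsets _) (subst P (sym eq) (PS q))))
    (length-tabulate S)

  #subsets-mono : {Q : Pred (Subset m) 0ℓ} (Q? : Decidable Q) (f : Subset n → Subset m) →
                  (∀ {S T} → f S ≡ f T → S ≡ T) → (∀ {S} → P S → Q (f S)) →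
                  #subsets P? ≤ #subsets Q?
  #subsets-mono {Q = Q} Q? f inj PQ = subst (_≤ #subsets Q?) (length-map f (List.filter P? (allSubsets n)))
    (length-mono (Unique.map⁺ inj (Unique.filter⁺ P? (allSubsets-unique n))) λ T∈ →
      let S , S∈ , eq = ∈-map⁻ f T∈
      in ∈-filter⁺ Q? (∈-allSubsets _)
           (subst Q (sym eq) (PQ (proj₂ (∈-filter⁻ P? {xs = allSubsets n} S∈)))))

module _ {P : Pred (Fin n) 0ℓ} (P? : Decidable P) where

  comprehension : Subset n
  comprehension = tabulate (λ i → does (P? i))

  ∈-comprehension⁺ : ∀ {i} → P i → i ∈ comprehension
  ∈-comprehension⁺ {i} p = lookup⇒[]= i _ (trans (lookup∘tabulate _ i)
                             (cong does (proj₂ (dec-yes (P? i) p))))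

  ∈-comprehension⁻ : ∀ {i} → i ∈ comprehension → P i
  ∈-comprehension⁻ {i} i∈ with P? i | trans (sym (lookup∘tabulate (λ i → does (P? i)) i)) ([]=⇒lookup i∈)
  ... | yes p | _ = p

x∈p─q⁻ : ∀ {p q : Subset n} {x} → x ∈ p ─ q → x ∈ p × x ∉ q
x∈p─q⁻ {p = p} {q} x∈ = p─q⊆p p q x∈ , ∉q p q x∈
  where
  ∉q : ∀ {n} (p q : Subset n) {x} → x ∈ p ─ q → x ∉ q
  ∉q (_ ∷ p) (inside ∷ q) (there x∈) (there x∈q) = ∉q p q x∈ x∈q
  ∉q (_ ∷ p) (outside ∷ q) (there x∈) (there x∈q) = ∉q p q x∈ x∈q

-- Circuits and connected components

module _ (M : Matroid n) where

  -- Exchanging an element of `A ─ B` for one of `B` keeps the size of `A` and shrinks `A ─ B`,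
  -- until `A` lies in `B`.
  basis-card-≤ : ∀ {A B} → Basis M A → Basis M B → ∣ A ∣ ≤ ∣ B ∣
  basis-card-≤ {A} {B} = go ∣ A ─ B ∣ A ≤-refl
    where
    go : ∀ d A → ∣ A ─ B ∣ ≤ d → Basis M A → Basis M B → ∣ A ∣ ≤ ∣ B ∣
    go d A bound bA bB with nonempty? (A ─ B)
    ... | no empty = p⊆q⇒∣p∣≤∣q∣ λ {x} x∈A →
          decidable-stable (x ∈? B) (λ x∉B → empty (x , x∈p∧x∉q⇒x∈p─q x∈A x∉B))
    go zero A bound bA bB | yes (x , x∈) =
      ⊥-elim (n≮0 (<-≤-trans (subst (_≤ ∣ A ─ B ∣) (∣⁅x⁆∣≡1 x)
        (p⊆q⇒∣p∣≤∣q∣ λ y∈ → subst (_∈ _) (sym (x∈⁅y⁆⇒x≡y x y∈)) x∈)) bound))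
    go (suc d) A bound bA bB | yes (x , x∈) =
      let x∈A , x∉B = x∈p─q⁻ x∈
          y , y∈B , y∉A , bA′ = exchange M bA bB x∈A x∉B
          A′⊂ : ((A - x) ∪ ⁅ y ⁆) ─ B ⊂ A ─ B
          A′⊂ = (λ z∈ → let z∈A′ , z∉B = x∈p─q⁻ z∈ in
                   case x∈p∪q⁻ (A - x) ⁅ y ⁆ z∈A′ of λ where
                     (inj₁ z∈A-x) → x∈p∧x∉q⇒x∈p─q (p─q⊆p A ⁅ x ⁆ z∈A-x) z∉B
                     (inj₂ z∈y) → ⊥-elim (z∉B (subst (_∈ B) (sym (x∈⁅y⁆⇒x≡y y z∈y)) y∈B)))
              , x , x∈ , λ x∈′ → case x∈p∪q⁻ (A - x) ⁅ y ⁆ (proj₁ (x∈p─q⁻ x∈′)) of λ where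
                     (inj₁ x∈A-x) → proj₂ (x∈p─q⁻ {p = A} x∈A-x) (x∈⁅x⁆ x)
                     (inj₂ x∈y) → x∉B (subst (_∈ B) (sym (x∈⁅y⁆⇒x≡y y x∈y)) y∈B)
      in subst (_≤ ∣ B ∣)
           (trans (∣p∪y∣ (λ y∈ → y∉A (p─q⊆p A ⁅ x ⁆ y∈))) (∣p-x∣ x∈A))
           (go d _ (≤-pred (≤-trans (p⊂q⇒∣p∣<∣q∣ A′⊂) bound)) bA′ bB)

  independent-⊆ : ∀ {I J} → I ⊆ J → Independent M J → Independent M I
  independent-⊆ I⊆J (B , bB , J⊆B) = B , bB , λ x∈ → J⊆B (I⊆J x∈)

  dependent⇒circuit : ∀ {D} → Dependent M D → ∃ λ C → Circuit M C × C ⊆ D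
  dependent⇒circuit {D} = go ∣ D ∣ D ≤-refl
    where
    go : ∀ d D → ∣ D ∣ ≤ d → Dependent M D → ∃ λ C → Circuit M C × C ⊆ D
    go d D bound dep
      with Fin.any? (λ x → (x ∈? D) ×-dec ¬? (independent? M (D - x)))
    ... | no none = D , (dep , λ D′ (D′⊆D , x , x∈D , x∉D′) →
            independent-⊆ (λ {y} y∈ → x∈p∧x≢y⇒x∈p-y (D′⊆D y∈) λ { refl → x∉D′ y∈ })
              (decidable-stable (independent? M (D - x)) (λ dep′ → none (x , x∈D , dep′))))
          , λ z → z
    go zero D bound dep | yes (x , x∈D , dep′) =
      ⊥-elim (n≮0 (<-≤-trans (x∈p⇒∣p-x∣<∣p∣ x∈D) bound))
    go (suc d) D bound dep | yes (x , x∈D , dep′)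
      with C , circ , C⊆ ← go d (D - x) (≤-pred (≤-trans (x∈p⇒∣p-x∣<∣p∣ x∈D) bound)) dep′ =
      C , circ , λ y∈ → p─q⊆p D ⁅ x ⁆ (C⊆ y∈)

  -- `B ∪ ⁅ i ⁆` is too large to be independent, and a circuit in it contains `i` because `B` is
  -- independent and `j` because the exchanged basis is.
  swap⇒∼ : ∀ {B i j} → Basis M B → i ∉ B → j ∈ B → Basis M ((B - j) ∪ ⁅ i ⁆) → _∼_ M i j
  swap⇒∼ {B} {i} {j} bB i∉B j∈B bB′
    with C , (dep , min) , C⊆ ← dependent⇒circuit {B ∪ ⁅ i ⁆} (λ (A , bA , sub) →
           1+n≰n (subst (_≤ ∣ B ∣) (∣p∪y∣ i∉B)
             (≤-trans (p⊆q⇒∣p∣≤∣q∣ sub) (basis-card-≤ bA bB)))) =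
    inj₂ (C , (dep , min) ,
      decidable-stable (i ∈? C) (λ i∉C → dep (B , bB , λ {x} x∈C →
        case x∈p∪q⁻ B ⁅ i ⁆ (C⊆ x∈C) of λ where
          (inj₁ x∈B) → x∈B
          (inj₂ x∈i) → ⊥-elim (i∉C (subst (_∈ C) (x∈⁅y⁆⇒x≡y i x∈i) x∈C)))) ,
      decidable-stable (j ∈? C) (λ j∉C → dep (_ , bB′ , λ {x} x∈C →
        case x∈p∪q⁻ B ⁅ i ⁆ (C⊆ x∈C) of λ where
          (inj₁ x∈B) → x∈p∪q⁺ (inj₁ (x∈p∧x≢y⇒x∈p-y x∈B λ { refl → j∉C x∈C }))
          (inj₂ x∈i) → x∈p∪q⁺ (inj₂ x∈i))))

  ∼-sym : ∀ {i j} → _∼_ M i j → _∼_ M j i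
  ∼-sym (inj₁ eq) = inj₁ (sym eq)
  ∼-sym (inj₂ (C , circ , i∈ , j∈)) = inj₂ (C , circ , j∈ , i∈)

  #components-labelled : (lab : Fin n → Fin r) → (∀ q → ∃ λ i → lab i ≡ q) →
                         (∀ {i j} → lab i ≡ lab j → _∼_ M i j) →
                         (∀ {i j} → _∼_ M i j → lab i ≡ lab j) →
                         #components M ≡ r
  #components-labelled lab surj same⇒∼ ∼⇒same =
    #subsets-enumerated (component? M) class class-injective class-component
      λ {T} (i , comp) → lab i , ⊆-antisym
        (λ j∈T → lab≡⇒∈ (sym (∼⇒same (proj₁ (comp _) j∈T))))
        (λ j∈ → proj₂ (comp _) (same⇒∼ (sym (∈⇒lab≡ j∈))))
    where
    class : Fin _ → Subset n
    class q = comprehension (λ i → lab i Fin.≟ q)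

    lab≡⇒∈ : ∀ {i q} → lab i ≡ q → i ∈ class q
    lab≡⇒∈ {q = q} = ∈-comprehension⁺ (λ i → lab i Fin.≟ q)

    ∈⇒lab≡ : ∀ {i q} → i ∈ class q → lab i ≡ q
    ∈⇒lab≡ {q = q} = ∈-comprehension⁻ (λ i → lab i Fin.≟ q)

    class-injective : ∀ {p q} → class p ≡ class q → p ≡ q
    class-injective {p} eq with i , refl ← surj p = ∈⇒lab≡ (subst (i ∈_) eq (lab≡⇒∈ refl))

    class-component : ∀ q → Component M (class q)
    class-component q with i , refl ← surj q =
      i , λ j → (λ j∈ → same⇒∼ (sym (∈⇒lab≡ j∈))) , λ i∼j → lab≡⇒∈ (sym (∼⇒same i∼j))

  #components-connected : Fin n → Connected M → #components M ≡ 1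
  #components-connected i conn =
    #components-labelled (λ _ → zero) (λ { zero → i , refl }) (λ _ → conn _ _) (λ _ → refl)

-- Invariance under isomorphism

∈-image⁺ : ∀ (π : Permutation m n) {S x} → x ∈ S → π ⟨$⟩ʳ x ∈ image π S
∈-image⁺ π {S} {x} x∈ = lookup⇒[]= _ _ (trans (lookup∘tabulate _ (π ⟨$⟩ʳ x))
  (trans (cong (lookup S) (Perm.inverseˡ π)) ([]=⇒lookup x∈)))

∈-image⁻ : ∀ (π : Permutation m n) {S y} → y ∈ image π S → π ⟨$⟩ˡ y ∈ S
∈-image⁻ π {S} {y} y∈ = lookup⇒[]= _ _ (trans (sym (lookup∘tabulate _ y)) ([]=⇒lookup y∈))

image-flip : ∀ (π : Permutation m n) S → image π (image (Perm.flip π) S) ≡ S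
image-flip π S = trans (tabulate-cong λ j → trans (lookup∘tabulate _ (π ⟨$⟩ˡ j))
                         (cong (lookup S) (Perm.inverseʳ π)))
                       (tabulate∘lookup S)

image-mono : ∀ (π : Permutation m n) {S T} → S ⊆ T → image π S ⊆ image π T
image-mono π S⊆T y∈ =
  subst (_∈ _) (Perm.inverseʳ π) (∈-image⁺ π (S⊆T (∈-image⁻ π y∈)))

≅-sym : ∀ {M : Matroid m} {N : Matroid n} → M ≅ N → N ≅ M
≅-sym {M = M} {N} (π , iff) = Perm.flip π , λ B → mk⇔
  (λ bB → ⇐ (iff _) (subst (Basis N) (sym (image-flip π B)) bB))
  (λ bB → subst (Basis N) (image-flip π B) (⇒ (iff _) bB))

independent-image : ∀ {M : Matroid m} {N : Matroid n} ((π , _) : M ≅ N) {I} →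
                    Independent M I → Independent N (image π I)
independent-image (π , iff) (B , bB , I⊆B) = image π B , ⇒ (iff B) bB , image-mono π I⊆B

circuit-image : ∀ {M : Matroid m} {N : Matroid n} ((π , _) : M ≅ N) {C} →
                Circuit M C → Circuit N (image π C)
circuit-image {M = M} {N} M≅N@(π , _) {C} (dep , min) =
  (λ ind → dep (subst (Independent M) (image-flip (Perm.flip π) C)
                  (independent-image {M = N} {M} (≅-sym {M = M} {N} M≅N) ind)))
  , λ D (D⊆ , x , x∈ , x∉D) → subst (Independent N) (image-flip π D)
      (independent-image {M = M} {N} M≅N (min (image (Perm.flip π) D)
        ( (λ y∈ → subst (_∈ C) (Perm.inverseˡ π) (∈-image⁻ π (D⊆ (∈-image⁻ (Perm.flip π) y∈))))
        , π ⟨$⟩ˡ x , ∈-image⁻ π x∈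
        , λ x∈′ → x∉D (subst (_∈ D) (Perm.inverseʳ π) (∈-image⁻ (Perm.flip π) x∈′)))))

∼-image : ∀ {M : Matroid m} {N : Matroid n} ((π , _) : M ≅ N) {i j} →
          _∼_ M i j → _∼_ N (π ⟨$⟩ʳ i) (π ⟨$⟩ʳ j)
∼-image (π , _) (inj₁ eq) = inj₁ (cong (π ⟨$⟩ʳ_) eq)
∼-image {M = M} {N} M≅N@(π , _) (inj₂ (C , circ , i∈ , j∈)) =
  inj₂ (image π C , circuit-image {M = M} {N} M≅N circ , ∈-image⁺ π i∈ , ∈-image⁺ π j∈)

#components-≅ : ∀ {M : Matroid m} {N : Matroid n} → M ≅ N → #components M ≡ #components N
#components-≅ {M = M} {N} M≅N =
  ≤-antisym (mono {M = M} {N} M≅N) (mono {M = N} {M} (≅-sym {M = M} {N} M≅N))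
  where
  mono : ∀ {m n} {M : Matroid m} {N : Matroid n} → M ≅ N → #components M ≤ #components N
  mono {M = M} {N} M≅N@(π , _) = #subsets-mono (component? M) (component? N) (image π)
    (λ {S} {T} eq → trans (sym (image-flip (Perm.flip π) S))
                      (trans (cong (image (Perm.flip π)) eq) (image-flip (Perm.flip π) T)))
    λ {S} (i , comp) → π ⟨$⟩ʳ i , λ j →
      (λ j∈ → subst (_∼_ N (π ⟨$⟩ʳ i)) (Perm.inverseʳ π)
                (∼-image {M = M} {N} M≅N (proj₁ (comp _) (∈-image⁻ π j∈))))
      , λ i∼j → subst (_∈ image π S) (Perm.inverseʳ π) (∈-image⁺ π (proj₂ (comp _)
                (subst (λ i → _∼_ M i _) (Perm.inverseˡ π)
                  (∼-image {M = N} {M} (≅-sym {M = M} {N} M≅N) i∼j))))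

-- The components of a closed chain are its blocks

mutual
  closed-label : ∀ {c : Vec Interval n} → Closed K a r c → Fin n → Fin r
  closed-label (start o) zero    = first-label o
  closed-label (start o) (suc i) = open-label o i

  open-label : ∀ {c : Vec Interval n} → Open K a r c → Fin n → Fin r
  open-label (par o)   zero    = first-label o
  open-label (par o)   (suc i) = open-label o i
  open-label (ser o)   zero    = first-label o
  open-label (ser o)   (suc i) = open-label o i
  open-label (close o) zero    = zero
  open-label (close o) (suc i) = suc (closed-label o i)

  first-label : ∀ {c : Vec Interval n} → Open K a r c → Fin r
  first-label (par o)   = first-label o
  first-label (ser o)   = first-label o
  first-label (close o) = zero

closed-label-surjective : ∀ {c : Vec Interval n} (o : Closed K a r c) q →
                          ∃ λ i → closed-label o i ≡ q
open-label-surjective   : ∀ {c : Vec Interval n} (o : Open K a r c) q →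
                          ∃ λ i → open-label o i ≡ q
closed-label-surjective (start o) q with i , eq ← open-label-surjective o q = suc i , eq
open-label-surjective (par o) q with i , eq ← open-label-surjective o q = suc i , eq
open-label-surjective (ser o) q with i , eq ← open-label-surjective o q = suc i , eq
open-label-surjective (close o) zero = zero , refl
open-label-surjective (close o) (suc q) with i , eq ← closed-label-surjective o q =
  suc i , cong suc eq

-- An element of the current block can be traded for one unit of the entry level. An earlier element
-- `i` of the block supplies that unit when it is taken instead of `j`.
first-swap : ∀ {c : Vec Interval n} (o : Open K a r c) j → open-label o j ≡ first-label o →
             ∃ λ B → Path K a c B × j ∈ B × Path K (suc a) c (B [ j ]≔ outside)
first-swap (par o) zero eq with B , p ← open-path-high o =
  inside ∷ B , (n≤1+n _ , ≤-refl , p) , here , n≤1+n _ , ≤-refl , p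
first-swap (par o) (suc j) eq with B , p , j∈ , p′ ← first-swap o j eq =
  outside ∷ B , (≤-refl , n≤1+n _ , p) , there j∈ , n≤1+n _ , ≤-refl , p′
first-swap (ser o) zero eq with B , p ← open-path-low o =
  inside ∷ B , (≤-refl , n≤1+n _ , p) , here , ≤-refl , n≤1+n _ , p
first-swap (ser o) (suc j) eq with B , p , j∈ , p′ ← first-swap o j eq =
  inside ∷ B , (≤-refl , n≤1+n _ , p) , there j∈ , n≤1+n _ , ≤-refl , p′
first-swap (close o) zero eq with B , p ← closed-path o =
  inside ∷ B , (≤-refl , ≤-refl , p) , here , ≤-refl , ≤-refl , p

SwapAt : ∀ K s → Vec Interval n → Fin n → Fin n → Set
SwapAt K s c i j = ∃ λ B → Path K s c B × i ∉ B × j ∈ B ×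
                   Path K s c ((B [ j ]≔ outside) [ i ]≔ inside)

swapAt-∷ : ∀ β {l h} {c : Vec Interval n} {i j} → l ≤ step β s → step β s ≤ h →
           SwapAt K (step β s) c i j → SwapAt K s ((l , h) ∷ c) (suc i) (suc j)
swapAt-∷ β l≤ ≤h (B , p , i∉ , j∈ , p′) =
  β ∷ B , (l≤ , ≤h , p) , (λ { (there i∈) → i∉ i∈ }) , there j∈ , l≤ , ≤h , p′

closed-swap : ∀ {c : Vec Interval n} (o : Closed K a r c) {i j} → i Fin.< j →
              closed-label o i ≡ closed-label o j → SwapAt K a c i j
-- The entry level depends on the letter of `i`: to leave out a series letter and still enter the
-- rest at the bottom of its strip, the count must already be `suc a`.
open-swap   : ∀ {c : Vec Interval n} (o : Open K a r c) {i j} → i Fin.< j →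
              open-label o i ≡ open-label o j → SwapAt K a c i j ⊎ SwapAt K (suc a) c i j
closed-swap (start o) {zero} {suc j} i<j eq with B , p , j∈ , p′ ← first-swap o j (sym eq) =
  outside ∷ B , (≤-refl , n≤1+n _ , p) , (λ ()) , there j∈ , n≤1+n _ , ≤-refl , p′
closed-swap (start o) {suc i} {suc j} i<j eq with open-swap o (≤-pred i<j) eq
... | inj₁ sw = swapAt-∷ outside ≤-refl (n≤1+n _) sw
... | inj₂ sw = swapAt-∷ inside (n≤1+n _) ≤-refl sw
open-swap (par o) {zero} {suc j} i<j eq with B , p , j∈ , p′ ← first-swap o j (sym eq) =
  inj₁ (outside ∷ B , (≤-refl , n≤1+n _ , p) , (λ ()) , there j∈ , n≤1+n _ , ≤-refl , p′)
open-swap (par o) {suc i} {suc j} i<j eq =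
  Sum.map (swapAt-∷ outside ≤-refl (n≤1+n _)) (swapAt-∷ outside (n≤1+n _) ≤-refl)
    (open-swap o (≤-pred i<j) eq)
open-swap (ser o) {zero} {suc j} i<j eq with B , p , j∈ , p′ ← first-swap o j (sym eq) =
  inj₂ (outside ∷ B , (≤-refl , n≤1+n _ , p) , (λ ()) , there j∈ , n≤1+n _ , ≤-refl , p′)
open-swap (ser o) {suc i} {suc j} i<j eq =
  Sum.map (swapAt-∷ inside ≤-refl (n≤1+n _)) (swapAt-∷ inside (n≤1+n _) ≤-refl)
    (open-swap o (≤-pred i<j) eq)
open-swap (close o) {suc i} {suc j} i<j eq =
  inj₁ (swapAt-∷ inside ≤-refl ≤-refl (closed-swap o (≤-pred i<j) (Fin.suc-injective eq)))

mix : Subset n → Subset n → Subset n → Subset n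
mix []            []      []      = []
mix (inside ∷ S)  (α ∷ A) (β ∷ B) = α ∷ mix S A B
mix (outside ∷ S) (α ∷ A) (β ∷ B) = β ∷ mix S A B

mix-⊥ : ∀ (A B : Subset n) → mix ⊥ A B ≡ B
mix-⊥ []      []      = refl
mix-⊥ (α ∷ A) (β ∷ B) = cong (β ∷_) (mix-⊥ A B)

∈-mix⁺ : ∀ {S A B : Subset n} {x} → (x ∈ S → x ∈ A) → (x ∉ S → x ∈ B) → x ∈ mix S A B
∈-mix⁺ {S = inside ∷ S} {α ∷ A} {β ∷ B} {zero} onS offS with here ← onS here = here
∈-mix⁺ {S = outside ∷ S} {α ∷ A} {β ∷ B} {zero} onS offS with here ← offS (λ ()) = here
∈-mix⁺ {S = inside ∷ S} {α ∷ A} {β ∷ B} {suc x} onS offS =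
  there (∈-mix⁺ (λ x∈ → drop-there (onS (there x∈))) (λ x∉ → drop-there (offS (λ { (there x∈) → x∉ x∈ }))))
∈-mix⁺ {S = outside ∷ S} {α ∷ A} {β ∷ B} {suc x} onS offS =
  there (∈-mix⁺ (λ x∈ → drop-there (onS (there x∈))) (λ x∉ → drop-there (offS (λ { (there x∈) → x∉ x∈ }))))

-- Recombining bases along `S` is what makes `S` a separator. The two paths may start at different
-- levels, since they may already have diverged on the part of `S` that `cut-∷` has passed.
Cut : ∀ (K : ℕ) → Vec Interval n → Subset n → Set
Cut K c S = ∀ {a b A B} → Path K a c A → Path K b c B → Path K a c (mix S A B)

cut-∷ : ∀ {l h} {c : Vec Interval n} {S} → Cut K c S → Cut K ((l , h) ∷ c) (inside ∷ S)
cut-∷ cut {A = _ ∷ _} {_ ∷ _} (l≤ , ≤h , p) (_ , _ , q) = l≤ , ≤h , cut p q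

-- Both paths pass through the single value `a`, so the first can be continued by the second.
cut-close : {c : Vec Interval n} → Cut K ((a , a) ∷ c) (inside ∷ ⊥)
cut-close {K = K} {c = c} {A = α ∷ A} {β ∷ B} (l≤ , ≤h , p) (l≤′ , ≤h′ , q) =
  l≤ , ≤h , subst₂ (λ s B → Path K s c B)
              (trans (≤-antisym ≤h′ l≤′) (≤-antisym l≤ ≤h)) (sym (mix-⊥ A B)) q

first-cut : ∀ {c : Vec Interval n} (o : Open K a r c) j → open-label o j ≢ first-label o →
            ∃ λ S → j ∉ S × Cut K c S
first-cut (par o) zero neq = ⊥-elim (neq refl)
first-cut (par o) (suc j) neq with S , j∉ , cut ← first-cut o j neq =
  inside ∷ S , (λ { (there j∈) → j∉ j∈ }) , cut-∷ cut
first-cut (ser o) zero neq = ⊥-elim (neq refl)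
first-cut (ser o) (suc j) neq with S , j∉ , cut ← first-cut o j neq =
  inside ∷ S , (λ { (there j∈) → j∉ j∈ }) , cut-∷ cut
first-cut (close o) zero neq = ⊥-elim (neq refl)
first-cut (close o) (suc j) neq = inside ∷ ⊥ , (λ { (there j∈) → ∉⊥ j∈ }) , cut-close

CutBetween : ∀ (K : ℕ) → Vec Interval n → Fin n → Fin n → Set
CutBetween K c i j = ∃ λ S → i ∈ S × j ∉ S × Cut K c S

cutBetween-∷ : ∀ {l h} {c : Vec Interval n} {i j} → CutBetween K c i j →
               CutBetween K ((l , h) ∷ c) (suc i) (suc j)
cutBetween-∷ (S , i∈ , j∉ , cut) = inside ∷ S , there i∈ , (λ { (there j∈) → j∉ j∈ }) , cut-∷ cut

closed-cut : ∀ {c : Vec Interval n} (o : Closed K a r c) {i j} → i Fin.< j →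
             closed-label o i ≢ closed-label o j → CutBetween K c i j
open-cut   : ∀ {c : Vec Interval n} (o : Open K a r c) {i j} → i Fin.< j →
             open-label o i ≢ open-label o j → CutBetween K c i j
closed-cut (start o) {zero} {suc j} i<j neq with S , j∉ , cut ← first-cut o j (neq ∘ sym) =
  inside ∷ S , here , (λ { (there j∈) → j∉ j∈ }) , cut-∷ cut
closed-cut (start o) {suc i} {suc j} i<j neq = cutBetween-∷ (open-cut o (≤-pred i<j) neq)
open-cut (par o) {zero} {suc j} i<j neq with S , j∉ , cut ← first-cut o j (neq ∘ sym) =
  inside ∷ S , here , (λ { (there j∈) → j∉ j∈ }) , cut-∷ cut
open-cut (par o) {suc i} {suc j} i<j neq = cutBetween-∷ (open-cut o (≤-pred i<j) neq)
open-cut (ser o) {zero} {suc j} i<j neq with S , j∉ , cut ← first-cut o j (neq ∘ sym) =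
  inside ∷ S , here , (λ { (there j∈) → j∉ j∈ }) , cut-∷ cut
open-cut (ser o) {suc i} {suc j} i<j neq = cutBetween-∷ (open-cut o (≤-pred i<j) neq)
open-cut (close o) {zero} {suc j} i<j neq =
  inside ∷ ⊥ , here , (λ { (there j∈) → ∉⊥ j∈ }) , cut-close
open-cut (close o) {suc i} {suc j} i<j neq =
  cutBetween-∷ (closed-cut o (≤-pred i<j) (neq ∘ cong suc))

-- A circuit on both sides of `S` is the union of two proper, hence independent, parts. Mixing bases
-- that contain them gives a basis that contains the whole circuit.
cut⇒no-circuit : ∀ {c : Vec Interval n} {ne i j C} → CutBetween K c i j →
                 Circuit (chain K a c ne) C → i ∈ C → j ∉ C
cut⇒no-circuit {C = C} (S , i∈S , j∉S , cut) (dep , min) i∈C j∈C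
  with A , bA , sA ← min (C ∩ S)
         (p∩q⊆p C S , _ , j∈C , λ j∈ → j∉S (proj₂ (x∈p∩q⁻ C S j∈)))
     | B , bB , sB ← min (C ∩ ∁ S)
         (p∩q⊆p C (∁ S) , _ , i∈C , λ i∈ → x∈∁p⇒x∉p (proj₂ (x∈p∩q⁻ C (∁ S) i∈)) i∈S) =
  dep (mix S A B , cut bA bB , λ x∈C →
    ∈-mix⁺ (λ x∈S → sA (x∈p∩q⁺ (x∈C , x∈S))) (λ x∉S → sB (x∈p∩q⁺ (x∈C , x∉p⇒x∈∁p x∉S))))

#components-closed : ∀ {c : Vec Interval n} (o : Closed K a r c) ne →
                     #components (chain K a c ne) ≡ r
#components-closed {K = K} {a} {c = c} o ne =
  #components-labelled M (closed-label o) (closed-label-surjective o) same⇒∼ ∼⇒same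
  where
  M = chain K a c ne

  swap : ∀ {i j} → i Fin.< j → closed-label o i ≡ closed-label o j → _∼_ M i j
  swap {i} {j} i<j eq with B , p , i∉ , j∈ , p′ ← closed-swap o i<j eq =
    swap⇒∼ M p i∉ j∈ (subst (Path K a c) (sym (swap≡≔ B j i)) p′)

  same⇒∼ : ∀ {i j} → closed-label o i ≡ closed-label o j → _∼_ M i j
  same⇒∼ {i} {j} eq with Fin.<-cmp i j
  ... | tri< i<j _ _ = swap i<j eq
  ... | tri≈ _ i≡j _ = inj₁ i≡j
  ... | tri> _ _ j<i = ∼-sym M (swap j<i (sym eq))

  ∼⇒same : ∀ {i j} → _∼_ M i j → closed-label o i ≡ closed-label o j
  ∼⇒same (inj₁ refl) = refl
  ∼⇒same {i} {j} (inj₂ (C , circ , i∈ , j∈)) =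
    decidable-stable (closed-label o i Fin.≟ closed-label o j) λ neq →
      case Fin.<-cmp i j of λ where
        (tri< i<j _ _) → cut⇒no-circuit {ne = ne} (closed-cut o i<j neq) circ i∈ j∈
        (tri≈ _ refl _) → neq refl
        (tri> _ _ j<i) → cut⇒no-circuit {ne = ne} (closed-cut o j<i (neq ∘ sym)) circ j∈ i∈

-- Averages of lists of subsets

total : (A → ℕ) → List A → ℕ
total f []       = 0
total f (x ∷ xs) = f x + total f xs

total-cong : ∀ {f g : A → ℕ} → (∀ x → f x ≡ g x) → ∀ xs → total f xs ≡ total g xs
total-cong eq []       = refl
total-cong eq (x ∷ xs) = cong₂ _+_ (eq x) (total-cong eq xs)

total-+ : ∀ (f g : A → ℕ) xs → total (λ x → f x + g x) xs ≡ total f xs + total g xs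
total-+ f g []       = refl
total-+ f g (x ∷ xs) rewrite total-+ f g xs = interchange (f x) (g x) (total f xs) (total g xs)
  where
  interchange : ∀ a b c d → a + b + (c + d) ≡ a + c + (b + d)
  interchange = solve-∀

total-map : ∀ {B : Set} (f : B → ℕ) (g : A → B) xs →
            total f (List.map g xs) ≡ total (λ x → f (g x)) xs
total-map f g []       = refl
total-map f g (x ∷ xs) = cong (f (g x) +_) (total-map f g xs)

total-≤ : ∀ {f : A → ℕ} {h} {xs} → All (λ x → f x ≤ h) xs → total f xs ≤ List.length xs * h
total-≤ []       = z≤n
total-≤ (p ∷ ps) = +-mono-≤ p (total-≤ ps)

total-≥ : ∀ {f : A → ℕ} {l} {xs} → All (λ x → l ≤ f x) xs → List.length xs * l ≤ total f xs
total-≥ []       = z≤n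
total-≥ (p ∷ ps) = +-mono-≤ p (total-≥ ps)

bit : Subset n → Fin n → ℕ
bit B i = step (lookup B i) 0

bit≤1 : ∀ (B : Subset n) i → bit B i ≤ 1
bit≤1 B i with lookup B i
... | outside = z≤n
... | inside  = ≤-refl

step≡bit+ : ∀ β (B : Subset n) s → step β s ≡ s + bit (β ∷ B) zero
step≡bit+ outside B s = sym (+-identityʳ s)
step≡bit+ inside  B s = sym (+-comm s 1)

-- The inequalities on the prefix sums of v / N cutting out the base polytope
-- of the chain; S is the sum of the preceding entries.
InChain : ℕ → ℕ → ℕ → Vec Interval n → (Fin n → ℕ) → Set
InChain N K S []            v = S ≡ N * K
InChain N K S ((l , h) ∷ c) v =
  v zero ≤ N × N * l ≤ S + v zero × S + v zero ≤ N * h × InChain N K (S + v zero) c (v ∘ suc)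

module _ {N N′ : ℕ} .{{_ : NonZero N′}} where

  -- The hypothesis identifies `x / N` with an average `t / N′` over a list of length `N′`, so
  -- bounds on the entries of the list pass to `x`.
  scale-≤ : ∀ {x y t} → x * N′ ≡ t * N → t ≤ N′ * y → x ≤ N * y
  scale-≤ {x} {y} {t} eq t≤ = *-cancelʳ-≤ x (N * y) N′ (begin
    x * N′       ≡⟨ eq ⟩
    t * N        ≤⟨ *-monoˡ-≤ N t≤ ⟩
    N′ * y * N   ≡⟨ rearrange N′ y N ⟩
    N * y * N′   ∎)
    where
    open ≤-Reasoning
    rearrange : ∀ a b c → a * b * c ≡ c * b * a
    rearrange = solve-∀

  scale-≥ : ∀ {x y t} → x * N′ ≡ t * N → N′ * y ≤ t → N * y ≤ x
  scale-≥ {x} {y} {t} eq ≤t = *-cancelʳ-≤ (N * y) x N′ (begin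
    N * y * N′   ≡⟨ rearrange N y N′ ⟩
    N′ * y * N   ≤⟨ *-monoˡ-≤ N ≤t ⟩
    t * N        ≡⟨ eq ⟨
    x * N′       ∎)
    where
    open ≤-Reasoning
    rearrange : ∀ a b c → a * b * c ≡ c * b * a
    rearrange = solve-∀

-- Entries of the list are subsets together with the state of their path.
average-inChain : ∀ {N} (c : Vec Interval n) (L : List (ℕ × Subset n)) v →
  .{{_ : NonZero (List.length L)}} →
  All (λ (s , B) → Path K s c B) L →
  S * List.length L ≡ total proj₁ L * N →
  (∀ i → v i * List.length L ≡ total (λ (_ , B) → bit B i) L * N) →
  InChain N K S c v
average-inChain {K = K} {S} {N} [] L v ps eqS eqv = ≤-antisym
  (scale-≤ {N} {List.length L} eqS (total-≤ (All.map (λ { {s , []} p → ≤-reflexive p }) ps)))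
  (scale-≥ {N} {List.length L} eqS (total-≥ (All.map (λ { {s , []} p → ≤-reflexive (sym p) }) ps)))
average-inChain {n = suc n} {K = K} {S} {N} ((l , h) ∷ c) L v ps eqS eqv =
  subst (v zero ≤_) (*-identityʳ N)
    (scale-≤ {N} {List.length L} (eqv zero) (total-≤ (All.universal (λ (_ , B) → bit≤1 B zero) L)))
  , scale-≥ {N} {List.length L} eqS′ (total-≥ (All.map (λ { {s , β ∷ B} (p , _) → p }) ps))
  , scale-≤ {N} {List.length L} eqS′ (total-≤ (All.map (λ { {s , β ∷ B} (_ , p , _) → p }) ps))
  , average-inChain c (List.map next L) (v ∘ suc) {{nz}}
      (All.map⁺ (All.map (λ { {s , β ∷ B} (_ , _ , p) → p }) ps))
      (trans (cong ((S + v zero) *_) len) (trans eqS′ (cong (_* N) (sym (total-map proj₁ next L)))))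
      (λ i → trans (cong (v (suc i) *_) len) (trans (eqv (suc i)) (cong (_* N)
        (trans (total-cong (λ { (s , β ∷ B) → refl }) L) (sym (total-map _ next L))))))
  where
  next : ℕ × Subset (suc n) → ℕ × Subset n
  next (s , β ∷ B) = step β s , B

  len : List.length (List.map next L) ≡ List.length L
  len = length-map next L

  nz : NonZero (List.length (List.map next L))
  nz = subst NonZero (sym len) (recompute′ L)
    where
    recompute′ : ∀ {A : Set} (L : List A) → .{{_ : NonZero (List.length L)}} → NonZero (List.length L)
    recompute′ (_ ∷ _) = _

  open ≡-Reasoning

  eqS′ : (S + v zero) * List.length L ≡ total (proj₁ ∘ next) L * N
  eqS′ = begin
    (S + v zero) * List.length L
      ≡⟨ *-distribʳ-+ (List.length L) S (v zero) ⟩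
    S * List.length L + v zero * List.length L
      ≡⟨ cong₂ _+_ eqS (eqv zero) ⟩
    total proj₁ L * N + total (λ (_ , B) → bit B zero) L * N
      ≡⟨ *-distribʳ-+ N (total proj₁ L) _ ⟨
    (total proj₁ L + total (λ (_ , B) → bit B zero) L) * N
      ≡⟨ cong (_* N) (total-+ proj₁ (λ (_ , B) → bit B zero) L) ⟨
    total (λ (s , B) → s + bit B zero) L * N
      ≡⟨ cong (_* N) (total-cong (λ { (s , β ∷ B) → sym (step≡bit+ β B s) }) L) ⟩
    total (proj₁ ∘ next) L * N ∎

-- Conversely, v / N with prefix sums V / N is the average over j < N of the
-- subsets whose running counts are the floors of (V + j) / N.
sum< : ℕ → (ℕ → ℕ) → ℕ
sum< zero    f = 0
sum< (suc m) f = f m + sum< m f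

sum<-shift : ∀ m (f : ℕ → ℕ) → sum< m (f ∘ suc) + f 0 ≡ sum< m f + f m
sum<-shift zero    f = refl
sum<-shift (suc m) f = begin
  f (suc m) + sum< m (f ∘ suc) + f 0    ≡⟨ +-assoc (f (suc m)) _ _ ⟩
  f (suc m) + (sum< m (f ∘ suc) + f 0)  ≡⟨ cong (f (suc m) +_) (sum<-shift m f) ⟩
  f (suc m) + (sum< m f + f m)          ≡⟨ rearrange (f (suc m)) (sum< m f) (f m) ⟩
  f m + sum< m f + f (suc m)            ∎
  where
  open ≡-Reasoning
  rearrange : ∀ a b c → a + (b + c) ≡ c + b + a
  rearrange = solve-∀

sum<-cong : ∀ m {f g : ℕ → ℕ} → (∀ j → j < m → f j ≡ g j) → sum< m f ≡ sum< m g
sum<-cong zero    eq = refl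
sum<-cong (suc m) eq =
  cong₂ _+_ (eq m ≤-refl) (sum<-cong m (λ j j<m → eq j (m≤n⇒m≤1+n j<m)))

sum<-zero : ∀ m → sum< m (λ _ → 0) ≡ 0
sum<-zero zero    = refl
sum<-zero (suc m) = sum<-zero m

sum<-+ : ∀ m (f g : ℕ → ℕ) → sum< m (λ j → f j + g j) ≡ sum< m f + sum< m g
sum<-+ zero    f g = refl
sum<-+ (suc m) f g rewrite sum<-+ m f g = interchange (f m) (g m) (sum< m f) (sum< m g)
  where
  interchange : ∀ a b c d → a + b + (c + d) ≡ a + c + (b + d)
  interchange = solve-∀

ascent : ℕ → ℕ → Side
ascent p q with p <? q
... | yes _ = inside
... | no _  = outside

step-ascent : ∀ {p q} → p ≤ q → q ≤ suc p → step (ascent p q) p ≡ q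
step-ascent {p} {q} p≤q q≤1+p with p <? q
... | yes p<q = ≤-antisym p<q q≤1+p
... | no p≮q  = ≤-antisym p≤q (≮⇒≥ p≮q)

module _ (N : ℕ) .{{_ : NonZero N}} where

  [x+N]/N : ∀ x → (x + N) / N ≡ suc (x / N)
  [x+N]/N x = trans (+-distrib-/-∣ʳ x {N} {N} ∣-refl)
                    (trans (cong (x / N +_) (n/n≡1 N)) (+-comm (x / N) 1))

  -- Hermite's identity. Passing from `S` to `suc S` replaces the term `S / N` by `(S + N) / N`,
  -- which is larger by one.
  hermite : ∀ S → sum< N (λ j → (S + j) / N) ≡ S
  hermite zero = trans (sum<-cong N (λ j j<N → m<n⇒m/n≡0 j<N)) (sum<-zero N)
  hermite (suc S) = +-cancelʳ-≡ ((S + 0) / N) _ _ (begin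
    sum< N (λ j → (suc S + j) / N) + (S + 0) / N
      ≡⟨ cong (_+ (S + 0) / N) (sum<-cong N (λ j _ → cong (_/ N) (sym (+-suc S j)))) ⟩
    sum< N (λ j → (S + suc j) / N) + (S + 0) / N
      ≡⟨ sum<-shift N (λ j → (S + j) / N) ⟩
    sum< N (λ j → (S + j) / N) + (S + N) / N
      ≡⟨ cong₂ _+_ (hermite S) ([x+N]/N S) ⟩
    S + suc (S / N)
      ≡⟨ +-suc S _ ⟩
    suc S + S / N
      ≡⟨ cong (λ x → suc S + x / N) (+-identityʳ S) ⟨
    suc S + (S + 0) / N ∎)
    where open ≡-Reasoning

  round : ∀ {n} → ℕ → ℕ → (Fin n → ℕ) → Subset n
  round {zero}  j S v = []
  round {suc n} j S v = ascent ((S + j) / N) ((S + v zero + j) / N) ∷ round j (S + v zero) (v ∘ suc)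

  -- An entry of at most `N` raises the floor by at most one, so a single bit records the change.
  step-round : ∀ {S v} j → v ≤ N →
               step (ascent ((S + j) / N) ((S + v + j) / N)) ((S + j) / N) ≡ (S + v + j) / N
  step-round {S} {v} j v≤N = step-ascent (/-monoˡ-≤ N (+-monoˡ-≤ j (m≤m+n S v))) (begin
      (S + v + j) / N   ≤⟨ /-monoˡ-≤ N (+-monoˡ-≤ j (+-monoʳ-≤ S v≤N)) ⟩
      (S + N + j) / N   ≡⟨ cong (_/ N) (rearrange S N j) ⟩
      (S + j + N) / N   ≡⟨ [x+N]/N (S + j) ⟩
      suc ((S + j) / N) ∎)
    where
    open ≤-Reasoning
    rearrange : ∀ a b c → a + b + c ≡ a + c + b
    rearrange = solve-∀

  div-lower : ∀ {l S} j → N * l ≤ S → l ≤ (S + j) / N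
  div-lower {l} {S} j le = begin
    l             ≡⟨ m*n/n≡m l N ⟨
    l * N / N     ≤⟨ /-monoˡ-≤ N (≤-trans (≤-reflexive (*-comm l N)) (≤-trans le (m≤m+n S j))) ⟩
    (S + j) / N   ∎
    where open ≤-Reasoning

  div-upper : ∀ {h S j} → j < N → S ≤ N * h → (S + j) / N ≤ h
  div-upper {h} {S} {j} j<N le = ≤-pred (m<n*o⇒m/o<n (begin-strict
    S + j       <⟨ +-mono-≤-< le j<N ⟩
    N * h + N   ≡⟨ trans (cong (_+ N) (*-comm N h)) (+-comm (h * N) N) ⟩
    suc h * N   ∎))
    where open ≤-Reasoning

  round-path : ∀ {n K S} (c : Vec Interval n) v {j} → j < N → InChain N K S c v →
               Path K ((S + j) / N) c (round j S v)
  round-path {K = K} [] v {j} j<N refl =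
    ≤-antisym (div-upper j<N ≤-refl) (div-lower j ≤-refl)
  round-path {S = S} ((l , h) ∷ c) v {j} j<N (v≤N , ≥l , ≤h , rest)
    rewrite step-round {S} {v zero} j v≤N =
    div-lower j ≥l , div-upper j<N ≤h , round-path c (v ∘ suc) j<N rest

  rounds : ∀ {n} → ℕ → (Fin n → ℕ) → List (Subset n)
  rounds m v = List.map (λ j → round j 0 v) (List.downFrom m)

  total-downFrom : ∀ m (f : ℕ → ℕ) → total f (List.downFrom m) ≡ sum< m f
  total-downFrom zero    f = refl
  total-downFrom (suc m) f = cong (f m +_) (total-downFrom m f)

  -- By `hermite` the floors before and after an element, summed over `j < N`, are the prefix sums
  -- themselves; the bits add up to their difference.
  sum-round : ∀ {n K S} (c : Vec Interval n) v → InChain N K S c v → ∀ i →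
              sum< N (λ j → bit (round j S v) i) ≡ v i
  sum-round {S = S} (_ ∷ c) v (v≤N , _) zero = +-cancelˡ-≡ S _ _ (begin
    S + sum< N β
      ≡⟨ cong (_+ sum< N β) (hermite S) ⟨
    sum< N (λ j → (S + j) / N) + sum< N β
      ≡⟨ sum<-+ N (λ j → (S + j) / N) β ⟨
    sum< N (λ j → (S + j) / N + β j)
      ≡⟨ sum<-cong N (λ j _ → trans (sym (step≡bit+ _ [] ((S + j) / N))) (step-round {S} j v≤N)) ⟩
    sum< N (λ j → (S + v zero + j) / N)
      ≡⟨ hermite (S + v zero) ⟩
    S + v zero ∎)
    where
    open ≡-Reasoning
    β : ℕ → ℕ
    β j = bit (round j S v) zero
  sum-round (_ ∷ c) v (_ , _ , _ , rest) (suc i) = sum-round c (v ∘ suc) rest i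

  inChain-average : ∀ {n K} (c : Vec Interval n) v → InChain N K 0 c v →
    ∃ λ L → List.length L ≡ N × All (Path K 0 c) L × ∀ i → total (λ B → bit B i) L ≡ v i
  inChain-average {K = K} c v inC = rounds N v
    , trans (length-map _ (List.downFrom N)) (length-downFrom N)
    , All.map⁺ (All.tabulate λ {j} j∈ → let j<N = ∈-downFrom⁻ j∈ in
        subst (λ s → Path K s c (round j 0 v)) (m<n⇒m/n≡0 j<N) (round-path c v j<N inC))
    , λ i → trans (total-map _ _ (List.downFrom N)) (trans (total-downFrom N _) (sum-round c v inC i))

-- Points of a base polytope are averages of lists of bases

-- Repeated addition instead of a normalised fraction makes the homomorphism laws inductions; only
-- `denominator-clears` needs the link to fractions given by `toℚᵘ-ι`.
ι : ℕ → ℚ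
ι zero    = 0ℚ
ι (suc n) = 1ℚ ℚ.+ ι n

ι-+ : ∀ m n → ι (m + n) ≡ ι m ℚ.+ ι n
ι-+ zero    n = sym (ℚ.+-identityˡ (ι n))
ι-+ (suc m) n = trans (cong (1ℚ ℚ.+_) (ι-+ m n)) (sym (ℚ.+-assoc 1ℚ (ι m) (ι n)))

ι-* : ∀ m n → ι (m * n) ≡ ι m ℚ.* ι n
ι-* zero    n = sym (ℚ.*-zeroˡ (ι n))
ι-* (suc m) n = begin
  ι (n + m * n)                        ≡⟨ ι-+ n (m * n) ⟩
  ι n ℚ.+ ι (m * n)                    ≡⟨ cong₂ ℚ._+_ (sym (ℚ.*-identityˡ (ι n))) (ι-* m n) ⟩
  1ℚ ℚ.* ι n ℚ.+ ι m ℚ.* ι n           ≡⟨ ℚ.*-distribʳ-+ (ι n) 1ℚ (ι m) ⟨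
  (1ℚ ℚ.+ ι m) ℚ.* ι n                 ∎
  where open ≡-Reasoning

ι-nonNegative : ∀ n → 0ℚ ℚ.≤ ι n
ι-nonNegative zero    = ℚ.≤-refl
ι-nonNegative (suc n) = ℚ.+-mono-≤ {0ℚ} {1ℚ} (ℚ.nonNegative⁻¹ 1ℚ) (ι-nonNegative n)

ι-positive : ∀ n → ℚ.Positive (ι (suc n))
ι-positive n = ℚ.positive (ℚ.+-mono-<-≤ {0ℚ} {1ℚ} (ℚ.positive⁻¹ 1ℚ) (ι-nonNegative n))

ι-injective : ∀ {m n} → ι m ≡ ι n → m ≡ n
ι-injective {zero}  {zero}  eq = refl
ι-injective {zero}  {suc n} eq = ⊥-elim (ℚ.<-irrefl eq (ℚ.positive⁻¹ _ {{ι-positive n}}))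
ι-injective {suc m} {zero}  eq = ⊥-elim (ℚ.<-irrefl (sym eq) (ℚ.positive⁻¹ _ {{ι-positive m}}))
ι-injective {suc m} {suc n} eq = cong suc (ι-injective (∙-cancelˡ 1ℚ (ι m) (ι n) eq))

toℚᵘ-ι : ∀ n → toℚᵘ (ι n) ≃ᵘ mkℚᵘ (ℤ.+ n) 0
toℚᵘ-ι zero    = ℚᵘ.≃-refl
toℚᵘ-ι (suc n) = ℚᵘ.≃-trans (ℚ.toℚᵘ-homo-+ 1ℚ (ι n))
  (ℚᵘ.≃-trans (ℚᵘ.+-congʳ (toℚᵘ 1ℚ) (toℚᵘ-ι n))
    (*≡* (cong (ℤ._* ℤ.1ℤ) (cong ℤ.suc (ℤ.*-identityʳ (ℤ.+ n))))))

denominator-clears : ∀ {q} → 0ℚ ℚ.≤ q → ∃₂ λ d p → q ℚ.* ι (suc d) ≡ ι p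
denominator-clears {mkℚ -[1+ p ] d c} (ℚ.*≤* ())
denominator-clears {q@(mkℚ (ℤ.+ p) d c)} 0≤q = d , p , ℚ.toℚᵘ-injective
  (ℚᵘ.≃-trans (ℚ.toℚᵘ-homo-* q (ι (suc d)))
    (ℚᵘ.≃-trans (ℚᵘ.*-congˡ {toℚᵘ q} (toℚᵘ-ι (suc d)))
      (ℚᵘ.≃-trans (*≡* (trans (ℤ.*-identityʳ _)
          (cong ((ℤ.+ p) ℤ.*_) (cong ℤ.+_ (sym (*-identityʳ (suc d)))))))
        (ℚᵘ.≃-sym (toℚᵘ-ι p)))))

common-denominator : ∀ {s} (w : Fin s → ℚ) → (∀ j → 0ℚ ℚ.≤ w j) →
  ∃₂ λ T (W : Fin s → ℕ) → ∀ j → w j ℚ.* ι (suc T) ≡ ι (W j)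
common-denominator {zero} w w≥0 = 0 , (λ ()) , λ ()
common-denominator {suc s} w w≥0
  with d , p , eq ← denominator-clears (w≥0 zero)
     | T , W , eqs ← common-denominator (w ∘ suc) (w≥0 ∘ suc) =
  -- The successor of this number is `suc d * suc T`, the product of the denominators.
  T + d * suc T , (λ { zero → p * suc T ; (suc j) → W j * suc d }) , λ
    { zero → begin
        w zero ℚ.* ι (suc d * suc T)           ≡⟨ cong (w zero ℚ.*_) (ι-* (suc d) (suc T)) ⟩
        w zero ℚ.* (ι (suc d) ℚ.* ι (suc T))   ≡⟨ ℚ.*-assoc (w zero) (ι (suc d)) (ι (suc T)) ⟨
        w zero ℚ.* ι (suc d) ℚ.* ι (suc T)     ≡⟨ cong (ℚ._* ι (suc T)) eq ⟩
        ι p ℚ.* ι (suc T)                      ≡⟨ ι-* p (suc T) ⟨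
        ι (p * suc T)                          ∎
    ; (suc j) → begin
        w (suc j) ℚ.* ι (suc d * suc T)          ≡⟨ cong (λ x → w (suc j) ℚ.* ι x) (*-comm (suc d) (suc T)) ⟩
        w (suc j) ℚ.* ι (suc T * suc d)          ≡⟨ cong (w (suc j) ℚ.*_) (ι-* (suc T) (suc d)) ⟩
        w (suc j) ℚ.* (ι (suc T) ℚ.* ι (suc d))  ≡⟨ ℚ.*-assoc (w (suc j)) (ι (suc T)) (ι (suc d)) ⟨
        w (suc j) ℚ.* ι (suc T) ℚ.* ι (suc d)    ≡⟨ cong (ℚ._* ι (suc d)) (eqs j) ⟩
        ι (W j) ℚ.* ι (suc d)                    ≡⟨ ι-* (W j) (suc d) ⟨
        ι (W j * suc d)                          ∎
    }
  where open ≡-Reasoning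

count : Fin n → List (Subset n) → ℕ
count i = total (λ B → bit B i)

e≡ι-bit : ∀ (B : Subset n) i → e[ B ] i ≡ ι (bit B i)
e≡ι-bit B i with lookup B i
... | outside = refl
... | inside  = refl

repeat : ∀ {s} → (Fin s → ℕ) → (Fin s → Subset n) → List (Subset n)
repeat {s = zero}  W B = []
repeat {s = suc s} W B = List.replicate (W zero) (B zero) List.++ repeat (W ∘ suc) (B ∘ suc)

total-++ : ∀ (f : A → ℕ) xs ys → total f (xs List.++ ys) ≡ total f xs + total f ys
total-++ f []       ys = refl
total-++ f (x ∷ xs) ys = trans (cong (f x +_) (total-++ f xs ys)) (sym (+-assoc (f x) _ _))

total-replicate : ∀ (f : A → ℕ) m x → total f (List.replicate m x) ≡ m * f x
total-replicate f zero    x = refl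
total-replicate f (suc m) x = cong (λ y → f x + y) (total-replicate f m x)

length≡total : ∀ (xs : List A) → List.length xs ≡ total (λ _ → 1) xs
length≡total []       = refl
length≡total (x ∷ xs) = cong suc (length≡total xs)

total-repeat : ∀ {s} (f : Subset n → ℕ) (W : Fin s → ℕ) B (w : Fin s → ℚ) T →
               (∀ j → w j ℚ.* T ≡ ι (W j)) →
               ι (total f (repeat W B)) ≡ sumℚ (λ j → w j ℚ.* ι (f (B j))) ℚ.* T
total-repeat {s = zero} f W B w T eq = sym (ℚ.*-zeroˡ T)
total-repeat {s = suc s} f W B w T eq = begin
  ι (total f (List.replicate (W zero) (B zero) List.++ repeat (W ∘ suc) (B ∘ suc)))
    ≡⟨ cong ι (total-++ f (List.replicate (W zero) (B zero)) _) ⟩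
  ι (total f (List.replicate (W zero) (B zero)) + total f (repeat (W ∘ suc) (B ∘ suc)))
    ≡⟨ ι-+ (total f (List.replicate (W zero) (B zero))) _ ⟩
  ι (total f (List.replicate (W zero) (B zero))) ℚ.+ ι (total f (repeat (W ∘ suc) (B ∘ suc)))
    ≡⟨ cong₂ ℚ._+_ head (total-repeat f (W ∘ suc) (B ∘ suc) (w ∘ suc) T (eq ∘ suc)) ⟩
  w zero ℚ.* ι (f (B zero)) ℚ.* T ℚ.+ sumℚ (λ j → w (suc j) ℚ.* ι (f (B (suc j)))) ℚ.* T
    ≡⟨ ℚ.*-distribʳ-+ T (w zero ℚ.* ι (f (B zero))) _ ⟨
  sumℚ (λ j → w j ℚ.* ι (f (B j))) ℚ.* T ∎
  where
  open ≡-Reasoning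
  head : ι (total f (List.replicate (W zero) (B zero))) ≡ w zero ℚ.* ι (f (B zero)) ℚ.* T
  head = begin
    ι (total f (List.replicate (W zero) (B zero))) ≡⟨ cong ι (total-replicate f (W zero) (B zero)) ⟩
    ι (W zero * f (B zero))              ≡⟨ ι-* (W zero) (f (B zero)) ⟩
    ι (W zero) ℚ.* ι (f (B zero))        ≡⟨ cong (ℚ._* ι (f (B zero))) (eq zero) ⟨
    w zero ℚ.* T ℚ.* ι (f (B zero))      ≡⟨ ℚ.*-assoc (w zero) T _ ⟩
    w zero ℚ.* (T ℚ.* ι (f (B zero)))    ≡⟨ cong (w zero ℚ.*_) (ℚ.*-comm T _) ⟩
    w zero ℚ.* (ι (f (B zero)) ℚ.* T)    ≡⟨ ℚ.*-assoc (w zero) _ T ⟨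
    w zero ℚ.* ι (f (B zero)) ℚ.* T      ∎

sumℚ-cong : ∀ {s} {f g : Fin s → ℚ} → (∀ j → f j ≡ g j) → sumℚ f ≡ sumℚ g
sumℚ-cong {zero}  eq = refl
sumℚ-cong {suc s} eq = cong₂ ℚ._+_ (eq zero) (sumℚ-cong (eq ∘ suc))

repeat-all : ∀ {P : Subset n → Set} {s} (W : Fin s → ℕ) B → (∀ j → P (B j)) → All P (repeat W B)
repeat-all {s = zero}  W B PB = []
repeat-all {s = suc s} W B PB =
  All.++⁺ (All.replicate⁺ (W zero) (PB zero)) (repeat-all (W ∘ suc) (B ∘ suc) (PB ∘ suc))

-- Over a common denominator `suc T` the weights of the convex combination become multiplicities in
-- a list. As the weights sum to one, its length is `suc T`.
polytope⇒average : ∀ (M : Matroid n) {x} → Polytope M x →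
  ∃ λ L → NonZero (List.length L) × All (Basis M) L ×
          ∀ i → x i ℚ.* ι (List.length L) ≡ ι (count i L)
polytope⇒average M {x} (s , v , w , vertex , w≥0 , Σw≡1 , x≡)
  with T , W , eq ← common-denominator w w≥0 =
  L , subst NonZero (sym len) _ , repeat-all W B (λ j → proj₁ (proj₂ (vertex j))) , λ i → begin
    x i ℚ.* ι (List.length L)
      ≡⟨ cong₂ ℚ._*_ (x≡ i) (cong ι len) ⟩
    sumℚ (λ j → w j ℚ.* v j i) ℚ.* ι (suc T)
      ≡⟨ cong (ℚ._* ι (suc T)) (sumℚ-cong λ j → cong (w j ℚ.*_)
           (trans (proj₂ (proj₂ (vertex j)) i) (e≡ι-bit (B j) i))) ⟩
    sumℚ (λ j → w j ℚ.* ι (bit (B j) i)) ℚ.* ι (suc T)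
      ≡⟨ total-repeat (λ B → bit B i) W B w (ι (suc T)) eq ⟨
    ι (count i L) ∎
  where
  open ≡-Reasoning
  B = λ j → proj₁ (vertex j)
  L = repeat W B

  len : List.length L ≡ suc T
  len = ι-injective (begin
    ι (List.length L)           ≡⟨ cong ι (length≡total L) ⟩
    ι (total (λ _ → 1) L)       ≡⟨ total-repeat (λ _ → 1) W B w (ι (suc T)) eq ⟩
    sumℚ (λ j → w j ℚ.* ι 1) ℚ.* ι (suc T)
      ≡⟨ cong (ℚ._* ι (suc T)) (sumℚ-cong λ j →
           trans (cong (w j ℚ.*_) (ℚ.+-identityʳ 1ℚ)) (ℚ.*-identityʳ (w j))) ⟩
    sumℚ w ℚ.* ι (suc T)        ≡⟨ cong (ℚ._* ι (suc T)) Σw≡1 ⟩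
    1ℚ ℚ.* ι (suc T)            ≡⟨ ℚ.*-identityˡ _ ⟩
    ι (suc T)                   ∎)

sumℚ-lookup : ∀ (f : A → ℕ) r L → sumℚ (λ j → r ℚ.* ι (f (List.lookup L j))) ≡ r ℚ.* ι (total f L)
sumℚ-lookup f r [] = sym (ℚ.*-zeroʳ r)
sumℚ-lookup f r (B ∷ L) = begin
  r ℚ.* ι (f B) ℚ.+ sumℚ (λ j → r ℚ.* ι (f (List.lookup L j)))
    ≡⟨ cong (r ℚ.* ι (f B) ℚ.+_) (sumℚ-lookup f r L) ⟩
  r ℚ.* ι (f B) ℚ.+ r ℚ.* ι (total f L)   ≡⟨ ℚ.*-distribˡ-+ r (ι (f B)) (ι (total f L)) ⟨
  r ℚ.* (ι (f B) ℚ.+ ι (total f L))       ≡⟨ cong (r ℚ.*_) (ι-+ (f B) (total f L)) ⟨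
  r ℚ.* ι (f B + total f L)               ∎
  where open ≡-Reasoning

average⇒polytope : ∀ (M : Matroid n) {x} L → NonZero (List.length L) → All (Basis M) L →
                   (∀ i → x i ℚ.* ι (List.length L) ≡ ι (count i L)) → Polytope M x
average⇒polytope M {x} L@(_ ∷ L′) _ bases eq =
  List.length L , (λ j → e[ List.lookup L j ]) , (λ _ → N⁻¹) ,
  (λ j → List.lookup L j , All.lookup bases (∈-lookup j) , λ i → refl) ,
  (λ _ → ℚ.nonNegative⁻¹ N⁻¹ {{ℚ.pos⇒nonNeg N⁻¹ {{ℚ.1/pos⇒pos N {{posN}}}}}}) ,
  (begin
    sumℚ {List.length L} (λ _ → N⁻¹)
      ≡⟨ sumℚ-cong {List.length L} (λ j → sym (trans (cong (N⁻¹ ℚ.*_) (ℚ.+-identityʳ 1ℚ)) (ℚ.*-identityʳ N⁻¹))) ⟩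
    sumℚ {List.length L} (λ _ → N⁻¹ ℚ.* ι 1)   ≡⟨ sumℚ-lookup (λ _ → 1) N⁻¹ L ⟩
    N⁻¹ ℚ.* ι (total (λ _ → 1) L)              ≡⟨ cong (λ m → N⁻¹ ℚ.* ι m) (length≡total L) ⟨
    N⁻¹ ℚ.* N                                  ≡⟨ ℚ.*-inverseˡ N {{nzN}} ⟩
    1ℚ ∎) ,
  λ i → begin
    x i                        ≡⟨ ℚ.*-identityʳ (x i) ⟨
    x i ℚ.* 1ℚ                 ≡⟨ cong (x i ℚ.*_) (ℚ.*-inverseʳ N {{nzN}}) ⟨
    x i ℚ.* (N ℚ.* N⁻¹)          ≡⟨ ℚ.*-assoc (x i) N N⁻¹ ⟨
    x i ℚ.* N ℚ.* N⁻¹            ≡⟨ cong (ℚ._* N⁻¹) (eq i) ⟩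
    ι (count i L) ℚ.* N⁻¹        ≡⟨ ℚ.*-comm _ N⁻¹ ⟩
    N⁻¹ ℚ.* ι (count i L)        ≡⟨ sumℚ-lookup (λ B → bit B i) N⁻¹ L ⟨
    sumℚ (λ j → N⁻¹ ℚ.* ι (bit (List.lookup L j) i))
      ≡⟨ sumℚ-cong {List.length L} (λ j → cong (N⁻¹ ℚ.*_) (sym (e≡ι-bit (List.lookup L j) i))) ⟩
    sumℚ (λ j → N⁻¹ ℚ.* e[ List.lookup L j ] i) ∎
  where
  open ≡-Reasoning
  N : ℚ
  N = ι (List.length L)
  posN : ℚ.Positive N
  posN = ι-positive (List.length L′)
  nzN : ℚ.NonZero N
  nzN = ℚ.pos⇒nonZero N {{posN}}
  N⁻¹ : ℚ
  N⁻¹ = ℚ.1/_ N {{nzN}}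

polytope-mono : ∀ (M N : Matroid n) {x} → (∀ B → Basis M B → Basis N B) →
                Polytope M x → Polytope N x
polytope-mono M N sub (s , v , w , vertex , rest) =
  s , v , w , (λ j → let B , bB , eq = vertex j in B , sub B bB , eq) , rest

-- The fraction need not be reduced: any list of subsets averaging to `x` provides one, and
-- `isFraction-unique` compares two of them by cross-multiplication.
_isFraction_/_ : Point n → (Fin n → ℕ) → ℕ → Set
x isFraction v / N = ∀ i → x i ℚ.* ι N ≡ ι (v i)

isFraction-unique : ∀ (x : Point n) v v′ {N N′} → x isFraction v / N → x isFraction v′ / N′ →
                    ∀ i → v i * N′ ≡ v′ i * N
isFraction-unique x v v′ {N} {N′} eq eq′ i = ι-injective (begin
  ι (v i * N′)           ≡⟨ ι-* (v i) N′ ⟩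
  ι (v i) ℚ.* ι N′       ≡⟨ cong (ℚ._* ι N′) (eq i) ⟨
  x i ℚ.* ι N ℚ.* ι N′   ≡⟨ ℚ.*-assoc (x i) (ι N) (ι N′) ⟩
  x i ℚ.* (ι N ℚ.* ι N′) ≡⟨ cong (x i ℚ.*_) (ℚ.*-comm (ι N) (ι N′)) ⟩
  x i ℚ.* (ι N′ ℚ.* ι N) ≡⟨ ℚ.*-assoc (x i) (ι N′) (ι N) ⟨
  x i ℚ.* ι N′ ℚ.* ι N   ≡⟨ cong (ℚ._* ι N) (eq′ i) ⟩
  ι (v′ i) ℚ.* ι N       ≡⟨ ι-* (v′ i) N ⟨
  ι (v′ i * N)           ∎)
  where open ≡-Reasoning

polytope⇒inChain : ∀ {c : Vec Interval n} {ne x v N} → x isFraction v / N →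
                   Polytope (chain K 0 c ne) x → InChain N K 0 c v
polytope⇒inChain {n = n} {K = K} {c = c} {ne} {x} {v} {N} frac px
  with L , nz , bases , eq ← polytope⇒average (chain K 0 c ne) px =
  average-inChain c (List.map at-0 L) v {{subst NonZero (sym (length-map at-0 L)) nz}}
    (All.map⁺ bases)
    (sym (cong (_* N) (zeros L)))
    λ i → trans (cong (v i *_) (length-map at-0 L))
      (trans (isFraction-unique x v (λ i → count i L) frac eq i)
        (cong (_* N) (sym (total-map (λ (_ , B) → bit B i) at-0 L))))
  where
  at-0 : Subset n → ℕ × Subset n
  at-0 B = 0 , B

  zeros : ∀ L → total proj₁ (List.map at-0 L) ≡ 0
  zeros []      = refl
  zeros (_ ∷ L) = zeros L

inChain⇒polytope : ∀ {c : Vec Interval n} {ne x v N} .{{_ : NonZero N}} → x isFraction v / N →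
                   InChain N K 0 c v → Polytope (chain K 0 c ne) x
inChain⇒polytope {c = c} {ne} {x} {v} {N@(suc _)} frac inC
  with L , len , bases , eq ← inChain-average N c v inC =
  average⇒polytope (chain _ 0 c ne) L (subst NonZero (sym len) _) bases
    λ i → trans (cong (λ N → x i ℚ.* ι N) len) (trans (frac i) (cong ι (sym (eq i))))

-- Chains with a fixed beginning

-- The beginning is a list read backwards, as in a zipper. Moving an interval between the beginning
-- and the rest is then a definitional equality, both for the vector and for its length.
_ʳ+_ : List Interval → ℕ → ℕ
[]      ʳ+ j = j
(x ∷ z) ʳ+ j = z ʳ+ suc j

plug : ∀ z → Vec Interval j → Vec Interval (z ʳ+ j)
plug []      c = c
plug (x ∷ z) c = plug z (x ∷ c)

-- A path that ends at `K` satisfies these bounds anyway, so only the final count restricts the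
-- elements.
free : ∀ K j → Vec Interval j
free K j = Vec.replicate j (0 , K)

path-plug : ∀ z → (∀ s B → Path K s c B → Path K s c′ B) →
            ∀ s B → Path K s (plug z c) B → Path K s (plug z c′) B
path-plug []      f = f
path-plug (_ ∷ z) f = path-plug z λ { s (β ∷ B) (l≤ , ≤h , p) → l≤ , ≤h , f (step β s) B p }

inChain-plug-∪ : ∀ z {c₁ c₂ : Vec Interval j} {N} →
  (∀ S v → InChain N K S c v → InChain N K S c₁ v ⊎ InChain N K S c₂ v) →
  ∀ S v → InChain N K S (plug z c) v → InChain N K S (plug z c₁) v ⊎ InChain N K S (plug z c₂) v
inChain-plug-∪ []      f = f
inChain-plug-∪ (_ ∷ z) f = inChain-plug-∪ z λ S v (≤N , l≤ , ≤h , p) →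
  [ (λ p → inj₁ (≤N , l≤ , ≤h , p)) , (λ p → inj₂ (≤N , l≤ , ≤h , p)) ]′ (f (S + v zero) (v ∘ suc) p)

inChain-plug-∩ : ∀ z {c₁ c₂ : Vec Interval j} {N} →
  (∀ S v → InChain N K S c₁ v → InChain N K S c₂ v → InChain N K S c v) →
  ∀ S v → InChain N K S (plug z c₁) v → InChain N K S (plug z c₂) v → InChain N K S (plug z c) v
inChain-plug-∩ []      f = f
inChain-plug-∩ (_ ∷ z) f = inChain-plug-∩ z λ S v (≤N , l≤ , ≤h , p) (_ , _ , _ , q) →
  ≤N , l≤ , ≤h , f (S + v zero) (v ∘ suc) p q

path-free : ∀ {s} j (B : Subset j) → s + ∣ B ∣ ≡ K → Path K s (free K j) B
path-free {s = s} zero [] eq = trans (sym (+-identityʳ s)) eq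
path-free {s = s} (suc j) (outside ∷ B) eq =
  z≤n , subst (s ≤_) eq (m≤m+n s ∣ B ∣) , path-free j B eq
path-free {s = s} (suc j) (inside ∷ B) eq =
  z≤n , subst (suc s ≤_) eq′ (m≤m+n (suc s) ∣ B ∣) , path-free j B eq′
  where eq′ = trans (sym (+-suc s ∣ B ∣)) eq

free-path : ∀ {s} j → s ≤ K → K ≤ s + j → ∃ (Path K s (free K j))
free-path {s = s} j s≤K K≤s+j with B , eq ← nonempty (U _ j (m≤n+o⇒m∸n≤o _ s K≤s+j)) =
  B , path-free j B (trans (cong (s +_) eq) (m+[n∸m]≡n s≤K))

mutual
  -- The counterpart of `Open` and `Closed`, built from the left. `r` counts the blocks already
  -- closed and leaves out the one in progress.
  data OpenPrefix : List Interval → ℕ → ℕ → Set where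
    start : ∀ {z} → ClosedPrefix z r a → OpenPrefix ((a , suc a) ∷ z) r a
    par   : ∀ {z} → OpenPrefix z r a → OpenPrefix ((a , suc a) ∷ z) r a
    ser   : ∀ {z} → OpenPrefix z r a → OpenPrefix ((suc a , suc (suc a)) ∷ z) r (suc a)

  data ClosedPrefix : List Interval → ℕ → ℕ → Set where
    nil : ClosedPrefix [] 0 0
    close : ∀ {z} → OpenPrefix z r a → ClosedPrefix ((suc a , suc a) ∷ z) (suc r) (suc a)

plug-open   : ∀ {z} → OpenPrefix z r a → Open K a m c → Closed K 0 (r + m) (plug z c)
plug-closed : ∀ {z} → ClosedPrefix z r a → Closed K a m c → Closed K 0 (r + m) (plug z c)
plug-open (start p) o = plug-closed p (start o)
plug-open (par p)   o = plug-open p (par o)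
plug-open (ser p)   o = plug-open p (ser o)
plug-closed nil o = o
plug-closed {K = K} {m = m} {c = c} (close {r = r} {a = a} {z = z} p) o =
  subst (λ r → Closed K 0 r (plug ((suc a , suc a) ∷ z) c)) (+-suc r m) (plug-open p (close o))

-- A block in progress can be left at either level of its strip, so a continuation from one of the
-- two suffices.
path-open   : ∀ {z} → OpenPrefix z r a → ∃ (Path K a c) ⊎ ∃ (Path K (suc a) c) → ∃ (Path K 0 (plug z c))
path-closed : ∀ {z} → ClosedPrefix z r a → ∃ (Path K a c) → ∃ (Path K 0 (plug z c))
path-open (start p) (inj₁ (B , q)) = path-closed p (outside ∷ B , ≤-refl , n≤1+n _ , q)
path-open (start p) (inj₂ (B , q)) = path-closed p (inside ∷ B , n≤1+n _ , ≤-refl , q)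
path-open (par p) (inj₁ (B , q)) = path-open p (inj₁ (outside ∷ B , ≤-refl , n≤1+n _ , q))
path-open (par p) (inj₂ (B , q)) = path-open p (inj₂ (outside ∷ B , n≤1+n _ , ≤-refl , q))
path-open (ser p) (inj₁ (B , q)) = path-open p (inj₁ (inside ∷ B , ≤-refl , n≤1+n _ , q))
path-open (ser p) (inj₂ (B , q)) = path-open p (inj₂ (inside ∷ B , n≤1+n _ , ≤-refl , q))
path-closed nil q = q
path-closed (close p) (B , q) = path-open p (inj₁ (inside ∷ B , ≤-refl , ≤-refl , q))

-- Behind an open prefix the count is known up to one, so different intervals may impose the same
-- condition. This allows a free or a cut interval to be renamed into a letter without a change of
-- bases.
path-after-open : ∀ {z} → OpenPrefix z r a →
  (∀ {s} B → a ≤ s → s ≤ suc a → Path K s c B → Path K s c′ B) →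
  ∀ {B} → Path K 0 (plug z c) B → Path K 0 (plug z c′) B
path-after-open (start {z = z} p) f = path-plug z (λ { s (β ∷ B) (l≤ , ≤h , q) → l≤ , ≤h , f B l≤ ≤h q }) 0 _
path-after-open (par {z = z} p)   f = path-plug z (λ { s (β ∷ B) (l≤ , ≤h , q) → l≤ , ≤h , f B l≤ ≤h q }) 0 _
path-after-open (ser {z = z} p)   f = path-plug z (λ { s (β ∷ B) (l≤ , ≤h , q) → l≤ , ≤h , f B l≤ ≤h q }) 0 _

path-after-closed : ∀ {z} → ClosedPrefix z r a →
  (∀ {s} B → a ≤ s → s ≤ a → Path K s c B → Path K s c′ B) →
  ∀ {B} → Path K 0 (plug z c) B → Path K 0 (plug z c′) B
path-after-closed nil f = f _ ≤-refl ≤-refl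
path-after-closed (close {z = z} p) f =
  path-plug z (λ { s (β ∷ B) (l≤ , ≤h , q) → l≤ , ≤h , f B l≤ ≤h q }) 0 _

-- Coefficients

sumℤ-cong : ∀ {s} {f f′ : Fin s → ℤ} → (∀ i → f i ≡ f′ i) → sumℤ f ≡ sumℤ f′
sumℤ-cong {zero}  eq = refl
sumℤ-cong {suc s} eq = cong₂ ℤ._+_ (eq zero) (sumℤ-cong (eq ∘ suc))

coeff-sum : ∀ {s} (p : Fin s → ℤ[t]) i → coeff (sum p) i ≡ sumℤ (λ j → coeff (p j) i)
coeff-sum {zero}  p i = refl
coeff-sum {suc s} p i = trans (coeff-+ᵖ (p zero) _ i)
  (cong (ℤ._+_ (coeff (p zero) i)) (coeff-sum (p ∘ suc) i))

coeff-· : ∀ m p i → coeff (m · p) i ≡ (ℤ.+ m) ℤ.* coeff p i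
coeff-· zero    p i = refl
coeff-· (suc m) p i = begin
  coeff (p +ᵖ (m · p)) i                    ≡⟨ coeff-+ᵖ p (m · p) i ⟩
  coeff p i ℤ.+ coeff (m · p) i             ≡⟨ cong (ℤ._+_ (coeff p i)) (coeff-· m p i) ⟩
  coeff p i ℤ.+ (ℤ.+ m) ℤ.* coeff p i       ≡⟨ ℤ.suc-* (ℤ.+ m) (coeff p i) ⟨
  ℤ.suc (ℤ.+ m) ℤ.* coeff p i               ∎
  where open ≡-Reasoning

coeff-×ᶻ : ∀ b p i → coeff (_×ᶻ_ ℤ[t]-+-abelianGroup b p) i ≡ b ℤ.* coeff p i
coeff-×ᶻ (ℤ.+ m)  p i = coeff-· m p i
coeff-×ᶻ -[1+ m ] p i = begin
  coeff (-ᵖ (suc m · p)) i            ≡⟨ coeff--ᵖ (suc m · p) i ⟩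
  ℤ.- coeff (suc m · p) i             ≡⟨ cong ℤ.-_ (coeff-· (suc m) p i) ⟩
  ℤ.- ((ℤ.+ suc m) ℤ.* coeff p i)     ≡⟨ ℤ.neg-distribˡ-* (ℤ.+ suc m) (coeff p i) ⟩
  -[1+ m ] ℤ.* coeff p i              ∎
  where open ≡-Reasoning

infix 4 _≐_
_≐_ : (ℕ → ℤ) → (ℕ → ℤ) → Set
f ≐ g = ∀ i → f i ≡ g i

-- Multiplication by - t
sh : (ℕ → ℤ) → ℕ → ℤ
sh f zero    = 0ℤ
sh f (suc i) = ℤ.- f i

shift : ℕ → (ℕ → ℤ) → ℕ → ℤ
shift zero    f = f
shift (suc r) f = sh (shift r f)

shift-sh : ∀ r f → shift r (sh f) ≡ shift (suc r) f
shift-sh zero    f = refl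
shift-sh (suc r) f = cong sh (shift-sh r f)

shift-split : ∀ r f g f′ →
  shift r (λ i → (f i ℤ.+ g i) ℤ.- sh f′ i) ≐ λ i → (shift r f i ℤ.+ shift r g i) ℤ.- shift (suc r) f′ i
shift-split zero    f g f′ i       = refl
shift-split (suc r) f g f′ zero    = refl
shift-split (suc r) f g f′ (suc i) =
  trans (cong ℤ.-_ (shift-split r f g f′ i)) (neg-split (shift r f i) (shift r g i) (shift (suc r) f′ i))
  where
  neg-split : ∀ x y z → ℤ.- ((x ℤ.+ y) ℤ.- z) ≡ (ℤ.- x ℤ.+ ℤ.- y) ℤ.- (ℤ.- z)
  neg-split = ℤ.solve-∀

δ₀ : ℕ → ℤ
δ₀ zero    = 1ℤ
δ₀ (suc i) = 0ℤ

-- The signed value of a direct sum of `r` series-parallel matroids without loops and coloops: each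
-- of its `r` components contributes `- t`.
[-1]^r*t^r : ∀ r i → (-1ℤ ℤ.^ r) ℤ.* coeff (t^ r) i ≡ shift r δ₀ i
[-1]^r*t^r zero    zero    = refl
[-1]^r*t^r zero    (suc i) = refl
[-1]^r*t^r (suc r) zero    = ℤ.*-zeroʳ (-1ℤ ℤ.^ suc r)
[-1]^r*t^r (suc r) (suc i) = trans (neg (-1ℤ ℤ.^ r) (coeff (t^ r) i)) (cong ℤ.-_ ([-1]^r*t^r r i))
  where
  neg : ∀ x y → (-1ℤ ℤ.* x) ℤ.* y ≡ ℤ.- (x ℤ.* y)
  neg = ℤ.solve-∀

-- Signed coefficients of g and their values on chains

module Value (g : ∀ {n} → Matroid n → ℤ[t]) (isG : IsSpeyerG g) where
  open IsSpeyerG isG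

  abstract
    -- The signed coefficient is the additive quantity that covaluativity provides. It is opaque, so
    -- values are compared through the lemmas below and never by evaluating the component count.
    val : Matroid n → ℕ → ℤ
    val M i = (-1ℤ ℤ.^ #components M) ℤ.* coeff (g M) i

    val-def : ∀ (M : Matroid n) i → val M i ≡ (-1ℤ ℤ.^ #components M) ℤ.* coeff (g M) i
    val-def M i = refl

  val-valuation : ∀ {s} (M : Fin s → Matroid n) a → IndicatorRelation M a →
                  ∀ i → sumℤ (λ j → a j ℤ.* val (M j) i) ≡ 0ℤ
  val-valuation M a rel i = trans (sumℤ-cong λ j → begin
      a j ℤ.* val (M j) i             ≡⟨ cong (a j ℤ.*_) (val-def (M j) i) ⟩
      a j ℤ.* (σ j ℤ.* coeff (g (M j)) i)
        ≡⟨ cong (a j ℤ.*_) (coeff-×ᶻ (σ j) (g (M j)) i) ⟨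
      a j ℤ.* coeff (signed j) i      ≡⟨ coeff-×ᶻ (a j) (signed j) i ⟨
      coeff (_×ᶻ_ ℤ[t]-+-abelianGroup (a j) (signed j)) i ∎)
    (trans (sym (coeff-sum (λ j → _×ᶻ_ ℤ[t]-+-abelianGroup (a j) (signed j)) i))
      (coeff-≡ (covaluative M a rel) i))
    where
    open ≡-Reasoning
    σ = λ j → -1ℤ ℤ.^ #components (M j)
    signed = λ j → _×ᶻ_ ℤ[t]-+-abelianGroup (σ j) (g (M j))

  val-≅ : ∀ {M : Matroid m} {N : Matroid n} → M ≅ N → val M ≐ val N
  val-≅ {M = M} {N} M≅N i = trans (val-def M i) (trans (cong₂ (λ c x → (-1ℤ ℤ.^ c) ℤ.* x)
    (#components-≅ {M = M} {N} M≅N) (coeff-≡ (invariant M≅N) i)) (sym (val-def N i)))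

  val-cong : ∀ (M N : Matroid n) → (∀ {B} → Basis M B → Basis N B) →
             (∀ {B} → Basis N B → Basis M B) → val M ≐ val N
  val-cong M N to from = val-≅ {M = M} {N}
    (sum-≅ {M = M} {N = N} refl λ B → mk⇔ to from)

  -- The points whose prefix sum equals `m` cut the polytope into two parts. Both parts and the cut
  -- are base polytopes because chain polytopes are given by the prefix inequalities: an average of
  -- bases that lies on one side need not consist of bases on that side.
  val-split : ∀ z (c : Vec Interval j) l m h → l ≤ m → m ≤ h → ∀ ne ne₁ ne₂ ne₃ i →
    val (chain K 0 (plug z ((l , h) ∷ c)) ne) i ≡
    (val (chain K 0 (plug z ((l , m) ∷ c)) ne₁) i ℤ.+
     val (chain K 0 (plug z ((m , h) ∷ c)) ne₂) i) ℤ.-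
    val (chain K 0 (plug z ((m , m) ∷ c)) ne₃) i
  val-split {K = K} z c l m h l≤m m≤h ne ne₁ ne₂ ne₃ i =
    solve (val M i) (val M₁ i) (val M₂ i) (val M₃ i) (val-valuation Ms coeffs relation i)
    where
    M M₁ M₂ M₃ : Matroid _
    M  = chain K 0 (plug z ((l , h) ∷ c)) ne
    M₁ = chain K 0 (plug z ((l , m) ∷ c)) ne₁
    M₂ = chain K 0 (plug z ((m , h) ∷ c)) ne₂
    M₃ = chain K 0 (plug z ((m , m) ∷ c)) ne₃

    Ms : Fin 4 → Matroid _
    Ms zero                   = M
    Ms (suc zero)             = M₁
    Ms (suc (suc zero))       = M₂
    Ms (suc (suc (suc zero))) = M₃

    coeffs : Fin 4 → ℤ
    coeffs zero                   = 1ℤ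
    coeffs (suc zero)             = -1ℤ
    coeffs (suc (suc zero))       = -1ℤ
    coeffs (suc (suc (suc zero))) = 1ℤ

    solve : ∀ x x₁ x₂ x₃ →
            1ℤ ℤ.* x ℤ.+ (-1ℤ ℤ.* x₁ ℤ.+ (-1ℤ ℤ.* x₂ ℤ.+ (1ℤ ℤ.* x₃ ℤ.+ 0ℤ))) ≡ 0ℤ →
            x ≡ (x₁ ℤ.+ x₂) ℤ.- x₃
    solve x x₁ x₂ x₃ eq = trans (isolate x x₁ x₂ x₃)
      (trans (cong (ℤ._+ ((x₁ ℤ.+ x₂) ℤ.- x₃)) eq) (ℤ.+-identityˡ _))
      where
      isolate : ∀ x x₁ x₂ x₃ → x ≡
        (1ℤ ℤ.* x ℤ.+ (-1ℤ ℤ.* x₁ ℤ.+ (-1ℤ ℤ.* x₂ ℤ.+ (1ℤ ℤ.* x₃ ℤ.+ 0ℤ)))) ℤ.+ ((x₁ ℤ.+ x₂) ℤ.- x₃)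
      isolate = ℤ.solve-∀

    union : ∀ {x} → Polytope M x → Polytope M₁ x ⊎ Polytope M₂ x
    union {x} p with L , nz , bases , eq ← polytope⇒average M p =
      [ (λ q → inj₁ (inChain⇒polytope {ne = ne₁} {{nz}} eq q))
      , (λ q → inj₂ (inChain⇒polytope {ne = ne₂} {{nz}} eq q)) ]′
      (inChain-plug-∪ z here-∪ 0 (λ i → count i L) (polytope⇒inChain {ne = ne} eq p))
      where
      here-∪ : ∀ {N} S v → InChain N K S ((l , h) ∷ c) v →
               InChain N K S ((l , m) ∷ c) v ⊎ InChain N K S ((m , h) ∷ c) v
      here-∪ {N} S v (≤N , l≤ , ≤h , q) with ≤-total (S + v zero) (N * m)
      ... | inj₁ ≤m = inj₁ (≤N , l≤ , ≤m , q)
      ... | inj₂ m≤ = inj₂ (≤N , m≤ , ≤h , q)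

    intersection : ∀ {x} → Polytope M₁ x → Polytope M₂ x → Polytope M₃ x
    intersection {x} p₁ p₂ with L , nz , bases , eq ← polytope⇒average M₁ p₁ =
      inChain⇒polytope {ne = ne₃} {{nz}} eq
        (inChain-plug-∩ z (λ { S v (≤N , _ , ≤m , q) (_ , m≤ , _ , _) → ≤N , m≤ , ≤m , q })
          0 (λ i → count i L) (polytope⇒inChain {ne = ne₁} eq p₁) (polytope⇒inChain {ne = ne₂} eq p₂))

    widen : ∀ {l l′ h h′} → l′ ≤ l → h ≤ h′ →
            ∀ B → Path K 0 (plug z ((l , h) ∷ c)) B → Path K 0 (plug z ((l′ , h′) ∷ c)) B
    widen l′≤l h≤h′ = path-plug z
      (λ { s (β ∷ B) (l≤ , ≤h , q) → ≤-trans l′≤l l≤ , ≤-trans ≤h h≤h′ , q }) 0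

    relation : IndicatorRelation Ms coeffs
    relation x d with d zero | d (suc zero) | d (suc (suc zero)) | d (suc (suc (suc zero)))
    ... | yes _ | yes _  | yes _  | yes _  = refl
    ... | yes _ | yes p₁ | yes p₂ | no ¬p₃ = ⊥-elim (¬p₃ (intersection p₁ p₂))
    ... | yes _ | yes _  | no ¬p₂ | yes p₃ =
      ⊥-elim (¬p₂ (polytope-mono M₃ M₂ (widen ≤-refl m≤h) p₃))
    ... | yes _ | yes _  | no _   | no _   = refl
    ... | yes _ | no ¬p₁ | _      | yes p₃ =
      ⊥-elim (¬p₁ (polytope-mono M₃ M₁ (widen l≤m ≤-refl) p₃))
    ... | yes _ | no _   | yes _  | no _   = refl
    ... | yes p | no ¬p₁ | no ¬p₂ | no _   = ⊥-elim ([ ¬p₁ , ¬p₂ ]′ (union p))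
    ... | no ¬p | yes p₁ | _      | _      = ⊥-elim (¬p (polytope-mono M₁ M (widen ≤-refl m≤h) p₁))
    ... | no ¬p | _      | yes p₂ | _      = ⊥-elim (¬p (polytope-mono M₂ M (widen l≤m ≤-refl) p₂))
    ... | no ¬p | _      | _      | yes p₃ = ⊥-elim (¬p (polytope-mono M₃ M (widen l≤m m≤h) p₃))
    ... | no _  | no _   | no _   | no _   = refl

  val-closed : ∀ {c : Vec Interval n} → Closed K a r c → ∀ ne → val (chain K a c ne) ≐ shift r δ₀
  val-closed {K = K} {a} {r} {c} o ne i with Ms , sps , refl , eq , iff ← closed-sum o = begin
    val M i
      ≡⟨ val-def M i ⟩
    (-1ℤ ℤ.^ #components M) ℤ.* coeff (g M) i
      ≡⟨ cong₂ (λ c x → (-1ℤ ℤ.^ c) ℤ.* x) (#components-closed o ne)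
           (coeff-≡ (series-parallel M loopless coloopless Ms sps (sum-≅ {M = M} {N = proj₂ (⨁ Ms)} eq iff)) i) ⟩
    (-1ℤ ℤ.^ List.length Ms) ℤ.* coeff (t^ List.length Ms) i
      ≡⟨ [-1]^r*t^r (List.length Ms) i ⟩
    shift (List.length Ms) δ₀ i ∎
    where
    open ≡-Reasoning
    M = chain K a c ne
    loopless : ¬ ∃ (Loop M)
    loopless (i , loop) with B , p , eq ← closed-bit o i inside = loop B p (lookup⇒[]= i B eq)
    coloopless : ¬ ∃ (Coloop M)
    coloopless (i , coloop) with B , p , eq ← closed-bit o i outside
      with () ← trans (sym ([]=⇒lookup (coloop B p))) eq

  val-open : ∀ {z} {c c′ : Vec Interval j} → OpenPrefix z r a →
    (∀ {s} B → a ≤ s → s ≤ suc a → Path K s c B → Path K s c′ B) →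
    (∀ {s} B → a ≤ s → s ≤ suc a → Path K s c′ B → Path K s c B) →
    ∀ ne ne′ → val (chain K 0 (plug z c) ne) ≐ val (chain K 0 (plug z c′) ne′)
  val-open p to from ne ne′ = val-cong (chain _ 0 _ ne) (chain _ 0 _ ne′)
    (path-after-open p to) (path-after-open p from)

  -- The contribution φ of a free part depends only on its length and rank:
  -- splitting at its first element leaves parallel, series and closing letters.
  FreeValue : ℕ → ℕ → (ℕ → ℤ) → Set
  FreeValue j k φ = ∀ {z r a K} → OpenPrefix z r a → K ≡ k + a → ∀ ne →
                    val (chain K 0 (plug z (free K j)) ne) ≐ shift r φ

  -- Behind a closed prefix the count is exactly `a`, so after one more element it is `a` or
  -- `suc a`: this element opens a block without any cutting. Hence `suc j` free elements here have
  -- the value of `j` behind an open prefix. `1 ≤ k` keeps `suc a` within the bound `K`.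
  freeValue-closed : ∀ {φ z} → FreeValue j k φ → 1 ≤ k → ClosedPrefix z r a → K ≡ k + a → ∀ ne →
                     val (chain K 0 (plug z (free K (suc j))) ne) ≐ shift r φ
  freeValue-closed {j = j} {k} {a = a} {z = z} fv 1≤k p refl ne@(B , q) i = trans
    (val-cong (chain _ 0 _ ne) (chain _ 0 _ ne′) (path-after-closed p to) (path-after-closed p from) i)
    (fv (start p) refl ne′ i)
    where
    to : ∀ {s} B → a ≤ s → s ≤ a → Path (k + a) s (free (k + a) (suc j)) B →
         Path (k + a) s ((a , suc a) ∷ free (k + a) j) B
    to (outside ∷ B) a≤s s≤a (_ , _ , q) = a≤s , m≤n⇒m≤1+n s≤a , q
    to (inside ∷ B) a≤s s≤a (_ , _ , q) = m≤n⇒m≤1+n a≤s , s≤s s≤a , q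
    from : ∀ {s} B → a ≤ s → s ≤ a → Path (k + a) s ((a , suc a) ∷ free (k + a) j) B →
           Path (k + a) s (free (k + a) (suc j)) B
    from (β ∷ B) a≤s s≤a (_ , ≤h , q) = z≤n , ≤-trans ≤h (+-monoˡ-≤ a 1≤k) , q
    ne′ : ∃ (Path (k + a) 0 (plug z ((a , suc a) ∷ free (k + a) j)))
    ne′ = B , path-after-closed p to q

  -- The last element has to reach the final count `suc a`, which closes the block.
  freeValue-1-1 : FreeValue 1 1 (sh δ₀)
  freeValue-1-1 {z} {r} {a} p refl ne@(B , q) i = begin
    val (chain (suc a) 0 (plug z (free (suc a) 1)) ne) i
      ≡⟨ val-open p to (λ { (β ∷ []) _ _ (_ , ≤h , q) → z≤n , ≤h , q }) ne ne′ i ⟩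
    val (chain (suc a) 0 (plug z ((suc a , suc a) ∷ [])) ne′) i
      ≡⟨ val-closed (plug-open p (close done)) ne′ i ⟩
    shift (r + 1) δ₀ i
      ≡⟨ cong (λ r → shift r δ₀ i) (+-comm r 1) ⟩
    shift (suc r) δ₀ i
      ≡⟨ cong (λ f → f i) (shift-sh r δ₀) ⟨
    shift r (sh δ₀) i ∎
    where
    open ≡-Reasoning
    to : ∀ {s} B → a ≤ s → s ≤ suc a → Path (suc a) s (free (suc a) 1) B →
         Path (suc a) s ((suc a , suc a) ∷ []) B
    to (β ∷ []) _ _ (_ , ≤h , q) = ≤-reflexive (sym q) , ≤h , q
    ne′ : ∃ (Path (suc a) 0 (plug z ((suc a , suc a) ∷ [])))
    ne′ = B , path-after-open {c′ = (suc a , suc a) ∷ []} p to q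

  -- With one unit of rank left, the bound `K` is the top of the strip, so the element can only be a
  -- parallel letter.
  freeValue-par : ∀ {φ} → FreeValue j 1 φ → FreeValue (suc j) 1 φ
  freeValue-par {j = j} fv {z} {r} {a} p refl ne@(B , q) i =
    trans (val-open p to (λ { (β ∷ B) _ _ (_ , ≤h , q) → z≤n , ≤h , q }) ne ne′ i)
          (fv (par p) refl ne′ i)
    where
    to : ∀ {s} B → a ≤ s → s ≤ suc a → Path (suc a) s (free (suc a) (suc j)) B →
         Path (suc a) s ((a , suc a) ∷ free (suc a) j) B
    to (outside ∷ B) a≤s _ (_ , ≤h , q) = a≤s , ≤h , q
    to (inside ∷ B) a≤s _ (_ , ≤h , q) = m≤n⇒m≤1+n a≤s , ≤h , q
    ne′ : ∃ (Path (suc a) 0 (plug z ((a , suc a) ∷ free (suc a) j)))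
    ne′ = B , path-after-open p to q

  -- With as many elements left as units of rank, the count has to reach `suc a` at once for the
  -- remaining elements to suffice, so the element can only be a series letter.
  freeValue-ser : ∀ {φ} → FreeValue (suc k) (suc k) φ → FreeValue (suc (suc k)) (suc (suc k)) φ
  freeValue-ser {k = k} fv {z} {r} {a} p refl ne@(B , q) i =
    trans (val-open p to from ne ne′ i) (fv (ser p) (cong suc (sym (+-suc k a))) ne′ i)
    where
    to : ∀ {s} B → a ≤ s → s ≤ suc a → Path (suc (suc k) + a) s (free (suc (suc k) + a) (suc (suc k))) B →
         Path (suc (suc k) + a) s ((suc a , suc (suc a)) ∷ free (suc (suc k) + a) (suc k)) B
    to {s} (β ∷ B) _ s≤1+a (_ , _ , q) =
      +-cancelʳ-≤ (suc k) (suc a) (step β s) (begin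
        suc a + suc k          ≡⟨ cong suc (trans (+-suc a k) (cong suc (+-comm a k))) ⟩
        suc (suc k) + a        ≡⟨ path-total (free _ (suc k)) B q ⟨
        step β s + ∣ B ∣       ≤⟨ +-monoʳ-≤ (step β s) (∣p∣≤n B) ⟩
        step β s + suc k       ∎)
      , step≤ β , q
      where
      open ≤-Reasoning
      step≤ : ∀ β → step β s ≤ suc (suc a)
      step≤ outside = m≤n⇒m≤1+n s≤1+a
      step≤ inside  = s≤s s≤1+a
    from : ∀ {s} B → a ≤ s → s ≤ suc a →
         Path (suc (suc k) + a) s ((suc a , suc (suc a)) ∷ free (suc (suc k) + a) (suc k)) B →
         Path (suc (suc k) + a) s (free (suc (suc k) + a) (suc (suc k))) B
    from (β ∷ B) _ _ (_ , ≤h , q) = z≤n , ≤-trans ≤h (s≤s (s≤s (m≤n+m _ k))) , q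
    ne′ : ∃ (Path (suc (suc k) + a) 0 (plug z ((suc a , suc (suc a)) ∷ free (suc (suc k) + a) (suc k))))
    ne′ = B , path-after-open p to q

  -- A parallel letter keeps the remaining rank, while a series letter and a closing letter use up
  -- one unit. In the third case one more element is consumed: of the `suc j` elements behind the
  -- closed block, the first opens the next one. As `sh` is multiplication by `- t`, the recursion
  -- reads φ₁ + φ₂ + t φ₃.
  freeValue-split : ∀ {φ₁ φ₂ φ₃} → suc (suc k) ≤ suc j →
    FreeValue (suc j) (suc (suc k)) φ₁ → FreeValue (suc j) (suc k) φ₂ → FreeValue j (suc k) φ₃ →
    FreeValue (suc (suc j)) (suc (suc k)) (λ i → (φ₁ i ℤ.+ φ₂ i) ℤ.- sh φ₃ i)
  freeValue-split {k = k} {j} {φ₁} {φ₂} {φ₃} k<j fv₁ fv₂ fv₃ {z} {r} {a} p refl ne i = begin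
    val (chain T 0 (plug z ((0 , T) ∷ F)) ne) i
      ≡⟨ val-split z F 0 (suc a) T z≤n (s≤s (m≤n+m _ (suc k))) ne ne₁′ ne₂′ ne₃ i ⟩
    (val (chain T 0 (plug z ((0 , suc a) ∷ F)) ne₁′) i ℤ.+
     val (chain T 0 (plug z ((suc a , T) ∷ F)) ne₂′) i) ℤ.-
    val (chain T 0 (plug z ((suc a , suc a) ∷ F)) ne₃) i
      ≡⟨ cong₂ ℤ._-_ (cong₂ ℤ._+_
           (trans (val-open p to₁ from₁ ne₁′ ne₁ i) (fv₁ (par p) refl ne₁ i))
           (trans (val-open p to₂ from₂ ne₂′ ne₂ i) (fv₂ (ser p) T≡ ne₂ i)))
           (freeValue-closed fv₃ (s≤s z≤n) (close p) T≡ ne₃ i) ⟩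
    (shift r φ₁ i ℤ.+ shift r φ₂ i) ℤ.- shift (suc r) φ₃ i
      ≡⟨ shift-split r φ₁ φ₂ φ₃ i ⟨
    shift r (λ i → (φ₁ i ℤ.+ φ₂ i) ℤ.- sh φ₃ i) i ∎
    where
    open ≡-Reasoning
    T = suc (suc k) + a
    F = free T (suc j)

    T≡ : T ≡ suc k + suc a
    T≡ = cong suc (sym (+-suc k a))

    path₀ : ∃ (Path T a F)
    path₀ = free-path (suc j) (m≤n+m a _)
              (≤-trans (+-monoˡ-≤ a k<j) (≤-reflexive (+-comm (suc j) a)))

    path₁ : ∃ (Path T (suc a) F)
    path₁ = free-path (suc j) (s≤s (m≤n+m a _))
              (≤-trans (+-monoˡ-≤ a (m≤n⇒m≤1+n k<j)) (≤-reflexive (cong suc (+-comm (suc j) a))))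

    to₁ : ∀ {s} B → a ≤ s → s ≤ suc a → Path T s ((0 , suc a) ∷ F) B → Path T s ((a , suc a) ∷ F) B
    to₁ (outside ∷ B) a≤s _ (_ , ≤h , q) = a≤s , ≤h , q
    to₁ (inside ∷ B)  a≤s _ (_ , ≤h , q) = m≤n⇒m≤1+n a≤s , ≤h , q

    from₁ : ∀ {s} B → a ≤ s → s ≤ suc a → Path T s ((a , suc a) ∷ F) B → Path T s ((0 , suc a) ∷ F) B
    from₁ (β ∷ B) _ _ (_ , ≤h , q) = z≤n , ≤h , q

    to₂ : ∀ {s} B → a ≤ s → s ≤ suc a →
          Path T s ((suc a , T) ∷ F) B → Path T s ((suc a , suc (suc a)) ∷ F) B
    to₂ (outside ∷ B) _ s≤ (l≤ , _ , q) = l≤ , m≤n⇒m≤1+n s≤ , q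
    to₂ (inside ∷ B)  _ s≤ (l≤ , _ , q) = l≤ , s≤s s≤ , q

    from₂ : ∀ {s} B → a ≤ s → s ≤ suc a →
            Path T s ((suc a , suc (suc a)) ∷ F) B → Path T s ((suc a , T) ∷ F) B
    from₂ (β ∷ B) _ _ (l≤ , ≤h , q) = l≤ , ≤-trans ≤h (s≤s (s≤s (m≤n+m _ k))) , q

    ne₁ : ∃ (Path T 0 (plug z ((a , suc a) ∷ F)))
    ne₁ = path-open (par p) (inj₁ path₀)
    ne₁′ : ∃ (Path T 0 (plug z ((0 , suc a) ∷ F)))
    ne₁′ = proj₁ ne₁ , path-after-open p from₁ (proj₂ ne₁)
    ne₂ : ∃ (Path T 0 (plug z ((suc a , suc (suc a)) ∷ F)))
    ne₂ = path-open (ser p) (inj₁ path₁)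
    ne₂′ : ∃ (Path T 0 (plug z ((suc a , T) ∷ F)))
    ne₂′ = proj₁ ne₂ , path-after-open p from₂ (proj₂ ne₂)
    ne₃ : ∃ (Path T 0 (plug z ((suc a , suc a) ∷ F)))
    ne₃ = path-closed (close p) path₁

  freeValue : ∀ j k → 1 ≤ k → k ≤ j → ∃ (FreeValue j k)
  freeValue 1 1 _ _ = sh δ₀ , freeValue-1-1
  freeValue 1 (suc (suc k)) _ (s≤s ())
  freeValue (suc (suc j)) 1 1≤k _ =
    let φ , fv = freeValue (suc j) 1 1≤k (s≤s z≤n) in φ , freeValue-par fv
  freeValue 2 2 _ _ = let φ , fv = freeValue 1 1 ≤-refl ≤-refl in φ , freeValue-ser fv
  freeValue 2 (suc (suc (suc k))) _ (s≤s (s≤s ()))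
  freeValue (suc (suc (suc j))) (suc (suc k)) 1≤k k≤j = cases (m≤n⇒m<n∨m≡n k≤j)
    (λ k≤j → freeValue (suc (suc j)) (suc (suc k)) 1≤k k≤j)
    (freeValue (suc (suc j)) (suc k) (s≤s z≤n) (≤-pred k≤j))
    (λ k≤j → freeValue (suc j) (suc k) (s≤s z≤n) k≤j)
    where
    -- The recursive values are handed over as functions of the missing inequalities: the first and
    -- third exist only if the rank is below the number of elements, and equality forces a series
    -- letter.
    cases : suc (suc k) < suc (suc (suc j)) ⊎ suc (suc k) ≡ suc (suc (suc j)) →
            (suc (suc k) ≤ suc (suc j) → ∃ (FreeValue (suc (suc j)) (suc (suc k)))) →
            ∃ (FreeValue (suc (suc j)) (suc k)) →
            (suc k ≤ suc j → ∃ (FreeValue (suc j) (suc k))) →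
            ∃ (FreeValue (suc (suc (suc j))) (suc (suc k)))
    cases (inj₁ k<j) fv₁ (φ₂ , fv₂) fv₃
      with φ₁ , fv₁ ← fv₁ (≤-pred k<j) | φ₃ , fv₃ ← fv₃ (≤-pred (≤-pred k<j)) =
      _ , freeValue-split {φ₁ = φ₁} {φ₂} {φ₃} (≤-pred k<j) fv₁ fv₂ fv₃
    cases (inj₂ refl) _ (φ , fv) _ = φ , freeValue-ser fv

-- Hyperplanes of paving matroids

⊆-card⇒⊇ : ∀ {p q : Subset n} → p ⊆ q → ∣ q ∣ ≤ ∣ p ∣ → q ⊆ p
⊆-card⇒⊇ {p = p} p⊆q ∣q∣≤∣p∣ {x} x∈q = decidable-stable (x ∈? p) λ x∉p →
  <⇒≱ (p⊂q⇒∣p∣<∣q∣ (p⊆q , x , x∈q , x∉p)) ∣q∣≤∣p∣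

subset-of-size : ∀ {m} (S : Subset n) → m ≤ ∣ S ∣ → ∃ λ T → T ⊆ S × ∣ T ∣ ≡ m
subset-of-size [] z≤n = [] , (λ ()) , refl
subset-of-size (outside ∷ S) m≤ with T , T⊆S , eq ← subset-of-size S m≤ =
  outside ∷ T , out⊆ T⊆S , eq
subset-of-size {m = zero} (inside ∷ S) m≤ with T , T⊆S , eq ← subset-of-size S z≤n =
  outside ∷ T , out⊆ T⊆S , eq
subset-of-size {m = suc m} (inside ∷ S) (s≤s m≤) with T , T⊆S , eq ← subset-of-size S m≤ =
  inside ∷ T , in⊆in T⊆S , cong suc eq

card-two : ∀ {S : Subset n} {x y} → x ∈ S → y ∈ S → x ≢ y → 2 ≤ ∣ S ∣
card-two {S = S} {x} {y} x∈ y∈ x≢y = subst (2 ≤_) (∣p-x∣ x∈)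
  (s≤s (subst (1 ≤_) (∣p-x∣ (x∈p∧x≢y⇒x∈p-y y∈ (x≢y ∘ sym))) (s≤s z≤n)))

module _ (M : Matroid n) where

  rk-≥ : ∀ {I S} → Independent M I → I ⊆ S → ∣ I ∣ ≤ rk M S
  rk-≥ {I} {S} ind I⊆S =
    ≤-max (∈-filter⁺ (λ I → independent? M I ×-dec (I ⊆? S)) (∈-allSubsets I) (ind , I⊆S))
    where
    ≤-max : ∀ {Ss} → I ∈ˡ Ss → ∣ I ∣ ≤ List.foldr _⊔_ 0 (List.map ∣_∣ Ss)
    ≤-max (here refl) = m≤m⊔n ∣ I ∣ _
    ≤-max {S ∷ Ss} (there I∈) = ≤-trans (≤-max I∈) (m≤n⊔m ∣ S ∣ _)

  rk-attained : ∀ S → ∃ λ I → Independent M I × I ⊆ S × ∣ I ∣ ≡ rk M S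
  rk-attained S with attained (List.filter Q? (allSubsets n))
    where
    Q? = λ I → independent? M I ×-dec (I ⊆? S)
    attained : ∀ Ss → List.foldr _⊔_ 0 (List.map ∣_∣ Ss) ≡ 0 ⊎
                      ∃ λ I → I ∈ˡ Ss × ∣ I ∣ ≡ List.foldr _⊔_ 0 (List.map ∣_∣ Ss)
    attained [] = inj₁ refl
    attained (T ∷ Ss) with ⊔-sel ∣ T ∣ (List.foldr _⊔_ 0 (List.map ∣_∣ Ss)) | attained Ss
    ... | inj₁ eq | _                    = inj₂ (T , here refl , sym eq)
    ... | inj₂ eq | inj₁ zero′           = inj₁ (trans eq zero′)
    ... | inj₂ eq | inj₂ (I , I∈ , eq′)  = inj₂ (I , there I∈ , trans eq′ (sym eq))
  ... | inj₂ (I , I∈ , eq)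
      with ind , I⊆S ← proj₂ (∈-filter⁻ (λ I → independent? M I ×-dec (I ⊆? S)) {xs = allSubsets n} I∈) =
    I , ind , I⊆S , eq
  ... | inj₁ eq = ⊥ , (_ , proj₂ (nonempty M) , ⊥⊆) , ⊥⊆ , trans (∣⊥∣≡0 n) (sym eq)

  basis-card : ∀ {B} → Basis M B → ∣ B ∣ ≡ rank M
  basis-card {B} bB with I , (A , bA , I⊆A) , _ , eq ← rk-attained ⊤ = ≤-antisym
    (rk-≥ (B , bB , λ x → x) ⊆⊤)
    (≤-trans (≤-reflexive (sym eq)) (≤-trans (p⊆q⇒∣p∣≤∣q∣ I⊆A) (basis-card-≤ M bA bB)))

  independent-card⇒basis : ∀ {I} → Independent M I → ∣ I ∣ ≡ rank M → Basis M I
  independent-card⇒basis (B , bB , I⊆B) eq = subst (Basis M)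
    (sym (⊆-antisym I⊆B (⊆-card⇒⊇ I⊆B (≤-reflexive (trans (basis-card bB) (sym eq)))))) bB

  -- Extend `I` to a basis `B` and take `z` in `B` outside `I`. Either `z` lies in `A`, or
  -- exchanging `z` for an element of `A` leaves `I` intact.
  augment : ∀ {I A} → Independent M I → Basis M A → ∣ I ∣ < rank M →
            ∃ λ y → y ∈ A × y ∉ I × Independent M (I ∪ ⁅ y ⁆)
  augment {I} {A} (B , bB , I⊆B) bA I<rank
    with Fin.any? (λ x → (x ∈? B) ×-dec ¬? (x ∈? I))
  ... | no none = ⊥-elim (<-irrefl refl (≤-trans I<rank (≤-trans (≤-reflexive (sym (basis-card bB)))
          (p⊆q⇒∣p∣≤∣q∣ λ {x} x∈B → decidable-stable (x ∈? I) (λ x∉I → none (x , x∈B , x∉I))))))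
  ... | yes (z , z∈B , z∉I) with z ∈? A
  ...   | yes z∈A = z , z∈A , z∉I , B , bB , λ x∈ →
          [ I⊆B , (λ x∈z → subst (_∈ B) (sym (x∈⁅y⁆⇒x≡y z x∈z)) z∈B) ]′ (x∈p∪q⁻ I ⁅ z ⁆ x∈)
  ...   | no z∉A with y , y∈A , y∉B , bB′ ← exchange M bB bA z∈B z∉A =
          y , y∈A , (λ y∈I → y∉B (I⊆B y∈I)) , _ , bB′ , λ x∈ → x∈p∪q⁺
            ([ (λ x∈I → inj₁ (x∈p∧x≢y⇒x∈p-y (I⊆B x∈I) λ { refl → z∉I x∈I })) , inj₂ ]′
              (x∈p∪q⁻ I ⁅ y ⁆ x∈))

  hyperplane-⊉-basis : ∀ {H B} → Hyperplane M H → Basis M B → ¬ B ⊆ H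
  hyperplane-⊉-basis (_ , eq) bB B⊆H = 1+n≰n (≤-trans (≤-reflexive (trans eq (sym (basis-card bB))))
    (rk-≥ (_ , bB , λ x → x) B⊆H))

  module _ (paving : Paving M) where

    independent-small : ∀ {I} → ∣ I ∣ < rank M → Independent M I
    independent-small {I} I< =
      decidable-stable (independent? M I) (λ dep → <⇒≱ I< (paving I dep))

    -- For `x` in `H` outside the flat `H′`, the set `H′ ∪ ⁅ x ⁆` contains a basis, which extends
    -- the independent set `I` to a basis by some `y`. If `y` lies in `H′`, then so does this basis;
    -- if `y` is `x`, it lies in `H`. Neither is possible.
    hyperplane-⊆ : ∀ {H H′ I} → Hyperplane M H → Hyperplane M H′ →
                   I ⊆ H → I ⊆ H′ → suc ∣ I ∣ ≡ rank M → H ⊆ H′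
    hyperplane-⊆ {H} {H′} {I} (_ , eq) (flat′ , eq′) I⊆H I⊆H′ ∣I∣ {x} x∈H =
      decidable-stable (x ∈? H′) λ x∉H′ →
        let J , indJ , J⊆ , ∣J∣ = rk-attained (H′ ∪ ⁅ x ⁆)
            A , bA , J⊆A = indJ
            A⊆J : A ⊆ J
            A⊆J = ⊆-card⇒⊇ J⊆A (≤-trans (≤-reflexive (trans (basis-card bA) (sym eq′)))
                    (≤-trans (flat′ x x∉H′) (≤-reflexive (sym ∣J∣))))
            y , y∈A , y∉I , indIy = augment (independent-small (≤-reflexive ∣I∣)) bA (≤-reflexive ∣I∣)
            basisIy = independent-card⇒basis indIy (trans (∣p∪y∣ y∉I) ∣I∣)
        in case x∈p∪q⁻ H′ ⁅ x ⁆ (J⊆ (A⊆J y∈A)) of λ where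
             (inj₁ y∈H′) → hyperplane-⊉-basis (flat′ , eq′) basisIy (λ z∈ →
               [ I⊆H′ , (λ z∈y → subst (_∈ H′) (sym (x∈⁅y⁆⇒x≡y y z∈y)) y∈H′) ]′ (x∈p∪q⁻ I ⁅ y ⁆ z∈))
             (inj₂ y∈x) → let y≡x = x∈⁅y⁆⇒x≡y x y∈x in
               1+n≰n (≤-trans (≤-reflexive (trans eq (trans (sym ∣I∣) (sym (∣p∪y∣ y∉I)))))
                 (rk-≥ indIy (λ z∈ →
                   [ I⊆H , (λ z∈y → subst (_∈ H) (sym (trans (x∈⁅y⁆⇒x≡y y z∈y) y≡x)) x∈H) ]′
                     (x∈p∪q⁻ I ⁅ y ⁆ z∈))))

    hyperplane-unique : ∀ {H H′ I} → Hyperplane M H → Hyperplane M H′ →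
                        I ⊆ H → I ⊆ H′ → rank M ≤ suc ∣ I ∣ → H ≡ H′
    hyperplane-unique {I = I} hyp hyp′@(_ , eq′) I⊆H I⊆H′ le
      with T , T⊆I , ∣T∣ ← subset-of-size I (≤-pred (≤-trans (≤-reflexive eq′) le)) =
      ⊆-antisym (hyperplane-⊆ hyp hyp′ (I⊆H ∘ T⊆I) (I⊆H′ ∘ T⊆I) (trans (cong suc ∣T∣) eq′))
                (hyperplane-⊆ hyp′ hyp (I⊆H′ ∘ T⊆I) (I⊆H ∘ T⊆I) (trans (cong suc ∣T∣) eq′))

    -- By paving, `B` without one element is independent, and `H` is its closure. The closure
    -- contains `B`, because returning the removed element gives back the dependent set `B`.
    nonbasis⇒hyperplane : ∀ {B} → rank M ≡ suc r → ∣ B ∣ ≡ rank M → ¬ Basis M B →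
                          ∃ λ H → Hyperplane M H × B ⊆ H
    nonbasis⇒hyperplane {r = r} {B} rank≡ ∣B∣ ¬bB = H , (flat , trans (cong suc rkH) (sym rank≡)) , B⊆H
      where
      nonemptyB : Nonempty B
      nonemptyB with nonempty? B
      ... | yes ne = ne
      ... | no empty with () ← trans (trans (sym (trans (cong ∣_∣ (Empty-unique empty)) (∣⊥∣≡0 n))) ∣B∣) rank≡

      x₀ = proj₁ nonemptyB
      x₀∈B = proj₂ nonemptyB
      I = B - x₀

      ∣I∣ : ∣ I ∣ ≡ r
      ∣I∣ = suc-injective (trans (∣p-x∣ x₀∈B) (trans ∣B∣ rank≡))

      I<rank : ∣ I ∣ < rank M
      I<rank = ≤-reflexive (trans (cong suc ∣I∣) (sym rank≡))

      indI : Independent M I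
      indI = independent-small I<rank

      closure? : ∀ y → Dec (y ∈ I ⊎ Dependent M (I ∪ ⁅ y ⁆))
      closure? y = (y ∈? I) ⊎-dec ¬? (independent? M (I ∪ ⁅ y ⁆))

      H : Subset n
      H = comprehension closure?

      ∈H⁺ : ∀ {y} → y ∈ I ⊎ Dependent M (I ∪ ⁅ y ⁆) → y ∈ H
      ∈H⁺ = ∈-comprehension⁺ closure?

      ∈H⁻ : ∀ {y} → y ∈ H → y ∈ I ⊎ Dependent M (I ∪ ⁅ y ⁆)
      ∈H⁻ = ∈-comprehension⁻ closure?

      rkH : rk M H ≡ r
      rkH = ≤-antisym
        (≮⇒≥ λ r<rk →
          let J , (A , bA , J⊆A) , J⊆H , ∣J∣ = rk-attained H
              A⊆J : A ⊆ J
              A⊆J = ⊆-card⇒⊇ J⊆A (≤-trans (≤-reflexive (trans (basis-card bA) rank≡))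
                      (≤-trans r<rk (≤-reflexive (sym ∣J∣))))
              y , y∈A , y∉I , indIy = augment indI bA I<rank
          in [ y∉I , (λ dep → dep indIy) ]′ (∈H⁻ (J⊆H (A⊆J y∈A))))
        (subst (_≤ rk M H) ∣I∣ (rk-≥ indI (∈H⁺ ∘ inj₁)))

      flat : Flat M H
      flat x x∉H = ≤-trans
        (≤-reflexive (cong suc (trans rkH (sym ∣I∣))))
        (≤-trans (≤-reflexive (sym (∣p∪y∣ (λ x∈I → x∉H (∈H⁺ (inj₁ x∈I))))))
          (rk-≥ (decidable-stable (independent? M (I ∪ ⁅ x ⁆)) (λ dep → x∉H (∈H⁺ (inj₂ dep))))
            λ z∈ → x∈p∪q⁺ ([ inj₁ ∘ ∈H⁺ ∘ inj₁ , inj₂ ]′ (x∈p∪q⁻ I ⁅ x ⁆ z∈))))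

      B⊆H : B ⊆ H
      B⊆H {y} y∈B = ∈H⁺ (case y ∈? I of λ where
        (yes y∈I) → inj₁ y∈I
        (no y∉I) → inj₂ λ indIy → ¬bB (subst (Basis M)
          (⊆-antisym (I∪y⊆B y y∈B) (⊆-card⇒⊇ (I∪y⊆B y y∈B)
            (≤-reflexive (trans ∣B∣ (trans rank≡ (trans (cong suc (sym ∣I∣)) (sym (∣p∪y∣ y∉I))))))))
          (independent-card⇒basis indIy (trans (∣p∪y∣ y∉I) (trans (cong suc ∣I∣) (sym rank≡))))))
        where
        I∪y⊆B : ∀ y → y ∈ B → I ∪ ⁅ y ⁆ ⊆ B
        I∪y⊆B y y∈B z∈ = [ p─q⊆p B ⁅ x₀ ⁆ , (λ z∈y → subst (_∈ B) (sym (x∈⁅y⁆⇒x≡y y z∈y)) y∈B) ]′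
                            (x∈p∪q⁻ I ⁅ y ⁆ z∈)

    module _ (connected : Connected M) where

      private
        outside-hyperplane : ∀ {H B} → Hyperplane M H → Basis M B → ∃ λ z → z ∈ B × z ∉ H
        outside-hyperplane {H} {B} hyp bB with Fin.any? (λ z → (z ∈? B) ×-dec ¬? (z ∈? H))
        ... | yes z = z
        ... | no none = ⊥-elim (hyperplane-⊉-basis hyp bB λ {z} z∈B →
                decidable-stable (z ∈? H) (λ z∉H → none (z , z∈B , z∉H)))

        circuit-through : ∀ {x y} → x ≢ y → ∃ λ C → Circuit M C × x ∈ C × y ∈ C
        circuit-through {x} {y} x≢y with connected x y
        ... | inj₁ eq = ⊥-elim (x≢y eq)
        ... | inj₂ circ = circ

      -- Otherwise the element outside H would be a coloop.
      hyperplane-codim : ∀ {H} → Hyperplane M H → Nonempty H → 2 ≤ ∣ ∁ H ∣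
      hyperplane-codim {H} hyp (j , j∈H) with _ , bB ← nonempty M
        with z , _ , z∉H ← outside-hyperplane hyp bB
        with Fin.any? (λ y → ¬? (y ∈? H) ×-dec ¬? (y Fin.≟ z))
      ... | yes (y , y∉H , y≢z) = card-two (x∉p⇒x∈∁p y∉H) (x∉p⇒x∈∁p z∉H) y≢z
      -- A basis containing `C - z` leaves `H`, hence contains `z`, the only element outside; then
      -- it contains the whole circuit.
      ... | no none with C , (dep , min) , j∈C , z∈C ← circuit-through {j} {z} (λ { refl → z∉H j∈H })
        with A , bA , sub ← min (C - z) (x∈p⇒p-x⊂p z∈C)
        with y , y∈A , y∉H ← outside-hyperplane hyp bA =
        ⊥-elim (dep (A , bA , λ {x} x∈C → case x Fin.≟ z of λ where
          (yes refl) → subst (_∈ A) (decidable-stable (y Fin.≟ z) (λ y≢z → none (y , y∉H , y≢z))) y∈A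
          (no x≢z) → sub (x∈p∧x≢y⇒x∈p-y x∈C x≢z)))

      -- Otherwise the elements of H would be loops.
      hyperplane-rank : ∀ {H} → Hyperplane M H → Nonempty H → 2 ≤ rank M
      hyperplane-rank {H} hyp@(_ , eq) (j , j∈H) with _ , bB ← nonempty M
        with z , _ , z∉H ← outside-hyperplane hyp bB
        with C , (dep , min) , j∈C , z∈C ← circuit-through {j} {z} (λ { refl → z∉H j∈H }) =
        subst (2 ≤_) eq (s≤s (subst (_≤ rk M H) (∣⁅x⁆∣≡1 j) (rk-≥
          (min ⁅ j ⁆ (⁅j⁆⊆ j∈C , z , z∈C , λ z∈j → z∉H (subst (_∈ H) (sym (x∈⁅y⁆⇒x≡y j z∈j)) j∈H)))
          (⁅j⁆⊆ j∈H))))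
        where
        ⁅j⁆⊆ : ∀ {S} → j ∈ S → ⁅ j ⁆ ⊆ S
        ⁅j⁆⊆ j∈S x∈ = subst (_∈ _) (sym (x∈⁅y⁆⇒x≡y j x∈)) j∈S

-- The base polytope of a paving matroid

sumOver : Subset n → (Fin n → ℕ) → ℕ
sumOver []            v = 0
sumOver (outside ∷ S) v = sumOver S (v ∘ suc)
sumOver (inside ∷ S)  v = v zero + sumOver S (v ∘ suc)

sumOver-cong : ∀ (S : Subset n) {v w : Fin n → ℕ} → (∀ i → v i ≡ w i) → sumOver S v ≡ sumOver S w
sumOver-cong []            eq = refl
sumOver-cong (outside ∷ S) eq = sumOver-cong S (eq ∘ suc)
sumOver-cong (inside ∷ S)  eq = cong₂ _+_ (eq zero) (sumOver-cong S (eq ∘ suc))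

sumOver-bit : ∀ (S B : Subset n) → sumOver S (bit B) ≡ ∣ B ∩ S ∣
sumOver-bit []            []            = refl
sumOver-bit (outside ∷ S) (outside ∷ B) = sumOver-bit S B
sumOver-bit (outside ∷ S) (inside ∷ B)  = sumOver-bit S B
sumOver-bit (inside ∷ S)  (outside ∷ B) = sumOver-bit S B
sumOver-bit (inside ∷ S)  (inside ∷ B)  = cong suc (sumOver-bit S B)

sumOver-count : ∀ (S : Subset n) L → sumOver S (λ i → count i L) ≡ total (λ B → ∣ B ∩ S ∣) L
sumOver-count S [] = sumOver-zero S
  where
  sumOver-zero : ∀ {n} (S : Subset n) → sumOver S (λ _ → 0) ≡ 0
  sumOver-zero []            = refl
  sumOver-zero (outside ∷ S) = sumOver-zero S
  sumOver-zero (inside ∷ S)  = sumOver-zero S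
sumOver-count S (B ∷ L) = trans (sumOver-+ S (bit B) (λ i → count i L))
                                (cong₂ _+_ (sumOver-bit S B) (sumOver-count S L))
  where
  sumOver-+ : ∀ {n} (S : Subset n) v w → sumOver S (λ i → v i + w i) ≡ sumOver S v + sumOver S w
  sumOver-+ []            v w = refl
  sumOver-+ (outside ∷ S) v w = sumOver-+ S (v ∘ suc) (w ∘ suc)
  sumOver-+ (inside ∷ S)  v w rewrite sumOver-+ S (v ∘ suc) (w ∘ suc) =
    interchange (v zero) (w zero) (sumOver S (v ∘ suc)) (sumOver S (w ∘ suc))
    where
    interchange : ∀ a b c d → a + b + (c + d) ≡ a + c + (b + d)
    interchange = solve-∀

∉⇒lookup : ∀ {p : Subset n} {x} → x ∉ p → lookup p x ≡ outside
∉⇒lookup {p = p} {x} x∉p with lookup p x in eq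
... | outside = refl
... | inside  = ⊥-elim (x∉p (lookup⇒[]= x p eq))

-- A simultaneous exchange between two members of a list does not move the point to which the list
-- averages.
swap-bits : ∀ {B C : Subset n} {e f} → e ∈ B → e ∉ C → f ∈ C → f ∉ B → ∀ i →
            bit ((B - e) ∪ ⁅ f ⁆) i + bit ((C - f) ∪ ⁅ e ⁆) i ≡ bit B i + bit C i
swap-bits {B = B} {C} {e} {f} e∈B e∉C f∈C f∉B i
  rewrite swap≡≔ B e f | swap≡≔ C f e with i Fin.≟ e | i Fin.≟ f
... | yes refl | yes refl = ⊥-elim (e∉C f∈C)
... | yes refl | no e≢f
  rewrite lookup∘update′ e≢f (B [ e ]≔ outside) inside | lookup∘update e B outside
        | lookup∘update e (C [ f ]≔ outside) inside
        | []=⇒lookup e∈B | ∉⇒lookup e∉C = refl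
... | no f≢e | yes refl
  rewrite lookup∘update f (B [ e ]≔ outside) inside
        | lookup∘update′ f≢e (C [ f ]≔ outside) inside | lookup∘update f C outside
        | []=⇒lookup f∈C | ∉⇒lookup f∉B = refl
... | no i≢e | no i≢f
  rewrite lookup∘update′ i≢f (B [ e ]≔ outside) inside | lookup∘update′ i≢e B outside
        | lookup∘update′ i≢e (C [ f ]≔ outside) inside | lookup∘update′ i≢f C outside = refl

swap-card : ∀ {B : Subset n} {e f} → e ∈ B → f ∉ B → ∣ (B - e) ∪ ⁅ f ⁆ ∣ ≡ ∣ B ∣
swap-card {B = B} {e} e∈B f∉B =
  trans (∣p∪y∣ (λ f∈ → f∉B (p─q⊆p B ⁅ e ⁆ f∈))) (∣p-x∣ e∈B)

two-elements : ∀ {S : Subset n} → 2 ≤ ∣ S ∣ → ∃₂ λ x y → x ∈ S × y ∈ S × x ≢ y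
two-elements {n = n} {S} 2≤ with nonempty? S
... | no empty with () ← subst (2 ≤_) (trans (cong ∣_∣ (Empty-unique empty)) (∣⊥∣≡0 n)) 2≤
... | yes (x , x∈) with nonempty? (S - x)
...   | yes (y , y∈) = let y∈S , y∉x = x∈p─q⁻ {p = S} y∈ in
        x , y , x∈ , y∈S , λ { refl → y∉x (x∈⁅x⁆ x) }
...   | no empty = ⊥-elim (n≮n 1 (subst (2 ≤_) (trans (sym (∣p-x∣ x∈))
          (cong suc (trans (cong ∣_∣ (Empty-unique empty)) (∣⊥∣≡0 n)))) 2≤))

total-large : ∀ {A : Set} (f : A → ℕ) L → suc (List.length L) ≤ total f L → ∃ λ x → x ∈ˡ L × 2 ≤ f x
total-large f (x ∷ L) lt with 2 ≤? f x
... | yes 2≤ = x , here refl , 2≤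
... | no ≮2 with y , y∈ , 2≤ ← total-large f L (+-cancelˡ-≤ 1 _ _
        (≤-trans lt (+-monoˡ-≤ (total f L) (≤-pred (≰⇒> ≮2))))) = y , there y∈ , 2≤

module PavingPolytope (M : Matroid n) (paving : Paving M) (rank≡ : rank M ≡ suc r) where

  module _ {B H : Subset n} {e f : Fin n} (hyp : Hyperplane M H) (B⊆H : B ⊆ H) (∣B∣ : ∣ B ∣ ≡ rank M)
           (e∈B : e ∈ B) (f∉H : f ∉ H) where

    -- Otherwise the new set lies in a hyperplane that shares the `rank M - 1` elements of `B - e`
    -- with `H`, hence in `H`, which misses `f`.
    swap-into : Basis M ((B - e) ∪ ⁅ f ⁆)
    swap-into = decidable-stable (basis? M _) λ ¬basis →
      let H′ , hyp′ , B′⊆H′ = nonbasis⇒hyperplane M paving rank≡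
            (trans (swap-card e∈B (λ f∈B → f∉H (B⊆H f∈B))) ∣B∣) ¬basis
          H≡H′ = hyperplane-unique M paving hyp hyp′ (λ x∈ → B⊆H (p─q⊆p B ⁅ e ⁆ x∈))
                   (λ x∈ → B′⊆H′ (x∈p∪q⁺ (inj₁ x∈)))
                   (≤-reflexive (trans (sym ∣B∣) (sym (∣p-x∣ e∈B))))
      in f∉H (subst (f ∈_) (sym H≡H′) (B′⊆H′ (x∈p∪q⁺ (inj₂ (x∈⁅x⁆ f)))))

  -- If both exchanges failed, the hyperplanes through the two results would share the `rank M - 1`
  -- elements of `(C - f - f′) ∪ ⁅ e ⁆`. They would coincide and contain the basis `C`.
  swap-out-of : ∀ {C e f f′} → Basis M C → e ∉ C → f ∈ C → f′ ∈ C → f ≢ f′ →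
                ¬ Basis M ((C - f) ∪ ⁅ e ⁆) → Basis M ((C - f′) ∪ ⁅ e ⁆)
  swap-out-of {C} {e} {f} {f′} bC e∉C f∈C f′∈C f≢f′ ¬basis =
    decidable-stable (basis? M _) λ ¬basis′ →
      let H , hyp , ⊆H = nonbasis⇒hyperplane M paving rank≡ (card f∈C) ¬basis
          H′ , hyp′ , ⊆H′ = nonbasis⇒hyperplane M paving rank≡ (card f′∈C) ¬basis′
          H≡H′ = hyperplane-unique M paving hyp hyp′
            (λ x∈ → ⊆H (x∈p∪q⁺ ([ (λ x∈ → inj₁ (p─q⊆p (C - f) ⁅ f′ ⁆ x∈)) , inj₂ ]′ (x∈p∪q⁻ _ ⁅ e ⁆ x∈))))
            (λ x∈ → ⊆H′ (x∈p∪q⁺ ([ (λ x∈ → let x∈′ , x∉f′ = x∈p─q⁻ {p = C - f} x∈ in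
                       inj₁ (x∈p∧x∉q⇒x∈p─q (p─q⊆p C ⁅ f ⁆ x∈′) x∉f′)) , inj₂ ]′ (x∈p∪q⁻ _ ⁅ e ⁆ x∈))))
            (≤-reflexive (sym cardI))
      in hyperplane-⊉-basis M hyp bC λ {x} x∈C → case x Fin.≟ f of λ where
           (no x≢f) → ⊆H (x∈p∪q⁺ (inj₁ (x∈p∧x≢y⇒x∈p-y x∈C x≢f)))
           (yes refl) → subst (f ∈_) (sym H≡H′)
             (⊆H′ (x∈p∪q⁺ (inj₁ (x∈p∧x≢y⇒x∈p-y f∈C f≢f′))))
    where
    card : ∀ {f} → f ∈ C → ∣ (C - f) ∪ ⁅ e ⁆ ∣ ≡ rank M
    card f∈C = trans (swap-card f∈C e∉C) (basis-card M bC)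
    f′∈C-f : f′ ∈ C - f
    f′∈C-f = x∈p∧x≢y⇒x∈p-y f′∈C (f≢f′ ∘ sym)
    cardI : suc ∣ (C - f - f′) ∪ ⁅ e ⁆ ∣ ≡ rank M
    cardI = trans (cong suc (trans (∣p∪y∣ (λ e∈ → e∉C (p─q⊆p C ⁅ f ⁆ (p─q⊆p (C - f) ⁅ f′ ⁆ e∈))))
                                   (∣p-x∣ f′∈C-f)))
              (trans (∣p-x∣ f∈C) (basis-card M bC))

  -- The inequality x(H) ≤ k - 1 on the complement, where it reads x(∁ H) ≥ 1 and no subtraction
  -- occurs. For smaller hyperplanes it follows from the entries being at most one.
  Spread : (Fin n → ℕ) → ℕ → Set
  Spread v N = ∀ H → Hyperplane M H → rank M ≤ ∣ H ∣ → N ≤ sumOver (∁ H) v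

  -- `B` contributes nothing outside `H`. The other entries, one fewer than the required sum, cannot
  -- all contribute at most one.
  spread⇒far : ∀ {v B H} bs gs → Hyperplane M H → B ⊆ H → ∣ B ∣ ≡ rank M →
    (∀ i → bit B i + count i bs + count i gs ≡ v i) →
    Spread v (suc (List.length bs + List.length gs)) →
    ∃ λ C → C ∈ˡ bs List.++ gs × 2 ≤ ∣ C ∩ ∁ H ∣
  spread⇒far {v} {B} {H} bs gs hyp B⊆H ∣B∣ eq spread =
    total-large (λ C → ∣ C ∩ ∁ H ∣) (bs List.++ gs) (begin
      suc (List.length (bs List.++ gs))
        ≡⟨ cong suc (length-++ bs) ⟩
      suc (List.length bs + List.length gs)
        ≤⟨ spread H hyp (≤-trans (≤-reflexive (sym ∣B∣)) (p⊆q⇒∣p∣≤∣q∣ B⊆H)) ⟩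
      sumOver (∁ H) v
        ≡⟨ sumOver-cong (∁ H) (λ i → trans (sym (eq i)) (trans (+-assoc (bit B i) _ _)
             (cong (bit B i +_) (sym (total-++ (λ B → bit B i) bs gs))))) ⟩
      sumOver (∁ H) (λ i → count i (B ∷ bs List.++ gs))
        ≡⟨ sumOver-count (∁ H) (B ∷ bs List.++ gs) ⟩
      ∣ B ∩ ∁ H ∣ + total (λ C → ∣ C ∩ ∁ H ∣) (bs List.++ gs)
        ≡⟨ cong (_+ total (λ C → ∣ C ∩ ∁ H ∣) (bs List.++ gs)) (trans (cong ∣_∣ (Empty-unique
             λ (x , x∈) → let x∈B , x∈∁H = x∈p∩q⁻ B (∁ H) x∈ in x∈∁p⇒x∉p x∈∁H (B⊆H x∈B))) (∣⊥∣≡0 n)) ⟩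
      total (λ C → ∣ C ∩ ∁ H ∣) (bs List.++ gs) ∎)
    where open ≤-Reasoning

  -- A nonbasis B lies in a hyperplane H, so some C of the list has at least two
  -- elements outside H; swapping one of them for an element of B makes B a
  -- basis, and one of the two choices does not destroy C.
  spread⇒bases : ∀ {v} m bs gs → List.length bs ≤ m →
    All (λ B → ∣ B ∣ ≡ rank M) bs → All (λ B → ¬ Basis M B) bs → All (Basis M) gs →
    (∀ i → count i bs + count i gs ≡ v i) →
    Spread v (List.length bs + List.length gs) →
    ∃ λ L → List.length L ≡ List.length bs + List.length gs × All (Basis M) L × ∀ i → count i L ≡ v i
  spread⇒bases m [] gs len cards bad good eq spread = gs , refl , good , eq
  spread⇒bases {v} (suc m) (B ∷ bs) gs (s≤s len) (∣B∣ ∷ cards) (¬bB ∷ bad) good eq spread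
    with H , hyp , B⊆H ← nonbasis⇒hyperplane M paving rank≡ ∣B∣ ¬bB
    with C , C∈ , 2≤ ← spread⇒far bs gs hyp B⊆H ∣B∣ eq spread
    with f , f′ , f∈ , f′∈ , f≢f′ ← two-elements 2≤ = swap (∈-++⁻ bs C∈)
    where
    open ≤-Reasoning

    f∈C = proj₁ (x∈p∩q⁻ C (∁ H) f∈)
    f∉H = x∈∁p⇒x∉p (proj₂ (x∈p∩q⁻ C (∁ H) f∈))
    f′∈C = proj₁ (x∈p∩q⁻ C (∁ H) f′∈)
    f′∉H = x∈∁p⇒x∉p (proj₂ (x∈p∩q⁻ C (∁ H) f′∈))

    ∣C∣ : ∣ C ∣ ≡ rank M
    ∣C∣ = [ All.lookup cards , (λ C∈gs → basis-card M (All.lookup good C∈gs)) ]′ (∈-++⁻ bs C∈)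

    exchanged : ∃ λ e → e ∈ B × e ∉ C
    exchanged with Fin.any? (λ e → (e ∈? B) ×-dec ¬? (e ∈? C))
    ... | yes e = e
    ... | no none = ⊥-elim (f∉H (B⊆H (⊆-card⇒⊇ {p = B} {C}
            (λ {e} e∈B → decidable-stable (e ∈? C) (λ e∉C → none (e , e∈B , e∉C)))
            (≤-reflexive (trans ∣C∣ (sym ∣B∣))) f∈C)))

    e = proj₁ exchanged
    e∈B = proj₁ (proj₂ exchanged)
    e∉C = proj₂ (proj₂ exchanged)

    Result : Set
    Result = ∃ λ L → List.length L ≡ suc (List.length bs + List.length gs) ×
                     All (Basis M) L × ∀ i → count i L ≡ v i

    -- bs₁ and gs₁ are bs and gs without C.
    module _ {bs₁ gs₁ f} (f∈C : f ∈ C) (f∉H : f ∉ H)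
      (cards₁ : All (λ B → ∣ B ∣ ≡ rank M) bs₁) (bad₁ : All (λ B → ¬ Basis M B) bs₁)
      (good₁ : All (Basis M) gs₁)
      (counts : ∀ i → bit C i + (count i bs₁ + count i gs₁) ≡ count i bs + count i gs)
      (lens : suc (List.length bs₁ + List.length gs₁) ≡ List.length bs + List.length gs) where

      B′ C′ : Subset n
      B′ = (B - e) ∪ ⁅ f ⁆
      C′ = (C - f) ∪ ⁅ e ⁆

      counts′ : ∀ i → bit B′ i + bit C′ i + (count i bs₁ + count i gs₁) ≡ v i
      counts′ i = begin-equality
        bit B′ i + bit C′ i + (count i bs₁ + count i gs₁)
          ≡⟨ cong (_+ (count i bs₁ + count i gs₁))
               (swap-bits e∈B e∉C f∈C (λ f∈B → f∉H (B⊆H f∈B)) i) ⟩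
        bit B i + bit C i + (count i bs₁ + count i gs₁)
          ≡⟨ +-assoc (bit B i) _ _ ⟩
        bit B i + (bit C i + (count i bs₁ + count i gs₁))
          ≡⟨ cong (bit B i +_) (counts i) ⟩
        bit B i + (count i bs + count i gs)
          ≡⟨ +-assoc (bit B i) _ _ ⟨
        bit B i + count i bs + count i gs
          ≡⟨ eq i ⟩
        v i ∎

      put-good : Basis M C′ → List.length bs₁ ≤ m → Result
      put-good bC′ len₁ =
        let L , lenL , basesL , eqL = spread⇒bases {v} m bs₁ (B′ ∷ C′ ∷ gs₁) len₁ cards₁ bad₁
              (swap-into hyp B⊆H ∣B∣ e∈B f∉H ∷ bC′ ∷ good₁)
              (λ i → trans (rearrange (count i bs₁) (bit B′ i) (bit C′ i) (count i gs₁)) (counts′ i))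
              (subst (Spread v) (sym lens′) spread)
        in L , trans lenL lens′ , basesL , eqL
        where
        rearrange : ∀ a b c d → a + (b + (c + d)) ≡ b + c + (a + d)
        rearrange = solve-∀
        lens′ : List.length bs₁ + suc (suc (List.length gs₁)) ≡ suc (List.length bs + List.length gs)
        lens′ = trans (trans (+-suc _ _) (cong suc (+-suc _ _))) (cong suc lens)

      -- Here `C` was itself a nonbasis. `C′` takes its place and `B′` is good, so the number of
      -- nonbases, which `m` bounds, still drops.
      put-bad : ¬ Basis M C′ → suc (List.length bs₁) ≤ m → Result
      put-bad ¬bC′ len₁ =
        let L , lenL , basesL , eqL = spread⇒bases {v} m (C′ ∷ bs₁) (B′ ∷ gs₁) len₁
              (trans (swap-card f∈C e∉C) ∣C∣ ∷ cards₁) (¬bC′ ∷ bad₁)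
              (swap-into hyp B⊆H ∣B∣ e∈B f∉H ∷ good₁)
              (λ i → trans (rearrange (bit C′ i) (count i bs₁) (bit B′ i) (count i gs₁)) (counts′ i))
              (subst (Spread v) (sym lens′) spread)
        in L , trans lenL lens′ , basesL , eqL
        where
        rearrange : ∀ a b c d → a + b + (c + d) ≡ c + a + (b + d)
        rearrange = solve-∀
        lens′ : suc (List.length bs₁) + suc (List.length gs₁) ≡ suc (List.length bs + List.length gs)
        lens′ = cong suc (trans (+-suc _ _) lens)

    count-remove : ∀ xs ys i → count i (xs List.++ C ∷ ys) ≡ bit C i + count i (xs List.++ ys)
    count-remove xs ys i = begin-equality
      count i (xs List.++ C ∷ ys)         ≡⟨ total-++ (λ B → bit B i) xs (C ∷ ys) ⟩
      count i xs + (bit C i + count i ys) ≡⟨ rearrange (count i xs) (bit C i) (count i ys) ⟩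
      bit C i + (count i xs + count i ys) ≡⟨ cong (bit C i +_) (total-++ (λ B → bit B i) xs ys) ⟨
      bit C i + count i (xs List.++ ys)   ∎
      where
      rearrange : ∀ a b c → a + (b + c) ≡ b + (a + c)
      rearrange = solve-∀

    length-remove : ∀ xs ys → List.length (xs List.++ C ∷ ys) ≡ suc (List.length (xs List.++ ys))
    length-remove xs ys = trans (length-++ xs) (trans (+-suc _ _) (cong suc (sym (length-++ xs))))

    all-remove : ∀ {P : Subset n → Set} xs {ys} → All P (xs List.++ C ∷ ys) → All P (xs List.++ ys)
    all-remove [] (_ ∷ ps) = ps
    all-remove (_ ∷ xs) (p ∷ ps) = p ∷ all-remove xs ps

    swap : C ∈ˡ bs ⊎ C ∈ˡ gs → Result
    swap (inj₂ C∈gs) with xs , ys , refl ← ∈-∃++ C∈gs = case basis? M ((C - f) ∪ ⁅ e ⁆) of λ where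
        (yes bC′) → put-good {bs} {xs List.++ ys} f∈C f∉H cards bad (all-remove xs good) counts lens bC′ len
        (no ¬bC′) → put-good {bs} {xs List.++ ys} f′∈C f′∉H cards bad (all-remove xs good) counts lens
          (swap-out-of (All.lookup good C∈gs) e∉C f∈C f′∈C f≢f′ ¬bC′) len
      where
      counts : ∀ i → bit C i + (count i bs + count i (xs List.++ ys)) ≡ count i bs + count i (xs List.++ C ∷ ys)
      counts i = trans (rearrange (bit C i) (count i bs) _) (cong (count i bs +_) (sym (count-remove xs ys i)))
        where
        rearrange : ∀ a b c → a + (b + c) ≡ b + (a + c)
        rearrange = solve-∀
      lens : suc (List.length bs + List.length (xs List.++ ys)) ≡ List.length bs + List.length (xs List.++ C ∷ ys)
      lens = trans (sym (+-suc (List.length bs) _)) (cong (List.length bs +_) (sym (length-remove xs ys)))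
    swap (inj₁ C∈bs) with xs , ys , refl ← ∈-∃++ C∈bs = case basis? M ((C - f) ∪ ⁅ e ⁆) of λ where
        (yes bC′) → put-good {xs List.++ ys} {gs} f∈C f∉H
          (all-remove xs cards) (all-remove xs bad) good counts lens bC′ (≤-trans (n≤1+n _) len′)
        (no ¬bC′) → put-bad {xs List.++ ys} {gs} f∈C f∉H
          (all-remove xs cards) (all-remove xs bad) good counts lens ¬bC′ len′
      where
      len′ : suc (List.length (xs List.++ ys)) ≤ m
      len′ = subst (_≤ m) (length-remove xs ys) len
      counts : ∀ i → bit C i + (count i (xs List.++ ys) + count i gs) ≡ count i (xs List.++ C ∷ ys) + count i gs
      counts i = trans (sym (+-assoc (bit C i) _ _)) (cong (_+ count i gs) (sym (count-remove xs ys i)))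
      lens : suc (List.length (xs List.++ ys) + List.length gs) ≡ List.length (xs List.++ C ∷ ys) + List.length gs
      lens = cong (_+ List.length gs) (sym (length-remove xs ys))

-- Relabelling the ground set

relabel : Permutation n m → Matroid m → Matroid n
relabel π N = record
  { Basis    = λ B → Basis N (image π B)
  ; basis?   = λ B → basis? N (image π B)
  ; nonempty = let B , bB = nonempty N in
               image (Perm.flip π) B , subst (Basis N) (sym (image-flip π B)) bB
  ; exchange = exch
  }
  where
  exch : ∀ {A B x} → Basis N (image π A) → Basis N (image π B) → x ∈ A → x ∉ B →
         ∃ λ y → y ∈ B × y ∉ A × Basis N (image π ((A - x) ∪ ⁅ y ⁆))
  exch {A} {B} {x} bA bB x∈A x∉B
    with y , y∈B , y∉A , basis ← exchange N bA bB (∈-image⁺ π x∈A)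
           (λ x∈B → x∉B (subst (_∈ B) (Perm.inverseˡ π) (∈-image⁻ π x∈B))) =
    π ⟨$⟩ˡ y , ∈-image⁻ π y∈B
    , (λ y∈A → y∉A (subst (_∈ image π A) (Perm.inverseʳ π) (∈-image⁺ π y∈A)))
    , subst (Basis N) (⊆-antisym to from) basis
    where
    to : (image π A - (π ⟨$⟩ʳ x)) ∪ ⁅ y ⁆ ⊆ image π ((A - x) ∪ ⁅ π ⟨$⟩ˡ y ⁆)
    to {z} z∈ = subst (_∈ _) (Perm.inverseʳ π) (∈-image⁺ π (x∈p∪q⁺ {p = A - x}
      (case x∈p∪q⁻ (image π A - (π ⟨$⟩ʳ x)) ⁅ y ⁆ z∈ of λ where
        (inj₁ z∈) → let z∈A , z∉x = x∈p─q⁻ {p = image π A} z∈ in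
          inj₁ (x∈p∧x≢y⇒x∈p-y (∈-image⁻ π z∈A) λ { refl →
            z∉x (subst (z ∈_) (cong ⁅_⁆ (sym (Perm.inverseʳ π))) (x∈⁅x⁆ z)) })
        (inj₂ z∈y) → inj₂ (subst (λ w → π ⟨$⟩ˡ w ∈ ⁅ π ⟨$⟩ˡ y ⁆) (sym (x∈⁅y⁆⇒x≡y y z∈y)) (x∈⁅x⁆ _)))))

    from : image π ((A - x) ∪ ⁅ π ⟨$⟩ˡ y ⁆) ⊆ (image π A - (π ⟨$⟩ʳ x)) ∪ ⁅ y ⁆
    from {z} z∈ = x∈p∪q⁺ (case x∈p∪q⁻ (A - x) ⁅ π ⟨$⟩ˡ y ⁆ (∈-image⁻ π z∈) of λ where
      (inj₁ z∈) → let z∈A , z∉x = x∈p─q⁻ {p = A} z∈ in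
        inj₁ (x∈p∧x≢y⇒x∈p-y (subst (_∈ image π A) (Perm.inverseʳ π) (∈-image⁺ π z∈A)) λ { refl →
          z∉x (subst (_∈ ⁅ x ⁆) (sym (Perm.inverseˡ π)) (x∈⁅x⁆ x)) })
      (inj₂ z∈y) → inj₂ (subst (_∈ ⁅ y ⁆)
        (trans (sym (trans (cong (π ⟨$⟩ʳ_) (x∈⁅y⁆⇒x≡y (π ⟨$⟩ˡ y) z∈y)) (Perm.inverseʳ π)))
               (Perm.inverseʳ π)) (x∈⁅x⁆ y)))

relabel-≅ : ∀ (π : Permutation n m) N → relabel π N ≅ N
relabel-≅ π N = π , λ B → mk⇔ (λ b → b) (λ b → b)

bit-image : ∀ (π : Permutation n m) B i → bit (image π B) i ≡ bit B (π ⟨$⟩ˡ i)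
bit-image π B i = cong (λ β → step β 0) (lookup∘tabulate _ i)

sumOver≡sum : ∀ (S : Subset n) v → sumOver S v ≡ sumℕ (λ i → bit S i * v i)
sumOver≡sum []            v = refl
sumOver≡sum (outside ∷ S) v = sumOver≡sum S (v ∘ suc)
sumOver≡sum (inside ∷ S)  v = cong₂ _+_ (sym (+-identityʳ (v zero))) (sumOver≡sum S (v ∘ suc))

sumOver-permute : ∀ (π : Permutation n m) {S T} → (∀ i → lookup T (π ⟨$⟩ʳ i) ≡ lookup S i) →
                  ∀ v → sumOver T (λ i → v (π ⟨$⟩ˡ i)) ≡ sumOver S v
sumOver-permute π {S} {T} eq v = begin
  sumOver T (λ i → v (π ⟨$⟩ˡ i))                          ≡⟨ sumOver≡sum T _ ⟩
  sumℕ (λ i → bit T i * v (π ⟨$⟩ˡ i))                     ≡⟨ sumℕ-permute _ π ⟩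
  sumℕ (λ i → bit T (π ⟨$⟩ʳ i) * v (π ⟨$⟩ˡ (π ⟨$⟩ʳ i)))   ≡⟨ sumℕ-cong (λ i →
    cong₂ (λ β j → step β 0 * v j) (eq i) (Perm.inverseˡ π)) ⟩
  sumℕ (λ i → bit S i * v i)                              ≡⟨ sumOver≡sum S v ⟨
  sumOver S v                                             ∎
  where open ≡-Reasoning

relabel-inChain⇒polytope : ∀ (π : Permutation n m) {c ne x v N} .{{_ : NonZero N}} →
  x isFraction v / N → InChain N K 0 c (λ i → v (π ⟨$⟩ˡ i)) →
  Polytope (relabel π (chain K 0 c ne)) x
relabel-inChain⇒polytope {K = K} π {c} {ne} {x} {v} {N@(suc _)} frac inC
  with L , len , bases , eq ← inChain-average N c _ inC =
  average⇒polytope (relabel π (chain K 0 c ne)) (List.map back L)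
    (subst NonZero (sym len′) _)
    (All.map⁺ (All.map (λ {B} → subst (Path K 0 c) (sym (image-flip π B))) bases))
    λ i → trans (cong (λ N → x i ℚ.* ι N) len′) (trans (frac i) (cong ι (sym (begin
      count i (List.map back L)                 ≡⟨ total-map (λ B → bit B i) back L ⟩
      total (λ B → bit (back B) i) L            ≡⟨ total-cong (λ B → bit-image (Perm.flip π) B i) L ⟩
      count (π ⟨$⟩ʳ i) L                        ≡⟨ eq (π ⟨$⟩ʳ i) ⟩
      v (π ⟨$⟩ˡ (π ⟨$⟩ʳ i))                     ≡⟨ cong v (Perm.inverseˡ π) ⟩
      v i                                       ∎))))
  where
  open ≡-Reasoning
  back = image (Perm.flip π)
  len′ : List.length (List.map back L) ≡ N
  len′ = trans (length-map back L) len

-- Moving a subset to the front of the ground set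

initial : ∀ n → ℕ → Subset n
initial zero    m       = []
initial (suc n) zero    = outside ∷ initial n zero
initial (suc n) (suc m) = inside ∷ initial n m

sorting : ∀ (S : Subset n) → ∃ λ (π : Permutation n n) →
          ∀ i → lookup (initial n ∣ S ∣) (π ⟨$⟩ʳ i) ≡ lookup S i
sorting [] = Perm.id , λ ()
sorting (inside ∷ S) with π , sorted ← sorting S =
  lift₀ π , λ { zero → refl ; (suc i) → sorted i }
sorting {suc n} (outside ∷ S) with π , sorted ← sorting S =
  -- An element outside `S` goes to the last position, which an initial segment of at most `n` of
  -- the `suc n` positions does not reach.
  insert zero (fromℕ n) π , λ
    { zero → initial-last n (∣p∣≤n S)
    ; (suc i) → trans (initial-punchIn n (∣p∣≤n S) (π ⟨$⟩ʳ i)) (sorted i) }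
  where
  initial-last : ∀ n {m} → m ≤ n → lookup (initial (suc n) m) (fromℕ n) ≡ outside
  initial-last zero    {zero}  _         = refl
  initial-last (suc n) {zero}  _         = initial-last n z≤n
  initial-last (suc n) {suc m} (s≤s m≤n) = initial-last n m≤n

  initial-punchIn : ∀ n {m} → m ≤ n → ∀ i →
                    lookup (initial (suc n) m) (punchIn (fromℕ n) i) ≡ lookup (initial n m) i
  initial-punchIn (suc n) {zero}  _         zero    = refl
  initial-punchIn (suc n) {suc m} _         zero    = refl
  initial-punchIn (suc n) {zero}  _         (suc i) = initial-punchIn n z≤n i
  initial-punchIn (suc n) {suc m} (s≤s m≤n) (suc i) = initial-punchIn n m≤n i

sorting-+ : ∀ (S : Subset n) → ∣ S ∣ ≡ m → n ≡ m + h → ∃ λ (π : Permutation n (m + h)) →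
            ∀ i → lookup (initial (m + h) m) (π ⟨$⟩ʳ i) ≡ lookup S i
sorting-+ {m = m} {h} S ∣S∣ refl = subst
  (λ k → ∃ λ (π : Permutation (m + h) (m + h)) → ∀ i → lookup (initial (m + h) k) (π ⟨$⟩ʳ i) ≡ lookup S i)
  ∣S∣ (sorting S)

-- Bases meeting a subset in at most, or exactly, one element

-- With the subset sorted to the front, its intersection with a basis is a prefix count, so the
-- matroid is a chain and its first elements are parallel letters.
atMostOne : ∀ K m h → Vec Interval (m + h)
atMostOne K zero    h = free K h
atMostOne K (suc m) h = (0 , 1) ∷ atMostOne K m h

-- The last of the `suc m` front elements carries the interval `(1 , 1)`, which closes their block.
exactlyOne : ∀ K m h → Vec Interval (suc m + h)
exactlyOne K zero    h = (1 , 1) ∷ free K h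
exactlyOne K (suc m) h = (0 , 1) ∷ exactlyOne K m h

p∩initial-0 : ∀ (p : Subset n) → ∣ p ∩ initial n 0 ∣ ≡ 0
p∩initial-0 []            = refl
p∩initial-0 (outside ∷ p) = p∩initial-0 p
p∩initial-0 (inside ∷ p)  = p∩initial-0 p

atMostOne-path : ∀ {s} m (B : Subset (m + h)) → s ≤ 1 → Path K s (atMostOne K m h) B →
                 s + ∣ B ∩ initial (m + h) m ∣ ≤ 1
atMostOne-path {s = s} zero B s≤1 p rewrite p∩initial-0 B | +-identityʳ s = s≤1
atMostOne-path (suc m) (outside ∷ B) s≤1 (_ , _ , p) = atMostOne-path m B s≤1 p
atMostOne-path {s = s} (suc m) (inside ∷ B) s≤1 (_ , ≤1 , p)
  rewrite +-suc s ∣ B ∩ initial (m + _) m ∣ = atMostOne-path m B ≤1 p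

exactlyOne-path : ∀ {s} m (B : Subset (suc m + h)) → Path K s (exactlyOne K m h) B →
                  s + ∣ B ∩ initial (suc m + h) (suc m) ∣ ≡ 1
exactlyOne-path {s = s} zero (outside ∷ B) (l , h , p)
  rewrite p∩initial-0 B | +-identityʳ s = ≤-antisym h l
exactlyOne-path {s = s} zero (inside ∷ B) (l , h , p)
  rewrite p∩initial-0 B = trans (+-comm s 1) (≤-antisym h l)
exactlyOne-path (suc m) (outside ∷ B) (_ , _ , p) = exactlyOne-path m B p
exactlyOne-path {s = s} (suc m) (inside ∷ B) (_ , _ , p)
  rewrite +-suc s ∣ B ∩ initial (suc m + _) (suc m) ∣ = exactlyOne-path m B p

atMostOne-nonempty : ∀ m → K ≤ h → ∃ (Path K 0 (atMostOne K m h))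
atMostOne-nonempty zero    K≤h = free-path _ z≤n K≤h
atMostOne-nonempty (suc m) K≤h with B , p ← atMostOne-nonempty m K≤h = outside ∷ B , z≤n , z≤n , p

exactlyOne-nonempty : ∀ m → 1 ≤ K → K ≤ suc h → ∃ (Path K 0 (exactlyOne K m h))
exactlyOne-nonempty zero 1≤K K≤1+h with B , p ← free-path _ 1≤K K≤1+h =
  inside ∷ B , ≤-refl , ≤-refl , p
exactlyOne-nonempty (suc m) 1≤K K≤1+h with B , p ← exactlyOne-nonempty m 1≤K K≤1+h =
  outside ∷ B , z≤n , z≤n , p

free-inChain : ∀ {N} h {v : Fin h → ℕ} → (∀ i → v i ≤ N) → S + sumOver ⊤ v ≡ N * K →
               InChain N K S (free K h) v
free-inChain {S = S} zero v≤N total = trans (sym (+-identityʳ S)) total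
free-inChain {S = S} {K} {N} (suc h) {v} v≤N total =
  v≤N zero , subst (_≤ S + v zero) (sym (*-zeroʳ N)) z≤n
  , subst (S + v zero ≤_) total′ (m≤m+n (S + v zero) _)
  , free-inChain h (v≤N ∘ suc) total′
  where
  total′ : S + v zero + sumOver ⊤ (v ∘ suc) ≡ N * K
  total′ = trans (+-assoc S (v zero) _) total

atMostOne-inChain : ∀ {N} m {v : Fin (m + h) → ℕ} → (∀ i → v i ≤ N) → S + sumOver ⊤ v ≡ N * K →
                    S + sumOver (initial (m + h) m) v ≤ N → InChain N K S (atMostOne K m h) v
atMostOne-inChain zero v≤N total ≤N = free-inChain _ v≤N total
atMostOne-inChain {S = S} {N = N} (suc m) {v} v≤N total ≤N =
  v≤N zero , subst (_≤ S + v zero) (sym (*-zeroʳ N)) z≤n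
  , subst (S + v zero ≤_) (sym (*-identityʳ N)) (≤-trans (m≤m+n (S + v zero) _) ≤N′)
  , atMostOne-inChain m (v≤N ∘ suc) (trans (+-assoc S (v zero) _) total) ≤N′
  where
  ≤N′ = subst (_≤ N) (sym (+-assoc S (v zero) _)) ≤N

sumOver-initial-0 : ∀ (v : Fin n → ℕ) → sumOver (initial n 0) v ≡ 0
sumOver-initial-0 {zero}  v = refl
sumOver-initial-0 {suc n} v = sumOver-initial-0 (v ∘ suc)

exactlyOne-inChain : ∀ {N} m {v : Fin (suc m + h) → ℕ} → (∀ i → v i ≤ N) →
                     S + sumOver ⊤ v ≡ N * K → S + sumOver (initial (suc m + h) (suc m)) v ≡ N →
                     InChain N K S (exactlyOne K m h) v
exactlyOne-inChain {S = S} {N = N} zero {v} v≤N total ≡N =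
  v≤N zero , ≤-reflexive (sym S+v₀≡) , ≤-reflexive S+v₀≡
  , free-inChain _ (v≤N ∘ suc) (trans (+-assoc S (v zero) _) total)
  where
  S+v₀≡ : S + v zero ≡ N * 1
  S+v₀≡ = trans (trans (cong (S +_) (sym (trans (cong (v zero +_) (sumOver-initial-0 (v ∘ suc)))
                                               (+-identityʳ (v zero))))) ≡N)
                (sym (*-identityʳ N))
exactlyOne-inChain {S = S} {N = N} (suc m) {v} v≤N total ≡N =
  v≤N zero , subst (_≤ S + v zero) (sym (*-zeroʳ N)) z≤n
  , subst (S + v zero ≤_) (trans ≡N′ (sym (*-identityʳ N))) (m≤m+n (S + v zero) _)
  , exactlyOne-inChain m (v≤N ∘ suc) (trans (+-assoc S (v zero) _) total) ≡N′
  where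
  ≡N′ = trans (+-assoc S (v zero) _) ≡N

-- Sums over subsets at points of base polytopes

sumOver-* : ∀ (S : Subset n) v c → sumOver S (λ i → v i * c) ≡ sumOver S v * c
sumOver-* []            v c = refl
sumOver-* (outside ∷ S) v c = sumOver-* S (v ∘ suc) c
sumOver-* (inside ∷ S)  v c = trans (cong (v zero * c +_) (sumOver-* S (v ∘ suc) c))
                                    (sym (*-distribʳ-+ c (v zero) _))

module _ (M : Matroid n) {x : Point n} v N (frac : x isFraction v / N) (p : Polytope M x)
         (S : Subset n) where

  private
    L = proj₁ (polytope⇒average M p)
    bases = proj₁ (proj₂ (proj₂ (polytope⇒average M p)))
    instance
      nz = proj₁ (proj₂ (polytope⇒average M p))

    scaled : sumOver S v * List.length L ≡ total (λ B → ∣ B ∩ S ∣) L * N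
    scaled = begin
      sumOver S v * List.length L             ≡⟨ sumOver-* S v (List.length L) ⟨
      sumOver S (λ i → v i * List.length L)
        ≡⟨ sumOver-cong S (isFraction-unique x v (λ i → count i L) frac (proj₂ (proj₂ (proj₂ (polytope⇒average M p))))) ⟩
      sumOver S (λ i → count i L * N)         ≡⟨ sumOver-* S (λ i → count i L) N ⟩
      sumOver S (λ i → count i L) * N         ≡⟨ cong (_* N) (sumOver-count S L) ⟩
      total (λ B → ∣ B ∩ S ∣) L * N           ∎
      where open ≡-Reasoning

  sumOver-≤ : ∀ {y} → (∀ {B} → Basis M B → ∣ B ∩ S ∣ ≤ y) → sumOver S v ≤ N * y
  sumOver-≤ bound = scale-≤ scaled (total-≤ (All.map bound bases))

  sumOver-≥ : ∀ {y} → (∀ {B} → Basis M B → y ≤ ∣ B ∩ S ∣) → N * y ≤ sumOver S v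
  sumOver-≥ bound = scale-≥ scaled (total-≥ (All.map bound bases))

module _ (S : Subset n) (∣S∣ : ∣ S ∣ ≡ suc m) (n≡ : n ≡ suc m + h) where

  private
    π : Permutation n (suc m + h)
    π = proj₁ (sorting-+ S ∣S∣ n≡)

    sorted : ∀ i → lookup (initial (suc m + h) (suc m)) (π ⟨$⟩ʳ i) ≡ lookup S i
    sorted = proj₂ (sorting-+ S ∣S∣ n≡)

    card-image : ∀ {S T} → (∀ i → lookup T (π ⟨$⟩ʳ i) ≡ lookup S i) →
                 ∀ B → ∣ image π B ∩ T ∣ ≡ ∣ B ∩ S ∣
    card-image {S} {T} eq B = begin
      ∣ image π B ∩ T ∣                      ≡⟨ sumOver-bit T (image π B) ⟨
      sumOver T (bit (image π B))            ≡⟨ sumOver-cong T (bit-image π B) ⟩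
      sumOver T (λ i → bit B (π ⟨$⟩ˡ i))     ≡⟨ sumOver-permute π {S} {T} eq (bit B) ⟩
      sumOver S (bit B)                      ≡⟨ sumOver-bit S B ⟩
      ∣ B ∩ S ∣                              ∎
      where open ≡-Reasoning

    all-⊤ : ∀ i → lookup ⊤ (π ⟨$⟩ʳ i) ≡ lookup ⊤ i
    all-⊤ i = trans (lookup-replicate (π ⟨$⟩ʳ i) inside) (sym (lookup-replicate i inside))

    card : ∀ {c : Vec Interval (suc m + h)} B → Path K 0 c (image π B) → ∣ B ∣ ≡ K
    card {c = c} B p = begin
      ∣ B ∣                  ≡⟨ cong ∣_∣ (∩-identityʳ B) ⟨
      ∣ B ∩ ⊤ ∣              ≡⟨ card-image all-⊤ B ⟨
      ∣ image π B ∩ ⊤ ∣      ≡⟨ cong ∣_∣ (∩-identityʳ (image π B)) ⟩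
      ∣ image π B ∣          ≡⟨ path-total c (image π B) p ⟩
      _                      ∎
      where open ≡-Reasoning

  module _ (ne : ∃ (Path K 0 (atMostOne K (suc m) h))) where

    AtMostOne : Matroid n
    AtMostOne = relabel π (chain K 0 (atMostOne K (suc m) h) ne)

    AtMostOne-≅ : AtMostOne ≅ chain K 0 (atMostOne K (suc m) h) ne
    AtMostOne-≅ = relabel-≅ π (chain K 0 (atMostOne K (suc m) h) ne)

    AtMostOne-card : ∀ {B} → Basis AtMostOne B → ∣ B ∣ ≡ K
    AtMostOne-card {B} = card B

    AtMostOne-∩ : ∀ {B} → Basis AtMostOne B → ∣ B ∩ S ∣ ≤ 1
    AtMostOne-∩ {B} p = subst (_≤ 1) (card-image sorted B) (atMostOne-path (suc m) (image π B) z≤n p)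

    AtMostOne-polytope : ∀ {x v N} .{{_ : NonZero N}} → x isFraction v / N → (∀ i → v i ≤ N) →
                         sumOver ⊤ v ≡ N * K → sumOver S v ≤ N → Polytope AtMostOne x
    AtMostOne-polytope {v = v} {N} frac v≤N total ≤N = relabel-inChain⇒polytope π {ne = ne} {v = v} frac
      (atMostOne-inChain {S = 0} (suc m) (λ i → v≤N (π ⟨$⟩ˡ i))
        (trans (sumOver-permute π {⊤} {⊤} all-⊤ v) total)
        (subst (_≤ N) (sym (sumOver-permute π {S} {initial (suc m + h) (suc m)} sorted v)) ≤N))

  module _ (ne : ∃ (Path K 0 (exactlyOne K m h))) where

    ExactlyOne : Matroid n
    ExactlyOne = relabel π (chain K 0 (exactlyOne K m h) ne)

    ExactlyOne-≅ : ExactlyOne ≅ chain K 0 (exactlyOne K m h) ne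
    ExactlyOne-≅ = relabel-≅ π (chain K 0 (exactlyOne K m h) ne)

    ExactlyOne-card : ∀ {B} → Basis ExactlyOne B → ∣ B ∣ ≡ K
    ExactlyOne-card {B} = card B

    ExactlyOne-∩ : ∀ {B} → Basis ExactlyOne B → ∣ B ∩ S ∣ ≡ 1
    ExactlyOne-∩ {B} p = trans (sym (card-image sorted B)) (exactlyOne-path m (image π B) p)

    ExactlyOne-polytope : ∀ {x v N} .{{_ : NonZero N}} → x isFraction v / N → (∀ i → v i ≤ N) →
                          sumOver ⊤ v ≡ N * K → sumOver S v ≡ N → Polytope ExactlyOne x
    ExactlyOne-polytope {v = v} {N} frac v≤N total ≡N = relabel-inChain⇒polytope π {ne = ne} {v = v} frac
      (exactlyOne-inChain {S = 0} m (λ i → v≤N (π ⟨$⟩ˡ i))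
        (trans (sumOver-permute π {⊤} {⊤} all-⊤ v) total)
        (trans (sumOver-permute π {S} {initial (suc m + h) (suc m)} sorted v) ≡N))

-- Connectedness of uniform matroids

∣⊤-x-y∣ : ∀ {x y : Fin n} → x ≢ y → suc (suc ∣ ⊤ - x - y ∣) ≡ n
∣⊤-x-y∣ {n} {x} x≢y = trans (cong suc (∣p-x∣ (x∈p∧x≢y⇒x∈p-y ∈⊤ (x≢y ∘ sym))))
                        (trans (∣p-x∣ (∈⊤ {x = x})) (∣⊤∣≡n n))

U-connected : ∀ p → 1 ≤ k → k < n → Connected (U k n p)
U-connected {suc k} {n} p _ k<n i j with i Fin.≟ j
... | yes i≡j = inj₁ i≡j
... | no i≢j with T , T⊆ , ∣T∣ ← subset-of-size (⊤ - i - j) (≤-pred (≤-pred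
        (≤-trans k<n (≤-reflexive (sym (∣⊤-x-y∣ i≢j)))))) =
  swap⇒∼ (U (suc k) n p) {T ∪ ⁅ j ⁆} {i} {j} ∣B∣ i∉B (x∈p∪q⁺ (inj₂ (x∈⁅x⁆ j)))
    (trans (swap-card (x∈p∪q⁺ (inj₂ (x∈⁅x⁆ j))) i∉B) ∣B∣)
  where
  j∉T : j ∉ T
  j∉T j∈ = proj₂ (x∈p─q⁻ {p = ⊤ - i} (T⊆ j∈)) (x∈⁅x⁆ j)
  ∣B∣ : ∣ T ∪ ⁅ j ⁆ ∣ ≡ suc k
  ∣B∣ = trans (∣p∪y∣ j∉T) (cong suc ∣T∣)
  i∉B : i ∉ T ∪ ⁅ j ⁆
  i∉B i∈ = [ (λ i∈T → proj₂ (x∈p─q⁻ {p = ⊤} (proj₁ (x∈p─q⁻ {p = ⊤ - i} (T⊆ i∈T)))) (x∈⁅x⁆ i))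
           , (λ i∈j → i≢j (x∈⁅y⁆⇒x≡y j i∈j)) ]′ (x∈p∪q⁻ T ⁅ j ⁆ i∈)

-- Integer sums

totalℤ : ∀ {A : Set} → (A → ℤ) → List A → ℤ
totalℤ f []       = 0ℤ
totalℤ f (x ∷ xs) = f x ℤ.+ totalℤ f xs

sumℤ-zero : ∀ {s} {f : Fin s → ℤ} → (∀ i → f i ≡ 0ℤ) → sumℤ f ≡ 0ℤ
sumℤ-zero {zero}  eq = refl
sumℤ-zero {suc s} eq = cong₂ ℤ._+_ (eq zero) (sumℤ-zero (eq ∘ suc))

sumℤ-+ : ∀ {s} (f f′ : Fin s → ℤ) → sumℤ (λ i → f i ℤ.+ f′ i) ≡ sumℤ f ℤ.+ sumℤ f′
sumℤ-+ {zero}  f f′ = refl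
sumℤ-+ {suc s} f f′ = trans (cong (ℤ._+_ (f zero ℤ.+ f′ zero)) (sumℤ-+ (f ∘ suc) (f′ ∘ suc)))
  (interchange (f zero) (f′ zero) (sumℤ (f ∘ suc)) (sumℤ (f′ ∘ suc)))
  where
  interchange : ∀ a b c d → a ℤ.+ b ℤ.+ (c ℤ.+ d) ≡ a ℤ.+ c ℤ.+ (b ℤ.+ d)
  interchange = ℤ.solve-∀

sumℤ-single : ∀ {s} (f : ℕ → ℤ) {j} → j < s → (w : Fin s → ℤ) →
              (∀ i → toℕ i ≡ j → w i ≡ 1ℤ) → (∀ i → toℕ i ≢ j → w i ≡ 0ℤ) →
              sumℤ (λ i → w i ℤ.* f (toℕ i)) ≡ f j
sumℤ-single {suc s} f {zero} j<s w on off = begin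
  w zero ℤ.* f 0 ℤ.+ sumℤ (λ i → w (suc i) ℤ.* f (suc (toℕ i)))
    ≡⟨ cong₂ ℤ._+_ (trans (cong (ℤ._* f 0) (on zero refl)) (ℤ.*-identityˡ (f 0)))
         (sumℤ-zero (λ i → trans (cong (ℤ._* f (suc (toℕ i))) (off (suc i) λ ())) (ℤ.*-zeroˡ (f (suc (toℕ i)))))) ⟩
  f 0 ℤ.+ 0ℤ ≡⟨ ℤ.+-identityʳ (f 0) ⟩
  f 0        ∎
  where open ≡-Reasoning
sumℤ-single {suc s} f {suc j} (s≤s j<s) w on off = begin
  w zero ℤ.* f 0 ℤ.+ sumℤ (λ i → w (suc i) ℤ.* f (suc (toℕ i)))
    ≡⟨ cong₂ ℤ._+_ (trans (cong (ℤ._* f 0) (off zero λ ())) (ℤ.*-zeroˡ (f 0)))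
         (sumℤ-single (f ∘ suc) j<s (w ∘ suc) (λ i eq → on (suc i) (cong suc eq))
           (λ i neq → off (suc i) (neq ∘ suc-injective))) ⟩
  0ℤ ℤ.+ f (suc j) ≡⟨ ℤ.+-identityˡ (f (suc j)) ⟩
  f (suc j)        ∎
  where open ≡-Reasoning

-- The values of Λ and Δ

module Pieces (g : ∀ {n} → Matroid n → ℤ[t]) (isG : IsSpeyerG g) where
  open Value g isG

  val-connected : ∀ (M : Matroid n) → Fin n → Connected M → ∀ i → val M i ≡ ℤ.- coeff (g M) i
  val-connected M x conn i = trans (val-def M i) (trans
    (cong (λ c → (-1ℤ ℤ.^ c) ℤ.* coeff (g M) i) (#components-connected M x conn))
    (ℤ.-1*i≡-i (coeff (g M) i)))

  -- All elements of a uniform matroid are free, and the first of them opens a block; this accounts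
  -- for `suc j` against `j`.
  val-U : ∀ {φ} → FreeValue j k φ → 1 ≤ k → ∀ p → val (U k (suc j) p) ≐ φ
  val-U {j = j} {k} fv 1≤k p i = trans
    (val-cong (U k (suc j) p) (chain k 0 (free k (suc j)) ne)
      (λ {B} → path-free (suc j) B) (λ {B} → path-total (free k (suc j)) B) i)
    (freeValue-closed fv 1≤k nil (sym (+-identityʳ k)) ne i)
    where
    ne : ∃ (Path k 0 (free k (suc j)))
    ne = let B , eq = nonempty (U k (suc j) p) in B , path-free (suc j) B eq

  -- Parallel letters change neither the level nor the number of closed blocks, so `m` does not
  -- affect the value.
  val-atMostOne : ∀ {φ z} m → FreeValue h K φ → OpenPrefix z r 0 → ∀ ne →
                  val (chain K 0 (plug z (atMostOne K m h)) ne) ≐ shift r φ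
  val-atMostOne zero    fv p ne = fv p (sym (+-identityʳ _)) ne
  val-atMostOne (suc m) fv p ne = val-atMostOne m fv (par p) ne

  -- The front elements form one closed block, which gives the extra `- t`. It has used one unit of
  -- rank, and the first of the `suc h` free elements opens a new block.
  val-exactlyOne : ∀ {φ z} m → FreeValue h k φ → 1 ≤ k → OpenPrefix z r 0 → ∀ ne →
                   val (chain (suc k) 0 (plug z (exactlyOne (suc k) m (suc h))) ne) ≐ shift (suc r) φ
  val-exactlyOne {k = k} zero fv 1≤k p ne = freeValue-closed fv 1≤k (close p) (+-comm 1 k) ne
  val-exactlyOne (suc m) fv 1≤k p ne = val-exactlyOne m fv 1≤k (par p) ne

  summand : ℕ → ℕ → ℤ[t]
  summand k j = let h = k + j; k≤h = m≤m+n k j in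
    g (U k (suc h) (≤-trans k≤h (n≤1+n h))) +ᵖ t· g (U (k ∸ 1) h (≤-trans (m∸n≤m k 1) k≤h))

  -- With h = k + j, the front of Λ leaves `h` free elements behind an open prefix, as does the
  -- first element of U k (h + 1); both have the value `φ`. Behind its front block Δ has the value
  -- `φ′` of U (k - 1) h. The uniform matroids are connected, so their signed values are the
  -- negatives of the coefficients of `g`.
  val-summand : ∀ k j m → 2 ≤ k → ∀ ne ne′ i →
    val (chain k 0 (atMostOne k (suc (suc m)) (k + j)) ne) i ℤ.-
    val (chain k 0 (exactlyOne k (suc m) (k + j)) ne′) i ≡ ℤ.- coeff (summand k j) i
  val-summand (suc (suc k)) j m (s≤s (s≤s _)) ne ne′ i
    with φ , fv ← freeValue (suc (suc k) + j) (suc (suc k)) (s≤s z≤n) (m≤m+n (suc (suc k)) j)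
       | φ′ , fv′ ← freeValue (suc k + j) (suc k) (s≤s z≤n) (m≤m+n (suc k) j) = begin
    val (chain T 0 (atMostOne T (suc (suc m)) (T + j)) ne) i ℤ.-
    val (chain T 0 (exactlyOne T (suc m) (T + j)) ne′) i
      ≡⟨ cong₂ ℤ._-_ (val-atMostOne (suc m) fv (start nil) ne i)
           (val-exactlyOne m fv′ (s≤s z≤n) (start nil) ne′ i) ⟩
    φ i ℤ.- sh φ′ i
      ≡⟨ cong₂ ℤ._-_ (trans (sym (val-U fv (s≤s z≤n) p i)) (val-connected W zero
             (U-connected p (s≤s z≤n) (s≤s (m≤m+n T j))) i))
           (sh-t i λ i → trans (sym (val-U fv′ (s≤s z≤n) p′ i)) (val-connected W′ zero
             (U-connected p′ (s≤s z≤n) (s≤s (m≤m+n (suc k) j))) i)) ⟩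
    ℤ.- coeff (g W) i ℤ.- coeff (t· g W′) i
      ≡⟨ ℤ.neg-distrib-+ (coeff (g W) i) (coeff (t· g W′) i) ⟨
    ℤ.- (coeff (g W) i ℤ.+ coeff (t· g W′) i)
      ≡⟨ cong ℤ.-_ (coeff-+ᵖ (g W) (t· g W′) i) ⟨
    ℤ.- coeff (summand T j) i ∎
    where
    open ≡-Reasoning
    T = suc (suc k)
    p = ≤-trans (m≤m+n T j) (n≤1+n (T + j))
    p′ = ≤-trans (m∸n≤m T 1) (m≤m+n T j)
    W = U T (suc (T + j)) p
    W′ = U (suc k) (T + j) p′

    sh-t : ∀ {f p} i → (∀ i → f i ≡ ℤ.- coeff p i) → sh f i ≡ coeff (t· p) i
    sh-t zero    eq = refl
    sh-t {p = p} (suc i) eq = trans (cong ℤ.-_ (eq i)) (ℤ.neg-involutive (coeff p i))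

-- The relation between the base polytopes

sumOver-covering : ∀ (H H′ : Subset n) v →
  sumOver ⊤ v ≤ sumOver (∁ H) v + sumOver (∁ H′) v + sumOver (H ∩ H′) v
sumOver-covering []       []        v = z≤n
sumOver-covering (β ∷ H) (β′ ∷ H′) v =
  ≤-trans (+-monoʳ-≤ (v zero) (sumOver-covering H H′ (v ∘ suc))) (add β β′)
  where
  x = sumOver (∁ H) (v ∘ suc)
  y = sumOver (∁ H′) (v ∘ suc)
  z = sumOver (H ∩ H′) (v ∘ suc)
  first : ∀ a x y z → a + (x + y + z) ≡ a + x + y + z
  first = solve-∀
  second : ∀ a x y z → a + (x + y + z) ≡ x + (a + y) + z
  second = solve-∀
  third : ∀ a x y z → a + (x + y + z) ≡ x + y + (a + z)
  third = solve-∀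
  add : ∀ β β′ → v zero + (x + y + z) ≤
        sumOver (∁ (β ∷ H)) v + sumOver (∁ (β′ ∷ H′)) v + sumOver ((β ∷ H) ∩ (β′ ∷ H′)) v
  add inside  inside  = ≤-reflexive (third (v zero) x y z)
  add inside  outside = ≤-reflexive (second (v zero) x y z)
  add outside inside  = ≤-reflexive (first (v zero) x y z)
  add outside outside = ≤-trans (≤-reflexive (first (v zero) x y z))
    (+-monoˡ-≤ z (+-monoʳ-≤ (v zero + x) (m≤n+m y (v zero))))

sumOver-≤-card : ∀ (S : Subset n) {v N} → (∀ i → v i ≤ N) → sumOver S v ≤ ∣ S ∣ * N
sumOver-≤-card []            v≤N = z≤n
sumOver-≤-card (outside ∷ S) v≤N = sumOver-≤-card S (v≤N ∘ suc)
sumOver-≤-card (inside ∷ S)  v≤N = +-mono-≤ (v≤N zero) (sumOver-≤-card S (v≤N ∘ suc))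

classify : ∀ {P : Subset n → Set} (M : Matroid n) {L} → All P L →
  ∃₂ λ bs gs → All P bs × All (λ B → ¬ Basis M B) bs × All (Basis M) gs ×
  List.length bs + List.length gs ≡ List.length L × ∀ i → count i bs + count i gs ≡ count i L
classify M [] = [] , [] , [] , [] , [] , refl , λ i → refl
classify M {B ∷ L} (pB ∷ pL) with bs , gs , ps , bad , good , len , eq ← classify M pL | basis? M B
... | yes bB = bs , B ∷ gs , ps , bad , bB ∷ good , trans (+-suc _ _) (cong suc len) , λ i →
      trans (rearrange (count i bs) (bit B i) (count i gs)) (cong (bit B i +_) (eq i))
  where
  rearrange : ∀ a b c → a + (b + c) ≡ b + (a + c)
  rearrange = solve-∀
... | no ¬bB = B ∷ bs , gs , pB ∷ ps , ¬bB ∷ bad , good , cong suc len , λ i →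
      trans (+-assoc (bit B i) _ _) (cong (bit B i +_) (eq i))

module Relation (M : Matroid n) (paving : Paving M) (connected : Connected M)
                (rank≡ : rank M ≡ suc r) where

  open PavingPolytope M paving rank≡

  Large : Subset n → Set
  Large H = Hyperplane M H × rank M ≤ ∣ H ∣

  large? : ∀ H → Dec (Large H)
  large? H = hyperplane? M H ×-dec (rank M ≤? ∣ H ∣)

  Uₖ : Matroid n
  Uₖ = U (rank M) n (rank≤n M)

  1≤rank : 1 ≤ rank M
  1≤rank = subst (1 ≤_) (sym rank≡) (s≤s z≤n)

  module _ {H} (large : Large H) where

    private
      hyp = proj₁ large

      nonemptyH : Nonempty H
      nonemptyH with nonempty? H
      ... | yes ne = ne
      ... | no empty = ⊥-elim (n≮0 (≤-trans (≤-trans 1≤rank (proj₂ large))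
              (≤-reflexive (trans (cong ∣_∣ (Empty-unique empty)) (∣⊥∣≡0 n)))))

      -- `excess` counts the elements of `H` beyond the rank, `codim` those outside `H` beyond the
      -- two that `hyperplane-codim` guarantees and that the front block of Δ requires.
      excess codim : ℕ
      excess = ∣ H ∣ ∸ rank M
      codim = ∣ ∁ H ∣ ∸ 2

      ∣∁H∣ : ∣ ∁ H ∣ ≡ suc (suc codim)
      ∣∁H∣ = sym (m+[n∸m]≡n (hyperplane-codim M paving connected hyp nonemptyH))

      n≡ : n ≡ suc (suc codim) + (rank M + excess)
      n≡ = begin
        n                      ≡⟨ m∸n+n≡m (∣p∣≤n H) ⟨
        n ∸ ∣ H ∣ + ∣ H ∣      ≡⟨ cong₂ _+_ (trans (sym (∣∁p∣≡n∸∣p∣ H)) ∣∁H∣)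
                                    (sym (m+[n∸m]≡n (proj₂ large))) ⟩
        suc (suc codim) + (rank M + excess) ∎
        where open ≡-Reasoning

      ne : ∃ (Path (rank M) 0 (atMostOne (rank M) (suc (suc codim)) (rank M + excess)))
      ne = atMostOne-nonempty (suc (suc codim)) (m≤m+n (rank M) excess)

      ne′ : ∃ (Path (rank M) 0 (exactlyOne (rank M) (suc codim) (rank M + excess)))
      ne′ = exactlyOne-nonempty (suc codim) 1≤rank (m≤n⇒m≤1+n (m≤m+n (rank M) excess))

    Λ Δ : Matroid n
    Λ = AtMostOne (∁ H) ∣∁H∣ n≡ ne
    Δ = ExactlyOne (∁ H) ∣∁H∣ n≡ ne′

    Λ⊆U : ∀ {x} → Polytope Λ x → Polytope Uₖ x
    Λ⊆U = polytope-mono Λ Uₖ (λ B → AtMostOne-card (∁ H) ∣∁H∣ n≡ ne {B})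

    Δ⊆U : ∀ {x} → Polytope Δ x → Polytope Uₖ x
    Δ⊆U = polytope-mono Δ Uₖ (λ B → ExactlyOne-card (∁ H) ∣∁H∣ n≡ ne′ {B})

    module _ {x : Point n} {v N} .{{nz : NonZero N}} (frac : x isFraction v / N) where

      Λ⇒ : Polytope Λ x → sumOver (∁ H) v ≤ N
      Λ⇒ p = subst (sumOver (∁ H) v ≤_) (*-identityʳ N)
        (sumOver-≤ Λ v N frac p (∁ H) (λ {B} → AtMostOne-∩ (∁ H) ∣∁H∣ n≡ ne {B}))

      Δ⇒ : Polytope Δ x → sumOver (∁ H) v ≡ N
      Δ⇒ p = trans (≤-antisym
        (sumOver-≤ Δ v N frac p (∁ H) (λ {B} bB → ≤-reflexive (ExactlyOne-∩ (∁ H) ∣∁H∣ n≡ ne′ {B} bB)))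
        (sumOver-≥ Δ v N frac p (∁ H) (λ {B} bB → ≤-reflexive (sym (ExactlyOne-∩ (∁ H) ∣∁H∣ n≡ ne′ {B} bB)))))
        (*-identityʳ N)

      module _ (v≤N : ∀ i → v i ≤ N) (total : sumOver ⊤ v ≡ N * rank M) where

        ⇒Λ : sumOver (∁ H) v ≤ N → Polytope Λ x
        ⇒Λ = AtMostOne-polytope (∁ H) ∣∁H∣ n≡ ne {v = v} frac v≤N total

        ⇒Δ : sumOver (∁ H) v ≡ N → Polytope Δ x
        ⇒Δ = ExactlyOne-polytope (∁ H) ∣∁H∣ n≡ ne′ {v = v} frac v≤N total

    module _ (g : ∀ {n} → Matroid n → ℤ[t]) (isG : IsSpeyerG g) where
      open Value g isG
      open Pieces g isG

      val-Λ-Δ : ∀ i → val Λ i ℤ.- val Δ i ≡ ℤ.- coeff (summand (rank M) (∣ H ∣ ∸ rank M)) i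
      val-Λ-Δ i = trans (cong₂ ℤ._-_
          (val-≅ {M = Λ} {N = chain (rank M) 0 (atMostOne (rank M) (suc (suc codim)) (rank M + excess)) ne}
            (AtMostOne-≅ (∁ H) ∣∁H∣ n≡ ne) i)
          (val-≅ {M = Δ} {N = chain (rank M) 0 (exactlyOne (rank M) (suc codim) (rank M + excess)) ne′}
            (ExactlyOne-≅ (∁ H) ∣∁H∣ n≡ ne′) i))
        (val-summand (rank M) excess codim (hyperplane-rank M paving connected hyp nonemptyH) ne ne′ i)

  terms : ∀ {Hs} → All Large Hs → List (ℤ × Matroid n)
  terms []         = []
  terms (lg ∷ lgs) = (-1ℤ , Λ lg) ∷ (1ℤ , Δ lg) ∷ terms lgs

  module _ (ts : List (ℤ × Matroid n)) where
    weight : Fin (List.length ts) → ℤ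
    weight i = proj₁ (List.lookup ts i)
    matroid : Fin (List.length ts) → Matroid n
    matroid i = proj₂ (List.lookup ts i)

  -- The terms of `H` cancel at `x`. The quantifier over `lg` is there because `Λ` and `Δ` are built
  -- from a proof of largeness.
  Balanced : Point n → Subset n → Set
  Balanced x H = ∀ (lg : Large H) → (Polytope (Λ lg) x → Polytope (Δ lg) x) × (Polytope (Δ lg) x → Polytope (Λ lg) x)

  balanced-pair : ∀ {P Q : Set} (p : Dec P) (q : Dec Q) → (P → Q) × (Q → P) → ∀ s →
                  -1ℤ ℤ.* 𝟙 p ℤ.+ (1ℤ ℤ.* 𝟙 q ℤ.+ s) ≡ s
  balanced-pair (yes p) (yes q) _ s = cancel s
    where
    cancel : ∀ s → -1ℤ ℤ.* 1ℤ ℤ.+ (1ℤ ℤ.* 1ℤ ℤ.+ s) ≡ s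
    cancel = ℤ.solve-∀
  balanced-pair (no ¬p) (no ¬q) _ s = trans (ℤ.+-identityˡ _) (ℤ.+-identityˡ s)
  balanced-pair (yes p) (no ¬q) (to , _) s = ⊥-elim (¬q (to p))
  balanced-pair (no ¬p) (yes q) (_ , from) s = ⊥-elim (¬p (from q))

  balanced-sum : ∀ {x Hs} (lgs : All Large Hs) → (∀ {H} → H ∈ˡ Hs → Balanced x H) →
    (d : ∀ i → Dec (Polytope (matroid (terms lgs) i) x)) →
    sumℤ (λ i → weight (terms lgs) i ℤ.* 𝟙 (d i)) ≡ 0ℤ
  balanced-sum [] bal d = refl
  balanced-sum (lg ∷ lgs) bal d = trans
    (balanced-pair (d zero) (d (suc zero)) (bal (here refl) lg) _)
    (balanced-sum lgs (bal ∘ there) (λ i → d (suc (suc i))))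

  unbalanced-pair : ∀ {P Q : Set} {t} (p : Dec P) (q : Dec Q) → P × ¬ Q → t ≡ 0ℤ →
                    -1ℤ ℤ.* 𝟙 p ℤ.+ (1ℤ ℤ.* 𝟙 q ℤ.+ t) ≡ -1ℤ
  unbalanced-pair (yes _) (no _)  _        refl = refl
  unbalanced-pair (yes _) (yes q) (_ , ¬q) _    = ⊥-elim (¬q q)
  unbalanced-pair (no ¬p) _       (p , _)  _    = ⊥-elim (¬p p)

  -- For points strictly above one cut: the value -1 compensates the indicator of the hypersimplex,
  -- as such a point lies outside the base polytope of `M`.
  unbalanced-sum : ∀ {x Hs H₀} (lgs : All Large Hs) → Unique Hs → H₀ ∈ˡ Hs →
    (∀ (lg : Large H₀) → Polytope (Λ lg) x × ¬ Polytope (Δ lg) x) →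
    (∀ {H} → H ≢ H₀ → Balanced x H) →
    (d : ∀ i → Dec (Polytope (matroid (terms lgs) i) x)) →
    sumℤ (λ i → weight (terms lgs) i ℤ.* 𝟙 (d i)) ≡ -1ℤ
  unbalanced-sum {x} (lg ∷ lgs) (H∉ ∷ uniq) (here refl) unbal bal d =
    unbalanced-pair (d zero) (d (suc zero)) (unbal lg)
      (balanced-sum lgs (λ H∈ → bal (λ eq → All.lookup H∉ H∈ (sym eq))) (λ i → d (suc (suc i))))
  unbalanced-sum (lg ∷ lgs) (H∉ ∷ uniq) (there H₀∈) unbal bal d = trans
    (balanced-pair (d zero) (d (suc zero)) (bal (All.lookup H∉ H₀∈) lg) _)
    (unbalanced-sum lgs uniq H₀∈ unbal bal (λ i → d (suc (suc i))))

  larges : List (Subset n)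
  larges = List.filter large? (allSubsets n)

  larges-large : All Large larges
  larges-large = All.all-filter large? (allSubsets n)

  allTerms : List (ℤ × Matroid n)
  allTerms = (1ℤ , Uₖ) ∷ (-1ℤ , M) ∷ terms larges-large

  basis-outside : ∀ {H B} → Hyperplane M H → Basis M B → 1 ≤ ∣ B ∩ ∁ H ∣
  basis-outside {H} {B} hyp bB with nonempty? (B ∩ ∁ H)
  ... | yes (x , x∈) = ≤-trans (s≤s z≤n) (≤-reflexive (∣p-x∣ x∈))
  ... | no empty = ⊥-elim (hyperplane-⊉-basis M hyp bB λ {x} x∈B →
          decidable-stable (x ∈? H) (λ x∉H → empty (x , x∈p∩q⁺ (x∈B , x∉p⇒x∈∁p x∉H))))

  -- A point of the hypersimplex outside the base polytope of M has more than
  -- rank M - 1 on exactly one hyperplane, as distinct ones share at most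
  -- rank M - 2 elements.
  module _ {v : Fin n → ℕ} {N} (v≤N : ∀ i → v i ≤ N) (total : sumOver ⊤ v ≡ N * rank M) where

    violated-unique : ∀ {H H′} → Large H → Large H′ → sumOver (∁ H) v < N → sumOver (∁ H′) v < N → H ≡ H′
    violated-unique {H} {H′} lg lg′ lt lt′ = hyperplane-unique M paving (proj₁ lg) (proj₁ lg′)
      (p∩q⊆p H H′) (p∩q⊆q H H′) (≮⇒≥ λ small → n≮n (N * rank M) (begin-strict
        N * rank M                               ≡⟨ total ⟨
        sumOver ⊤ v                              ≤⟨ sumOver-covering H H′ v ⟩
        sumOver (∁ H) v + sumOver (∁ H′) v + sumOver (H ∩ H′) v
          <⟨ +-mono-<-≤ (+-mono-< lt lt′) (sumOver-≤-card (H ∩ H′) v≤N) ⟩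
        N + N + ∣ H ∩ H′ ∣ * N                   ≡⟨ +-assoc N N _ ⟩
        suc (suc ∣ H ∩ H′ ∣) * N                 ≤⟨ *-monoˡ-≤ N small ⟩
        rank M * N                               ≡⟨ *-comm (rank M) N ⟩
        N * rank M                               ∎))
      where open ≤-Reasoning

  module _ {x : Point n} (p : Polytope Uₖ x) (L : List (Subset n)) {{nz : NonZero (List.length L)}}
           (sizes : All (λ B → ∣ B ∣ ≡ rank M) L)
           (frac : x isFraction (λ i → count i L) / List.length L) where

    private
      N = List.length L
      v : Fin n → ℕ
      v i = count i L

      v≤N : ∀ i → v i ≤ N
      v≤N i = subst (v i ≤_) (*-identityʳ N) (total-≤ (All.universal (λ B → bit≤1 B i) L))

      card-⊤ : ∀ {B : Subset n} → ∣ B ∣ ≡ rank M → ∣ B ∩ ⊤ ∣ ≡ rank M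
      card-⊤ {B} = trans (cong ∣_∣ (∩-identityʳ B))

      total-v : sumOver ⊤ v ≡ N * rank M
      total-v = ≤-antisym
        (sumOver-≤ Uₖ v N frac p ⊤ (λ {B} eq → ≤-reflexive (card-⊤ {B} eq)))
        (sumOver-≥ Uₖ v N frac p ⊤ (λ {B} eq → ≤-reflexive (sym (card-⊤ {B} eq))))

      balanced : ∀ {H} → N ≤ sumOver (∁ H) v → Balanced x H
      balanced N≤ lg =
        (λ q → ⇒Δ lg frac v≤N total-v (≤-antisym (Λ⇒ lg frac q) N≤)) ,
        (λ q → ⇒Λ lg frac v≤N total-v (≤-reflexive (Δ⇒ lg frac q)))

    private
      pair-sum : ∀ {P Q : Set} {t} (p : Dec P) (q : Dec Q) → P →
                 (Q × t ≡ 0ℤ) ⊎ (¬ Q × t ≡ -1ℤ) → 1ℤ ℤ.* 𝟙 p ℤ.+ (-1ℤ ℤ.* 𝟙 q ℤ.+ t) ≡ 0ℤ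
      pair-sum (yes _) (yes _) _ (inj₁ (_ , refl))  = refl
      pair-sum (yes _) (no _)  _ (inj₂ (_ , refl))  = refl
      pair-sum (yes _) (yes q) _ (inj₂ (¬q , _))    = ⊥-elim (¬q q)
      pair-sum (yes _) (no ¬q) _ (inj₁ (q , _))     = ⊥-elim (¬q q)
      pair-sum (no ¬p) _       p _                  = ⊥-elim (¬p p)

      -- The point comes as an average of subsets of size `rank M`. Once the nonbases are exchanged
      -- away, the same average exhibits it in the base polytope of `M`.
      satisfied⇒M : (∀ {H} → H ∈ˡ larges → N ≤ sumOver (∁ H) v) → Polytope M x
      satisfied⇒M N≤ =
        let bs , gs , cards , bad , good , len , eq = classify M sizes
            L′ , len′ , bases , eq′ = spread⇒bases (List.length bs) bs gs ≤-refl cards bad good eq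
              (subst (Spread v) (sym len) λ H hyp le →
                N≤ (∈-filter⁺ large? (∈-allSubsets H) (hyp , le)))
        in average⇒polytope M L′ (subst NonZero (sym (trans len′ len)) nz) bases λ i →
             trans (cong (λ N → x i ℚ.* ι N) (trans len′ len)) (trans (frac i) (cong ι (sym (eq′ i))))

      M⇒satisfied : Polytope M x → ∀ {H} → Hyperplane M H → N ≤ sumOver (∁ H) v
      M⇒satisfied pM {H} hyp = subst (_≤ sumOver (∁ H) v) (*-identityʳ N)
        (sumOver-≥ M v N frac pM (∁ H) (basis-outside hyp))

    relation-inside : (d : ∀ i → Dec (Polytope (matroid allTerms i) x)) →
                      sumℤ (λ i → weight allTerms i ℤ.* 𝟙 (d i)) ≡ 0ℤ
    relation-inside d = pair-sum (d zero) (d (suc zero)) p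
      (by-cases (Any.any? (λ H → sumOver (∁ H) v <? N) larges))
      where
      rest : ℤ
      rest = sumℤ (λ i → weight (terms larges-large) i ℤ.* 𝟙 (d (suc (suc i))))

      by-cases : Dec (Any.Any (λ H → sumOver (∁ H) v < N) larges) →
                 (Polytope M x × rest ≡ 0ℤ) ⊎ (¬ Polytope M x × rest ≡ -1ℤ)
      by-cases (yes violated) = let H₀ , H₀∈ , lt = find violated
                                    lg₀ = All.lookup larges-large H₀∈ in
        inj₂ ((λ pM → <⇒≱ lt (M⇒satisfied pM (proj₁ lg₀))) ,
          unbalanced-sum larges-large (Unique.filter⁺ large? (allSubsets-unique n)) H₀∈
            (λ lg → ⇒Λ lg frac v≤N total-v (<⇒≤ lt) , λ q → <⇒≢ lt (Δ⇒ lg frac q))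
            (λ {H} H≢H₀ lg → balanced (≮⇒≥ λ lt′ →
              H≢H₀ (violated-unique v≤N total-v lg lg₀ lt′ lt)) lg)
            (λ i → d (suc (suc i))))
      by-cases (no satisfied) =
        inj₁ (satisfied⇒M N≤ ,
          balanced-sum larges-large (λ H∈ → balanced (N≤ H∈)) (λ i → d (suc (suc i))))
        where
        N≤ : ∀ {H} → H ∈ˡ larges → N ≤ sumOver (∁ H) v
        N≤ H∈ = ≮⇒≥ λ lt → satisfied (Any.map (λ { refl → lt }) H∈)

  relation : IndicatorRelation (matroid allTerms) (weight allTerms)
  relation x d = by-cases (d zero)
    where
    sum-M : ∀ {P Q : Set} {s} (p : Dec P) (q : Dec Q) → ¬ P → ¬ Q → s ≡ 0ℤ →
            1ℤ ℤ.* 𝟙 p ℤ.+ (-1ℤ ℤ.* 𝟙 q ℤ.+ s) ≡ 0ℤ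
    sum-M (no _)  (no _)  _  _  refl = refl
    sum-M (yes p) _       ¬p _  _    = ⊥-elim (¬p p)
    sum-M (no _)  (yes q) _  ¬q _    = ⊥-elim (¬q q)

    by-cases : Dec (Polytope Uₖ x) → sumℤ (λ i → weight allTerms i ℤ.* 𝟙 (d i)) ≡ 0ℤ
    by-cases (yes p) = let L , nz , sizes , frac = polytope⇒average Uₖ p in
      relation-inside p L {{nz}} sizes frac d
    -- Outside the hypersimplex every indicator vanishes, so balance holds vacuously.
    by-cases (no ¬p) = sum-M (d zero) (d (suc zero)) ¬p
      (λ q → ¬p (polytope-mono M Uₖ (λ B → basis-card M) q))
      (balanced-sum larges-large
        (λ _ lg → (λ q → ⊥-elim (¬p (Λ⊆U lg q))) , (λ q → ⊥-elim (¬p (Δ⊆U lg q))))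
        (λ i → d (suc (suc i))))

  module _ (g : ∀ {n} → Matroid n → ℤ[t]) (isG : IsSpeyerG g) where
    open Value g isG
    open Pieces g isG

    sum-terms : ∀ {Hs} (lgs : All Large Hs) i →
      sumℤ (λ j → weight (terms lgs) j ℤ.* val (matroid (terms lgs) j) i) ≡
      totalℤ (λ H → coeff (summand (rank M) (∣ H ∣ ∸ rank M)) i) Hs
    sum-terms [] i = refl
    sum-terms {H ∷ Hs} (lg ∷ lgs) i = begin
      -1ℤ ℤ.* val (Λ lg) i ℤ.+ (1ℤ ℤ.* val (Δ lg) i ℤ.+ rest)
        ≡⟨ regroup (val (Λ lg) i) (val (Δ lg) i) rest ⟩
      ℤ.- (val (Λ lg) i ℤ.- val (Δ lg) i) ℤ.+ rest
        ≡⟨ cong₂ ℤ._+_ (trans (cong ℤ.-_ (val-Λ-Δ lg g isG i)) (ℤ.neg-involutive _)) (sum-terms lgs i) ⟩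
      totalℤ (λ H → coeff (summand (rank M) (∣ H ∣ ∸ rank M)) i) (H ∷ Hs) ∎
      where
      open ≡-Reasoning
      rest = sumℤ (λ j → weight (terms lgs) j ℤ.* val (matroid (terms lgs) j) i)
      regroup : ∀ a b c → -1ℤ ℤ.* a ℤ.+ (1ℤ ℤ.* b ℤ.+ c) ≡ ℤ.- (a ℤ.- b) ℤ.+ c
      regroup = ℤ.solve-∀

    -- A rank below `n` makes `Uₖ` connected. It then enters with the same sign as `M`, and `n` is
    -- positive, so there is an element to name the only component.
    coeff-g : rank M < n → ∀ i → coeff (g M) i ≡
              coeff (g Uₖ) i ℤ.- totalℤ (λ H → coeff (summand (rank M) (∣ H ∣ ∸ rank M)) i) larges
    coeff-g rank<n i = solve (coeff (g M) i) (coeff (g Uₖ) i) _ (begin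
      1ℤ ℤ.* (ℤ.- coeff (g Uₖ) i) ℤ.+ (-1ℤ ℤ.* (ℤ.- coeff (g M) i) ℤ.+ totalℤ _ larges)
        ≡⟨ cong₂ ℤ._+_ (cong (ℤ._*_ 1ℤ) (sym (val-connected Uₖ (Fin.fromℕ< rank<n)
               (U-connected (rank≤n M) 1≤rank rank<n) i)))
             (cong₂ ℤ._+_ (cong (ℤ._*_ -1ℤ) (sym (val-connected M (Fin.fromℕ< rank<n) connected i)))
               (sym (sum-terms larges-large i))) ⟩
      sumℤ (λ j → weight allTerms j ℤ.* val (matroid allTerms j) i)
        ≡⟨ val-valuation (matroid allTerms) (weight allTerms) relation i ⟩
      0ℤ ∎)
      where
      open ≡-Reasoning
      solve : ∀ a b c → 1ℤ ℤ.* (ℤ.- b) ℤ.+ (-1ℤ ℤ.* (ℤ.- a) ℤ.+ c) ≡ 0ℤ → a ≡ b ℤ.- c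
      solve a b c eq = trans (isolate a b c) (trans (cong (ℤ._+ (b ℤ.- c)) eq) (ℤ.+-identityˡ _))
        where
        isolate : ∀ a b c → a ≡ 1ℤ ℤ.* (ℤ.- b) ℤ.+ (-1ℤ ℤ.* (ℤ.- a) ℤ.+ c) ℤ.+ (b ℤ.- c)
        isolate = ℤ.solve-∀

-- Counting hyperplanes by size

hyperplane-card< : ∀ (M : Matroid n) {H} → Hyperplane M H → ∣ H ∣ < n
hyperplane-card< M {H} (_ , eq) = ≤∧≢⇒< (∣p∣≤n H) λ ∣H∣≡n →
  1+n≢n (trans eq (cong (rk M) (sym (∣p∣≡n⇒p≡⊤ ∣H∣≡n))))

module _ (M : Matroid n) (φ : ℕ → ℤ) where

  private
    ρ = rank M

    large : ∀ H → Dec (Hyperplane M H × ρ ≤ ∣ H ∣)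
    large H = hyperplane? M H ×-dec (ρ ≤? ∣ H ∣)

    ofSize : ∀ s H → Dec (Hyperplane M H × ∣ H ∣ ≡ s)
    ofSize s H = hyperplane? M H ×-dec (∣ H ∣ ≟ s)

    #ofSize : ℕ → List (Subset n) → ℤ
    #ofSize s Ss = ℤ.+ List.length (List.filter (ofSize s) Ss)

    #ofSize-yes : ∀ {s H} Ss → Hyperplane M H × ∣ H ∣ ≡ s → #ofSize s (H ∷ Ss) ≡ 1ℤ ℤ.+ #ofSize s Ss
    #ofSize-yes Ss p = cong (λ L → ℤ.+ List.length L) (filter-accept (ofSize _) p)

    #ofSize-no : ∀ {s H} Ss → ¬ (Hyperplane M H × ∣ H ∣ ≡ s) → #ofSize s (H ∷ Ss) ≡ #ofSize s Ss
    #ofSize-no Ss ¬p = cong (λ L → ℤ.+ List.length L) (filter-reject (ofSize _) ¬p)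

  -- A large hyperplane is counted only in the summand of index `∣ H ∣ ∸ ρ`, which lies in the range
  -- of summation because `H` is a proper subset.
  group-by-size : ∀ Ss → totalℤ (λ H → φ (∣ H ∣ ∸ ρ)) (List.filter large Ss) ≡
                  sumℤ {n ∸ ρ} (λ i → #ofSize (ρ + toℕ i) Ss ℤ.* φ (toℕ i))
  group-by-size [] = sym (sumℤ-zero {n ∸ ρ} (λ i → ℤ.*-zeroˡ (φ (toℕ i))))
  group-by-size (H ∷ Ss) = by-cases (large H)
    where
    open ≡-Reasoning

    by-cases : Dec (Hyperplane M H × ρ ≤ ∣ H ∣) →
               totalℤ (λ H → φ (∣ H ∣ ∸ ρ)) (List.filter large (H ∷ Ss)) ≡
               sumℤ {n ∸ ρ} (λ i → #ofSize (ρ + toℕ i) (H ∷ Ss) ℤ.* φ (toℕ i))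
    by-cases (no ¬large) = begin
      totalℤ (λ H → φ (∣ H ∣ ∸ ρ)) (List.filter large (H ∷ Ss))
        ≡⟨ cong (totalℤ (λ H → φ (∣ H ∣ ∸ ρ))) (filter-reject large ¬large) ⟩
      totalℤ (λ H → φ (∣ H ∣ ∸ ρ)) (List.filter large Ss)
        ≡⟨ group-by-size Ss ⟩
      sumℤ {n ∸ ρ} (λ i → #ofSize (ρ + toℕ i) Ss ℤ.* φ (toℕ i))
        ≡⟨ sumℤ-cong {n ∸ ρ} (λ i → cong (ℤ._* φ (toℕ i)) (sym (#ofSize-no Ss
             λ (hyp , eq) → ¬large (hyp , subst (ρ ≤_) (sym eq) (m≤m+n ρ (toℕ i)))))) ⟩
      sumℤ {n ∸ ρ} (λ i → #ofSize (ρ + toℕ i) (H ∷ Ss) ℤ.* φ (toℕ i)) ∎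
    by-cases (yes lg@(hyp , ρ≤)) = begin
      totalℤ (λ H → φ (∣ H ∣ ∸ ρ)) (List.filter large (H ∷ Ss))
        ≡⟨ cong (totalℤ (λ H → φ (∣ H ∣ ∸ ρ))) (filter-accept large lg) ⟩
      φ (∣ H ∣ ∸ ρ) ℤ.+ totalℤ (λ H → φ (∣ H ∣ ∸ ρ)) (List.filter large Ss)
        ≡⟨ cong₂ ℤ._+_ (sym (sumℤ-single {n ∸ ρ} φ (∸-monoˡ-< (hyperplane-card< M hyp) ρ≤)
             indicator (λ i → proj₁ (indicator-spec i)) (λ i → proj₂ (indicator-spec i))))
             (group-by-size Ss) ⟩
      sumℤ {n ∸ ρ} (λ i → indicator i ℤ.* φ (toℕ i)) ℤ.+
      sumℤ {n ∸ ρ} (λ i → #ofSize (ρ + toℕ i) Ss ℤ.* φ (toℕ i))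
        ≡⟨ sumℤ-+ {n ∸ ρ} (λ i → indicator i ℤ.* φ (toℕ i)) _ ⟨
      sumℤ {n ∸ ρ} (λ i → indicator i ℤ.* φ (toℕ i) ℤ.+ #ofSize (ρ + toℕ i) Ss ℤ.* φ (toℕ i))
        ≡⟨ sumℤ-cong {n ∸ ρ} (λ i → trans
             (sym (ℤ.*-distribʳ-+ (φ (toℕ i)) (indicator i) (#ofSize (ρ + toℕ i) Ss)))
             (cong (ℤ._* φ (toℕ i)) (indicator-# i))) ⟩
      sumℤ {n ∸ ρ} (λ i → #ofSize (ρ + toℕ i) (H ∷ Ss) ℤ.* φ (toℕ i)) ∎
      where
      indicator : Fin (n ∸ ρ) → ℤ
      indicator i = 𝟙 (toℕ i ≟ ∣ H ∣ ∸ ρ)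

      indicator-spec : ∀ i → (toℕ i ≡ ∣ H ∣ ∸ ρ → indicator i ≡ 1ℤ) × (toℕ i ≢ ∣ H ∣ ∸ ρ → indicator i ≡ 0ℤ)
      indicator-spec i = spec (toℕ i ≟ ∣ H ∣ ∸ ρ)
        where
        spec : ∀ {P : Set} (P? : Dec P) → (P → 𝟙 P? ≡ 1ℤ) × (¬ P → 𝟙 P? ≡ 0ℤ)
        spec (yes p) = (λ _ → refl) , (λ ¬p → ⊥-elim (¬p p))
        spec (no ¬p) = (λ p → ⊥-elim (¬p p)) , (λ _ → refl)

      indicator-# : ∀ i → indicator i ℤ.+ #ofSize (ρ + toℕ i) Ss ≡ #ofSize (ρ + toℕ i) (H ∷ Ss)
      indicator-# i = go (toℕ i ≟ ∣ H ∣ ∸ ρ)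
        where
        go : Dec (toℕ i ≡ ∣ H ∣ ∸ ρ) → indicator i ℤ.+ #ofSize (ρ + toℕ i) Ss ≡ #ofSize (ρ + toℕ i) (H ∷ Ss)
        go (yes eq) = trans (cong (ℤ._+ #ofSize (ρ + toℕ i) Ss) (proj₁ (indicator-spec i) eq))
          (sym (#ofSize-yes Ss (hyp , trans (sym (m+[n∸m]≡n ρ≤)) (cong (ρ +_) (sym eq)))))
        go (no neq) = trans (cong (ℤ._+ #ofSize (ρ + toℕ i) Ss) (proj₂ (indicator-spec i) neq))
          (trans (ℤ.+-identityˡ _) (sym (#ofSize-no Ss λ (_ , eq) →
            neq (trans (sym (m+n∸m≡n ρ (toℕ i))) (cong (_∸ ρ) (sym eq))))))

-- The formula, including the extreme ranks

module _ (g : ∀ {n} → Matroid n → ℤ[t]) (isG : IsSpeyerG g) where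
  open Pieces g isG

  hyperplaneSum : Matroid n → ℕ → ℤ
  hyperplaneSum {n = n} M i = sumℤ {n ∸ rank M} (λ j →
    (ℤ.+ #hyperplanes M (rank M + toℕ j)) ℤ.* coeff (summand (rank M) (toℕ j)) i)

  coeff-formula : ∀ (M : Matroid n) i →
    coeff (g (U (rank M) n (rank≤n M)) -ᵖ sum {n ∸ rank M} (λ j →
      #hyperplanes M (rank M + toℕ j) · summand (rank M) (toℕ j))) i ≡
    coeff (g (U (rank M) n (rank≤n M))) i ℤ.- hyperplaneSum M i
  coeff-formula {n = n} M i = trans (coeff-+ᵖ (g (U _ _ (rank≤n M))) (-ᵖ sum term) i)
    (cong (ℤ._+_ (coeff (g (U _ _ (rank≤n M))) i)) (trans (coeff--ᵖ (sum term) i)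
      (cong ℤ.-_ (trans (coeff-sum term i)
        (sumℤ-cong {n ∸ rank M} λ j → coeff-· (#hyperplanes M (rank M + toℕ j)) (summand (rank M) (toℕ j)) i)))))
    where
    term : Fin (n ∸ rank M) → ℤ[t]
    term j = #hyperplanes M (rank M + toℕ j) · summand (rank M) (toℕ j)

  -- For the ranks `0` and `n`, which the relation of polytopes leaves aside. In rank `0` there are
  -- no hyperplanes, in rank `n` the range of summation is empty, and in both cases `M` is uniform.
  formula-uniform : ∀ (M : Matroid n) → (∀ {B} → ∣ B ∣ ≡ rank M → Basis M B) →
    (∀ (j : Fin (n ∸ rank M)) → #hyperplanes M (rank M + toℕ j) ≡ 0) → ∀ i →
    coeff (g M) i ≡ coeff (g (U (rank M) n (rank≤n M))) i ℤ.- hyperplaneSum M i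
  formula-uniform {n = n} M uniform none i = begin
    coeff (g M) i
      ≡⟨ coeff-≡ (IsSpeyerG.invariant isG (sum-≅ {M = M} {N = Uₖ} refl λ B → mk⇔ (basis-card M) uniform)) i ⟩
    coeff (g Uₖ) i
      ≡⟨ ℤ.+-identityʳ _ ⟨
    coeff (g Uₖ) i ℤ.- 0ℤ
      ≡⟨ cong (λ s → coeff (g Uₖ) i ℤ.- s) (sym (sumℤ-zero {n ∸ rank M} λ j → trans
           (cong (λ c → (ℤ.+ c) ℤ.* coeff (summand (rank M) (toℕ j)) i) (none j))
           (ℤ.*-zeroˡ (coeff (summand (rank M) (toℕ j)) i)))) ⟩
    coeff (g Uₖ) i ℤ.- hyperplaneSum M i ∎
    where
    open ≡-Reasoning
    Uₖ = U (rank M) n (rank≤n M)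

  formula : ∀ (M : Matroid n) → Connected M → Paving M → ∀ i →
    coeff (g M) i ≡ coeff (g (U (rank M) n (rank≤n M))) i ℤ.- hyperplaneSum M i
  formula {n} M connected paving i = by-cases (rank M) refl (m≤n⇒m<n∨m≡n (rank≤n M))
    where
    by-cases : ∀ r → rank M ≡ r → rank M < n ⊎ rank M ≡ n →
      coeff (g M) i ≡ coeff (g (U (rank M) n (rank≤n M))) i ℤ.- hyperplaneSum M i
    by-cases zero rank≡0 _ = formula-uniform M
      (λ {B} eq → independent-card⇒basis M
        (_ , proj₂ (nonempty M) , λ {x} x∈B →
          ⊥-elim (n≮0 (subst (1 ≤_) (trans (∣p-x∣ x∈B) (trans eq rank≡0)) (s≤s z≤n)))) eq)
      (λ j → #subsets-enumerated (λ H → hyperplane? M H ×-dec (∣ H ∣ ≟ rank M + toℕ j)) (λ ()) (λ { {()} }) (λ ())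
        λ { ((_ , eq) , _) → ⊥-elim (1+n≢0 (trans eq rank≡0)) })
      i
    by-cases (suc r) rank≡ (inj₁ rank<n) = trans
      (Relation.coeff-g M paving connected rank≡ g isG rank<n i)
      (cong (λ s → coeff (g (U (rank M) n (rank≤n M))) i ℤ.- s)
        (group-by-size M (λ j → coeff (summand (rank M) j) i) (allSubsets n)))
    by-cases (suc r) _ (inj₂ rank≡n) = formula-uniform M
      (λ {B} eq → let A , bA = nonempty M in subst (Basis M)
        (trans (∣p∣≡n⇒p≡⊤ (trans (basis-card M bA) rank≡n)) (sym (∣p∣≡n⇒p≡⊤ (trans eq rank≡n)))) bA)
      (λ j → ⊥-elim (n≮0 (subst (toℕ j <_) (trans (cong (n ∸_) rank≡n) (n∸n≡0 n)) (Fin.toℕ<n j))))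
      i

theorem9p18 :
    (g : ∀ {n} → Matroid n → ℤ[t]) → IsSpeyerG g →
    ∀ {n} (M : Matroid n) → Connected M → Paving M →
    let k   = rank M
        k≤n = rank≤n M
    in g M ≈ g (U k n k≤n) -ᵖ
             (∑[ i < n ∸ k ]
               (let h = k ℕ.+ toℕ i
                    k≤h = m≤m+n k (toℕ i)
                in #hyperplanes M h ·
                   (g (U k (suc h) (≤-trans k≤h (n≤1+n h)))
                    +ᵖ t· g (U (k ∸ 1) h (≤-trans (m∸n≤m k 1) k≤h)))))
theorem9p18 g isG M connected paving = mk≈ λ i →
  trans (formula g isG M connected paving i) (sym (coeff-formula g isG M i))
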